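{- Let $\nu=(\nu_1,\dots,\nu_\ell)$ be an integer partition, $\mu$ a strict partition and $Q$ a symmetric function. Then there exists $r\in\mathbb{N}$ such that $$D^r\Bigl(\frac{Q\bigl(\binom{c_\square}{2}:\square\in\lambda\bigr)\,q_\nu(\lambda)}{H_\lambda}\Bigr)=0$$ for every strict partition $\lambda$. Consequently, $$P(n)=\sum_{|\lambda/\mu|=n}\frac{2^{|\lambda|-|\mu|-\ell(\lambda)+\ell(\mu)}f_{\lambda/\mu}}{H_\lambda}\,Q\Bigl(\tbinom{c_\square}{2}:\square\in\lambda\Bigr)\,q_\nu(\lambda)$$ is a polynomial in $n$, where the sum ranges over strict partitions $\lambda\supseteq\mu$ with $|\lambda|-|\mu|=n$.
   Context: A strict partition is a finite strictly decreasing sequence of positive integers $\lambda=(\lambda_1>\cdots>\lambda_\ell)$ (the empty sequence is allowed); $|\lambda|=\sum_i\lambda_i$, $\ell(\lambda)=\ell$, and $\lambda_i=0$ for $i>\ell(\lambda)$. The (shifted Young) diagram of $\lambda$ is the set of boxes $(i,j)$ with $1\le i\le\ell(\lambda)$, $i+1\le j\le i+\lambda_i$ (row $i$, column $j$); $\lambda$ is identified with its diagram. The content of $\square=(i,j)$ is $c_\square=j-i$. The hook length $h_\square$ of $\square=(i,j)\in\lambda$ is the number of boxes of $\lambda$ in row $i$ strictly to the right of $\square$, plus the number of boxes $(i',j)\in\lambda$ with $i'>i$, plus $1$, plus $\lambda_j$; $H_\lambda=\prod_{\square\in\lambda}h_\square$ ($H_\emptyset=1$). Write $\lambda\supseteq\mu$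 if $\lambda_i\ge\mu_i$ for all $i$; $\lambda/\mu$ is the set of boxes of $\lambda$ not in $\mu$, $|\lambda/\mu|=|\lambda|-|\mu|$. $f_{\lambda/\mu}$ is the number of standard shifted Young tableaux of shape $\lambda/\mu$ (bijective fillings of the boxes of $\lambda/\mu$ with $1,\dots,|\lambda/\mu|$ increasing along rows left to right and columns top to bottom; $f_{\mu/\mu}=1$). $Q(\binom{c_\square}{2}:\square\in\lambda)$ means $Q$ evaluated with $|\lambda|$ of its variables specialized to $\binom{c_\square}{2}$, $\square\in\lambda$, and all other variables to $0$. An outer corner of $\lambda$ is a box of $\lambda$ whose removal leaves the diagram of a strict partition; let $(\alpha_1,\beta_1),\dots,(\alpha_m,\beta_m)$ be the outer corners with $\alpha_1>\cdots>\alpha_m$, $y_j=\beta_j-\alpha_j$; set $\alpha_{m+1}=0$, $\beta_0=\ell(\lambda)+1$, $x_i=\beta_i-\alpha_{i+1}$ ($0\le i\le m$). $q_k(\lambda)=\sum_{i=0}^m\binom{x_i}{2}^k-\sum_{i=1}^m\binom{y_i}{2}^k$ and $q_\nu(\lambda)=\prod_{j=1}^\ell q_{\nu_j}(\lambda)$ ($q_\emptyset=1$). $\lambda^+$ ranges over strict partitions obtained from $\lambda$ by adding one box; $DG(\lambda)=\sum_{\lambda^+:\ell(\lambda^+)>\ell(\lambda)}G(\lambda^+)+2\sum_{\lambda^+:\ell(\lambda^+)=\ell(\lambda)}G(\lambda^+)-G(\lambda)$, and $D^r$ is its $r$-th iterate. -}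

module Defs where

open import Data.Nat.Base using (ℕ; zero; suc; _+_; _*_; _∸_; _^_; _≤_; _<_; _>_; _≥_; NonZero)
open import Data.Nat.Properties using (_≟_; _<?_; _≤?_; _>?_)
open import Data.Nat.Combinatorics using (_C_)
open import Data.Nat.ListAction using (sum; product)
open import Data.Nat.ListAction.Properties using (product≢0)
open import Data.Integer.Base using (+_)
open import Data.Rational.Base as ℚ using (ℚ; 0ℚ; 1ℚ; _/_)
open import Data.List.Base using (List; []; _∷_; [_]; _++_; map; concatMap; cartesianProductWith; filter;
  foldr; length; mapMaybe; reverse; upTo; zip; zipWith)
open import Data.List.Properties using (≡-dec)
open import Data.List.Relation.Unary.All using (All; []; _∷_; all?)
open import Data.List.Relation.Unary.Any using (Any; any?)
open import Data.List.Relation.Unary.Linked using (Linked; linked?)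
open import Data.List.Relation.Unary.Unique.DecPropositional _≟_ using (Unique; unique?)
open import Data.List.Relation.Binary.Permutation.Propositional using (_↭_)
open import Data.Maybe.Base using (Maybe; just; nothing)
open import Data.Product.Base using (_×_; _,_; proj₁; proj₂)
import Data.Product.Properties as Product
import Data.List.Membership.DecPropositional as DecMembership
open import Relation.Nullary.Decidable using (Dec; yes; no; _×-dec_; _→-dec_; ¬?)
open import Relation.Unary using (Decidable)
open import Relation.Binary.Definitions using (DecidableEquality)
open import Relation.Binary.PropositionalEquality using (_≡_)

fromℕ : ℕ → ℚ
fromℕ n = + n / 1

∑ : {A : Set} → List A → (A → ℚ) → ℚ
∑ xs f = foldr (λ x s → f x ℚ.+ s) 0ℚ xs

∏ : {A : Set} → List A → (A → ℚ) → ℚ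
∏ xs f = foldr (λ x s → f x ℚ.* s) 1ℚ xs

-- c₀ ∷ c₁ ∷ c₂ ∷ … is the polynomial c₀ + c₁ x + c₂ x² + ….
Polynomial : Set
Polynomial = List ℚ

evalPoly : Polynomial → ℚ → ℚ
evalPoly p x = foldr (λ c v → c ℚ.+ x ℚ.* v) 0ℚ p

range : ℕ → List ℕ
range n = map suc (upTo n)

words : {A : Set} → List A → ℕ → List (List A)
words as zero    = [ [] ]
words as (suc k) = cartesianProductWith _∷_ as (words as k)

record Partition : Set where
  constructor mkPartition
  field
    parts              : List ℕ
    .weaklyDecreasing  : Linked _≥_ parts
    .positive          : All (0 <_) parts

IsStrict : List ℕ → Set
IsStrict xs = Linked _>_ xs × All (0 <_) xs

isStrict? : Decidable IsStrict
isStrict? xs = linked? _>?_ xs ×-dec all? (0 <?_) xs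

-- The irrelevant field makes equality of strict partitions equality of parts.
record StrictPartition : Set where
  constructor mkStrict
  field
    parts     : List ℕ
    .isStrict : IsStrict parts

open StrictPartition using (parts)

size : StrictPartition → ℕ
size ρ = sum (parts ρ)

ℓ : StrictPartition → ℕ
ℓ ρ = length (parts ρ)

-- 1-based lookup, with value 0 past the end; index 0 is never used.
nth : List ℕ → ℕ → ℕ
nth []       _             = 0
nth (x ∷ xs) 0             = 0
nth (x ∷ xs) 1             = x
nth (x ∷ xs) (suc (suc i)) = nth xs (suc i)

part : StrictPartition → ℕ → ℕ
part ρ = nth (parts ρ)

toStrict : List ℕ → Maybe StrictPartition
toStrict xs with isStrict? xs
... | yes s = just (mkStrict xs s)
... | no _  = nothing

-- All strictly decreasing lists with entries in {1,…,m}, each once.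
decreasing : ℕ → List (List ℕ)
decreasing zero    = [ [] ]
decreasing (suc m) = map (suc m ∷_) (decreasing m) ++ decreasing m

-- All strict partitions of n, each once (toStrict never discards anything here).
strictPartitions : ℕ → List StrictPartition
strictPartitions n = mapMaybe toStrict (filter (λ xs → sum xs ≟ n) (decreasing n))

-- For i > ℓ(μ) the condition μᵢ ≤ ρᵢ reads 0 ≤ ρᵢ.
_⊆_ : StrictPartition → StrictPartition → Set
μ ⊆ ρ = All (λ i → part μ i ≤ part ρ i) (range (ℓ μ))

_⊆?_ : ∀ μ ρ → Dec (μ ⊆ ρ)
μ ⊆? ρ = all? (λ i → part μ i ≤? part ρ i) (range (ℓ μ))

-- The strict partitions ρ ⊇ μ with |ρ| - |μ| = n.
above : StrictPartition → ℕ → List StrictPartition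
above μ n = filter (μ ⊆?_) (strictPartitions (size μ + n))

-- (row , column), both counted from 1.
Box : Set
Box = ℕ × ℕ

row col : Box → ℕ
row = proj₁
col = proj₂

_≟ᵇ_ : DecidableEquality Box
_≟ᵇ_ = Product.≡-dec _≟_ _≟_

open DecMembership _≟ᵇ_ using (_∈?_)

-- Listed by increasing row, and by increasing column within each row.
diagram : StrictPartition → List Box
diagram ρ = concatMap (λ i → map (λ k → (i , i + k)) (range (part ρ i))) (range (ℓ ρ))

-- Boxes of a diagram have column > row, so the subtraction is exact.
content : Box → ℕ
content b = col b ∸ row b

hook : StrictPartition → Box → ℕ
hook ρ b = suc (arm + leg + part ρ (col b))
  where
  arm = length (filter (λ b′ → (row b′ ≟ row b) ×-dec (col b <? col b′)) (diagram ρ))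
  leg = length (filter (λ b′ → (col b′ ≟ col b) ×-dec (row b <? row b′)) (diagram ρ))

H : StrictPartition → ℕ
H ρ = product (map (hook ρ) (diagram ρ))

H≢0 : ∀ ρ → NonZero (H ρ)
H≢0 ρ = product≢0 (hooks≢0 (diagram ρ))
  where
  hooks≢0 : ∀ bs → All NonZero (map (hook ρ) bs)
  hooks≢0 []       = []
  hooks≢0 (b ∷ bs) = _ ∷ hooks≢0 bs

infixl 7 _/H_

_/H_ : ℚ → StrictPartition → ℚ
x /H ρ = x ℚ.* (_/_ (+ 1) (H ρ) {{H≢0 ρ}})

skew : StrictPartition → StrictPartition → List Box
skew ρ μ = filter (λ b → ¬? (b ∈? diagram μ)) (diagram ρ)

Increasing : List (Box × ℕ) → Set
Increasing T = All (λ (b , s) → All (λ (b′ , t) →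
    (row b ≡ row b′ → col b < col b′ → s < t)
  × (col b ≡ col b′ → row b < row b′ → s < t)) T) T

increasing? : Decidable Increasing
increasing? T = all? (λ (b , s) → all? (λ (b′ , t) →
    ((row b ≟ row b′) →-dec ((col b <? col b′) →-dec (s <? t)))
  ×-dec ((col b ≟ col b′) →-dec ((row b <? row b′) →-dec (s <? t)))) T) T

-- A filling of the N boxes of ρ/μ is the list w of the entries, in the order
-- of skew ρ μ.  Entries lie in {1,…,N}, so bijective means without repetition.
tableaux : StrictPartition → StrictPartition → List (List ℕ)
tableaux ρ μ = filter (λ w → unique? w ×-dec increasing? (zip (skew ρ μ) w)) (words (range N) N)
  where N = length (skew ρ μ)

f : StrictPartition → StrictPartition → ℕ
f ρ μ = length (tableaux ρ μ)

-- A formal power series over ℚ in x₁, x₂, …, of bounded degree and invariant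
-- under permutations of the variables.  An exponent sequence of finite support
-- is a list of its leading terms, up to trailing zeros.
record SymmetricFunction : Set where
  field
    coeff     : List ℕ → ℚ
    trailing  : ∀ α → coeff (α ++ [ 0 ]) ≡ coeff α
    symmetric : ∀ {α β} → α ↭ β → coeff α ≡ coeff β
    degree    : ℕ
    bounded   : ∀ α → degree < sum α → coeff α ≡ 0ℚ

-- The value at x₁, …, x_k (here natural numbers) with all other variables 0.
-- Exponents above the degree bound contribute nothing, and monomials involving
-- x_{k+1}, x_{k+2}, … vanish.
evaluate : SymmetricFunction → List ℕ → ℚ
evaluate Q xs = ∑ (words (upTo (suc degree)) (length xs)) λ α →
    coeff α ℚ.* fromℕ (product (zipWith _^_ xs α))
  where open SymmetricFunction Q

atContents : SymmetricFunction → StrictPartition → ℚ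
atContents Q ρ = evaluate Q (map (λ b → content b C 2) (diagram ρ))

-- A strict partition whose diagram is ρ without one box has size |ρ| - 1.
IsOuterCorner : StrictPartition → Box → Set
IsOuterCorner ρ b =
  Any (λ κ → diagram κ ≡ filter (λ b′ → ¬? (b′ ≟ᵇ b)) (diagram ρ)) (strictPartitions (size ρ ∸ 1))

isOuterCorner? : ∀ ρ → Decidable (IsOuterCorner ρ)
isOuterCorner? ρ b =
  any? (λ κ → ≡-dec _≟ᵇ_ (diagram κ) (filter (λ b′ → ¬? (b′ ≟ᵇ b)) (diagram ρ))) (strictPartitions (size ρ ∸ 1))

-- (α₁,β₁), …, (α_m,β_m), by decreasing row.
outerCorners : StrictPartition → List Box
outerCorners ρ = reverse (filter (isOuterCorner? ρ) (diagram ρ))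

-- x₀, …, x_m with xᵢ = βᵢ - αᵢ₊₁.  No truncation: β₀ = ℓ(ρ) + 1 > α₁, and
-- βᵢ > αᵢ > αᵢ₊₁ for i ≥ 1.
xs : StrictPartition → List ℕ
xs ρ = zipWith _∸_ (suc (ℓ ρ) ∷ map col (outerCorners ρ)) (map row (outerCorners ρ) ++ [ 0 ])

ys : StrictPartition → List ℕ
ys ρ = map content (outerCorners ρ)

q : ℕ → StrictPartition → ℚ
q k ρ = ∑ (xs ρ) (λ x → fromℕ ((x C 2) ^ k)) ℚ.- ∑ (ys ρ) (λ y → fromℕ ((y C 2) ^ k))

qᵖ : Partition → StrictPartition → ℚ
qᵖ ν ρ = ∏ (Partition.parts ν) (λ k → q k ρ)

D : (StrictPartition → ℚ) → StrictPartition → ℚ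
D G ρ = ∑ (filter (λ ρ⁺ → ℓ ρ <? ℓ ρ⁺) (above ρ 1)) G
  ℚ.+ fromℕ 2 ℚ.* ∑ (filter (λ ρ⁺ → ℓ ρ⁺ ≟ ℓ ρ) (above ρ 1)) G
  ℚ.- G ρ

-- For ρ ⊇ μ each of the ℓ(ρ) - ℓ(μ) rows of ρ below μ contains a box of ρ/μ,
-- so the exponent of 2 is a natural number and no subtraction is truncated.
P : Partition → StrictPartition → SymmetricFunction → ℕ → ℚ
P ν μ Q n = ∑ (above μ n) λ ρ →
  fromℕ (2 ^ ((size ρ ∸ size μ) ∸ (ℓ ρ ∸ ℓ μ)) * f ρ μ) /H ρ ℚ.* atContents Q ρ ℚ.* qᵖ ν ρ

{-# OPTIONS --safe #-}
module Submission where

-- Write S for the set of parts of a strict partition λ and put z a = C(a + 1, 2)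
-- and w a = C(a, 2).  By the hook formula
-- H_λ = ∏ a! ∏_{a > b} (a + b)/(a - b), the ratios H_λ/H_{λ⁺}, weighted by 1 for
-- a new row and by 2 otherwise, are the residues of t⁻¹ ∏ (t - w a)/(t - z a) at
-- its poles, the pole of λ⁺ being C(c, 2) for the content c of the added box.
-- Hence H_λ ∑ (weight) C(c, 2)ᵏ / H_{λ⁺} is a polynomial in the q_j(λ), homogeneous
-- of weight k, by Newton's identities for the power differences q_j = ∑ (z a)ʲ - (w a)ʲ.
-- Adding a box changes q_k by a polynomial of degree < k in C(c, 2), and
-- Q(contents) by a polynomial in C(c, 2) whose j-th coefficient (j ≥ 1) has degree
-- deg Q - j in the contents.  Counting a symmetric function of degree d in the
-- contents with weight 2d, the operator D therefore lowers the weight, so it is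
-- nilpotent.
--
-- Removing the largest entry of a tableau gives P[G](n + 1) = P[G](n) + P[D G](n),
-- so P is a combination of finitely many binomial coefficients C(n, k).

open import Defs
open import Data.Nat.Base as ℕ using (ℕ; zero; suc; _∸_; _^_; _≤_; _<_; _>_; z≤n; s≤s; NonZero)
import Data.Nat.Properties as ℕ
open import Data.Nat.GeneralisedArithmetic using (iterate)
open import Data.Nat.Combinatorics using (_C_)
import Data.Nat.Combinatorics as Comb
open import Data.Nat.ListAction using (sum; product)
open import Data.Nat.ListAction.Properties using (product-++)
import Data.Integer.Base as ℤ
import Data.Integer.Properties as ℤ
open import Data.Rational.Base as ℚ using (ℚ; 0ℚ; 1ℚ; ½; _+_; _*_; _-_; -_; _/_)
import Data.Rational.Properties as ℚ
import Data.Rational.Unnormalised.Base as ℚᵘ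
import Data.Rational.Unnormalised.Properties as ℚᵘ
open import Data.Rational.Solver using (module +-*-Solver)
open import Data.List.Base using (List; []; _∷_; [_]; _++_; map; concatMap; cartesianProductWith; filter; length; mapMaybe; reverse; upTo; applyUpTo; zip; zipWith; takeWhile)
import Data.List.Properties as List
open import Data.List.Membership.Propositional using (_∈_; _∉_)
import Data.List.Membership.Propositional as Membership
import Data.List.Membership.DecPropositional as DecMembership
open import Data.List.Membership.Propositional.Properties
open import Data.List.Membership.Propositional.Properties.WithK using (unique∧set⇒bag)
open import Data.List.Relation.Binary.BagAndSetEquality using (∼bag⇒↭)
open import Data.List.Relation.Binary.Permutation.Propositional using (_↭_; prep; swap; ↭-refl)
import Data.List.Relation.Binary.Permutation.Propositional.Properties as Perm
open import Data.List.Relation.Binary.Disjoint.Propositional using (Disjoint)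
open import Data.List.Relation.Unary.All as All using (All; []; _∷_)
import Data.List.Relation.Unary.All.Properties as All
open import Data.List.Relation.Unary.AllPairs as AllPairs using (AllPairs; []; _∷_)
import Data.List.Relation.Unary.AllPairs.Properties as AllPairs
open import Data.List.Relation.Unary.Any using (here; there)
open import Data.List.Relation.Unary.Linked using (Linked; []; _∷_)
import Data.List.Relation.Unary.Linked.Properties as LinkedP
open import Data.List.Relation.Unary.Unique.Propositional using (Unique)
open import Data.List.Relation.Unary.Unique.DecPropositional ℕ._≟_ using (unique?)
import Data.List.Relation.Unary.Unique.Propositional.Properties as Unique
open import Data.Maybe.Base using (Maybe; just; nothing)
open import Data.Product.Base using (_×_; _,_; proj₁; proj₂; ∃-syntax)
open import Data.Sum.Base using (_⊎_; inj₁; inj₂)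
open import Data.Empty using (⊥)
open import Data.Unit.Base using (⊤; tt)
open import Data.Bool.Base using (true; false; if_then_else_; _∧_)
open import Function.Base using (_∘_; case_of_)
open import Function.Bundles using (mk⇔)
open import Relation.Nullary.Decidable using (Dec; yes; no; does; ¬?; _×-dec_; recompute; dec-true; dec-false)
open import Relation.Nullary.Negation using (¬_; contradiction)
open import Relation.Unary using (Decidable)
open import Relation.Binary.PropositionalEquality hiding ([_])
open StrictPartition using (parts)

open ≡-Reasoning
open +-*-Solver hiding (Polynomial)

-- Rational numbers and finite sums

-- The origin of `z` and `w`: replacing `a` by `a + 1` multiplies (a - b)/(a + b) by (a + b)(a + 1 -
-- b) / ((a - b)(a + 1 + b)). Numerator and denominator are 2 (z a - w b) and 2 (z a - z b), so
-- every hook ratio is a product of linear fractions evaluated at a pole. The coefficients of `D`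
-- are those that make these ratios residues: 2 z a / (a + 1) = a = z a - w a is the numerator
-- belonging to the new pole, and a new row is the pole 0. The corner description of `q` becomes a
-- sum over all parts because w (a + 1) = z a, so that runs of consecutive parts telescope. The
-- doubled weight of contents is needed for a strict drop: with weight d the j-th coefficient of the
-- increment would have weight d - j, and its power of C(c, 2) would restore the missing j; with
-- weight 2d the total is 2 (d - j) + j = 2d - j. Sums over λ⁺ run over all parts, including those
-- whose enlargement destroys strictness: two equal parts produce a zero factor in the reciprocal
-- hook product.

fromℕ-+ : ∀ m n → fromℕ (m ℕ.+ n) ≡ fromℕ m + fromℕ n
fromℕ-+ m n = ℚ.toℚᵘ-injective (ℚᵘ.≃-trans (ℚ.toℚᵘ-fromℚᵘ (ℤ.+ (m ℕ.+ n) ℚᵘ./ 1))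
  (ℚᵘ.≃-sym (ℚᵘ.≃-trans (ℚ.toℚᵘ-homo-+ (fromℕ m) (fromℕ n))
    (ℚᵘ.≃-trans (ℚᵘ.+-cong (ℚ.toℚᵘ-fromℚᵘ (ℤ.+ m ℚᵘ./ 1)) (ℚ.toℚᵘ-fromℚᵘ (ℤ.+ n ℚᵘ./ 1)))
      (ℚᵘ.*≡* (cong (ℤ._* ℤ.+ 1) (cong₂ ℤ._+_ (ℤ.*-identityʳ (ℤ.+ m)) (ℤ.*-identityʳ (ℤ.+ n)))))))))

fromℕ-* : ∀ m n → fromℕ (m ℕ.* n) ≡ fromℕ m * fromℕ n
fromℕ-* m n = ℚ.toℚᵘ-injective (ℚᵘ.≃-trans (ℚ.toℚᵘ-fromℚᵘ (ℤ.+ (m ℕ.* n) ℚᵘ./ 1))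
  (ℚᵘ.≃-sym (ℚᵘ.≃-trans (ℚ.toℚᵘ-homo-* (fromℕ m) (fromℕ n))
    (ℚᵘ.≃-trans (ℚᵘ.*-cong (ℚ.toℚᵘ-fromℚᵘ (ℤ.+ m ℚᵘ./ 1)) (ℚ.toℚᵘ-fromℚᵘ (ℤ.+ n ℚᵘ./ 1)))
      (ℚᵘ.*≡* (cong (ℤ._* ℤ.+ 1) (sym (ℤ.pos-* m n))))))))

fromℕ-injective : ∀ {m n} → fromℕ m ≡ fromℕ n → m ≡ n
fromℕ-injective {m} {n} e = ℤ.+-injective (begin
  ℤ.+ m ≡⟨ ℤ.*-identityʳ (ℤ.+ m) ⟨
  ℤ.+ m ℤ.* ℤ.+ 1 ≡⟨ ℚᵘ.drop-*≡* (ℚ.fromℚᵘ-injective {ℤ.+ m ℚᵘ./ 1} {ℤ.+ n ℚᵘ./ 1} e) ⟩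
  ℤ.+ n ℤ.* ℤ.+ 1 ≡⟨ ℤ.*-identityʳ (ℤ.+ n) ⟩
  ℤ.+ n             ∎)

fromℕ-suc : ∀ n → fromℕ (suc n) ≡ 1ℚ + fromℕ n
fromℕ-suc = fromℕ-+ 1

fromℕ-≢0 : ∀ {n} → 0 < n → fromℕ n ≢ 0ℚ
fromℕ-≢0 0<n e = ℕ.<⇒≢ 0<n (sym (fromℕ-injective e))

-- Made total by the value 0 at 0, so that `rational` and `residues` are plain functions;
-- nonvanishing enters only where inverses are cancelled.
inv : ℚ → ℚ
inv p with p ℚ.≟ 0ℚ
... | yes _  = 0ℚ
... | no p≢0 = (ℚ.1/ p) {{ℚ.≢-nonZero p≢0}}

inv-inverse : ∀ {p} → p ≢ 0ℚ → p * inv p ≡ 1ℚ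
inv-inverse {p} p≢0 with p ℚ.≟ 0ℚ
... | yes p≡0 = contradiction p≡0 p≢0
... | no p≢0′ = ℚ.*-inverseʳ p {{ℚ.≢-nonZero p≢0′}}

*-cancel : ∀ {p q r} → p ≢ 0ℚ → p * q ≡ p * r → q ≡ r
*-cancel {p} {q} {r} p≢0 e = begin
  q ≡⟨ lemma q ⟨
  inv p * (p * q) ≡⟨ cong (inv p *_) e ⟩
  inv p * (p * r) ≡⟨ lemma r ⟩
  r               ∎
  where
  lemma : ∀ x → inv p * (p * x) ≡ x
  lemma x = begin
    inv p * (p * x) ≡⟨ solve 3 (λ i p x → i :* (p :* x) := (p :* i) :* x) refl (inv p) p x ⟩
    (p * inv p) * x ≡⟨ cong (_* x) (inv-inverse p≢0) ⟩
    1ℚ * x ≡⟨ ℚ.*-identityˡ x ⟩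
    x               ∎

*-≢0 : ∀ {p q} → p ≢ 0ℚ → q ≢ 0ℚ → p * q ≢ 0ℚ
*-≢0 {p} p≢0 q≢0 e = q≢0 (*-cancel p≢0 (trans e (sym (ℚ.*-zeroʳ p))))

inv-unique : ∀ {p q} → p * q ≡ 1ℚ → q ≡ inv p
inv-unique {p} {q} e = *-cancel p≢0 (trans e (sym (inv-inverse p≢0)))
  where
  p≢0 : p ≢ 0ℚ
  p≢0 refl = contradiction (trans (sym (ℚ.*-zeroˡ q)) e) (λ ())

inv-* : ∀ {p q} → p ≢ 0ℚ → q ≢ 0ℚ → inv (p * q) ≡ inv p * inv q
inv-* {p} {q} p≢0 q≢0 = sym (inv-unique {p * q} (begin
  p * q * (inv p * inv q) ≡⟨ solve 4 (λ a b c d → a :* b :* (c :* d) := a :* c :* (b :* d)) refl p q (inv p) (inv q) ⟩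
  p * inv p * (q * inv q) ≡⟨ cong₂ _*_ (inv-inverse p≢0) (inv-inverse q≢0) ⟩
  1ℚ                        ∎))

fraction-≡ : ∀ {p q r s} → q ≢ 0ℚ → s ≢ 0ℚ → p * s ≡ r * q → p * inv q ≡ r * inv s
fraction-≡ {p} {q} {r} {s} q≢0 s≢0 e = *-cancel (*-≢0 q≢0 s≢0) (begin
  q * s * (p * inv q) ≡⟨ solve 4 (λ q s p i → q :* s :* (p :* i) := p :* s :* (q :* i)) refl q s p (inv q) ⟩
  p * s * (q * inv q) ≡⟨ cong₂ _*_ e (trans (inv-inverse q≢0) (sym (inv-inverse s≢0))) ⟩
  r * q * (s * inv s) ≡⟨ solve 4 (λ r q s i → r :* q :* (s :* i) := q :* s :* (r :* i)) refl r q s (inv s) ⟩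
  q * s * (r * inv s)   ∎)

module _ {A : Set} where

  ∑-cong : ∀ (as : List A) {g h : A → ℚ} → (∀ {x} → x ∈ as → g x ≡ h x) → ∑ as g ≡ ∑ as h
  ∑-cong []       e = refl
  ∑-cong (a ∷ as) e = cong₂ _+_ (e (here refl)) (∑-cong as (e ∘ there))

  ∑-cong′ : ∀ (as : List A) {g h : A → ℚ} → (∀ x → g x ≡ h x) → ∑ as g ≡ ∑ as h
  ∑-cong′ as e = ∑-cong as (λ {x} _ → e x)

  ∑-+ : ∀ (as : List A) (g h : A → ℚ) → ∑ as (λ x → g x + h x) ≡ ∑ as g + ∑ as h
  ∑-+ []       g h = refl
  ∑-+ (a ∷ as) g h = begin
    g a + h a + ∑ as (λ x → g x + h x) ≡⟨ cong (g a + h a +_) (∑-+ as g h) ⟩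
    g a + h a + (∑ as g + ∑ as h)
      ≡⟨ solve 4 (λ a b c d → a :+ b :+ (c :+ d) := a :+ c :+ (b :+ d)) refl (g a) (h a) (∑ as g) (∑ as h) ⟩
    g a + ∑ as g + (h a + ∑ as h)        ∎

  ∑-*ˡ : ∀ (as : List A) c (g : A → ℚ) → ∑ as (λ x → c * g x) ≡ c * ∑ as g
  ∑-*ˡ []       c g = sym (ℚ.*-zeroʳ c)
  ∑-*ˡ (a ∷ as) c g = trans (cong (c * g a +_) (∑-*ˡ as c g)) (sym (ℚ.*-distribˡ-+ c (g a) (∑ as g)))

  ∑-*ʳ : ∀ (as : List A) c (g : A → ℚ) → ∑ as (λ x → g x * c) ≡ ∑ as g * c
  ∑-*ʳ as c g = trans (∑-cong′ as (λ x → ℚ.*-comm (g x) c)) (trans (∑-*ˡ as c g) (ℚ.*-comm c (∑ as g)))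

  ∑-0 : ∀ (as : List A) → ∑ as (λ _ → 0ℚ) ≡ 0ℚ
  ∑-0 []       = refl
  ∑-0 (a ∷ as) = trans (ℚ.+-identityˡ _) (∑-0 as)

  ∑-++ : ∀ (as bs : List A) (g : A → ℚ) → ∑ (as ++ bs) g ≡ ∑ as g + ∑ bs g
  ∑-++ []       bs g = sym (ℚ.+-identityˡ _)
  ∑-++ (a ∷ as) bs g = trans (cong (g a +_) (∑-++ as bs g)) (sym (ℚ.+-assoc (g a) (∑ as g) (∑ bs g)))

  ∑-↭ : ∀ {as bs : List A} (g : A → ℚ) → as ↭ bs → ∑ as g ≡ ∑ bs g
  ∑-↭ g _↭_.refl          = refl
  ∑-↭ g (prep x p)        = cong (g x +_) (∑-↭ g p)
  ∑-↭ g (swap {as} {bs} x y p) = begin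
    g x + (g y + ∑ as g) ≡⟨ cong (λ s → g x + (g y + s)) (∑-↭ g p) ⟩
    g x + (g y + ∑ bs g) ≡⟨ solve 3 (λ a b c → a :+ (b :+ c) := b :+ (a :+ c)) refl (g x) (g y) (∑ bs g) ⟩
    g y + (g x + ∑ bs g)   ∎
  ∑-↭ g (_↭_.trans p q)   = trans (∑-↭ g p) (∑-↭ g q)

  ∑-filter : ∀ {p} {P : A → Set p} (P? : Decidable P) (as : List A) (g : A → ℚ) →
    ∑ (filter P? as) g ≡ ∑ as (λ x → if does (P? x) then g x else 0ℚ)
  ∑-filter P? []       g = refl
  ∑-filter P? (a ∷ as) g with does (P? a)
  ... | true  = cong (g a +_) (∑-filter P? as g)
  ... | false = trans (∑-filter P? as g) (sym (ℚ.+-identityˡ _))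

  ∑-map : ∀ {B : Set} (h : B → A) bs (g : A → ℚ) → ∑ (map h bs) g ≡ ∑ bs (g ∘ h)
  ∑-map h []       g = refl
  ∑-map h (b ∷ bs) g = cong (g (h b) +_) (∑-map h bs g)

  -- Reduces every rearrangement of sums and every count of tableaux to a comparison of members;
  -- this is the purpose of the `Unique` lemmas.
  ↭-sets : {as bs : List A} → Unique as → Unique bs →
    (∀ {x} → x ∈ as → x ∈ bs) → (∀ {x} → x ∈ bs → x ∈ as) → as ↭ bs
  ↭-sets u v to from = ∼bag⇒↭ (unique∧set⇒bag u v (mk⇔ to from))

∑-swap : ∀ {A B : Set} (as : List A) (bs : List B) (g : A → B → ℚ) →
  ∑ as (λ a → ∑ bs (g a)) ≡ ∑ bs (λ b → ∑ as (λ a → g a b))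
∑-swap []       bs g = sym (∑-0 bs)
∑-swap (a ∷ as) bs g = trans (cong (∑ bs (g a) +_) (∑-swap as bs g)) (sym (∑-+ bs (g a) (λ b → ∑ as (λ a → g a b))))

-- Residues and Newton's identities

≢⇒-≢0 : ∀ {p q} → p ≢ q → p - q ≢ 0ℚ
≢⇒-≢0 {p} {q} p≢q e = p≢q (begin
  p ≡⟨ solve 2 (λ p q → p := p :- q :+ q) refl p q ⟩
  p - q + q ≡⟨ cong (_+ q) e ⟩
  0ℚ + q ≡⟨ ℚ.+-identityˡ q ⟩
  q             ∎)

inv-neg : ∀ {p} → p ≢ 0ℚ → inv (- p) ≡ - inv p
inv-neg {p} p≢0 = sym (inv-unique { - p} (trans (solve 2 (λ p i → :- p :* :- i := p :* i) refl p (inv p)) (inv-inverse p≢0)))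

-- residues as φ is the sum of φ against the residues of the rational function
-- rational as t = t⁻¹ ∏ (t - w a)/(t - z a) at its poles 0 and z a.
module Residues {A : Set} (z w : A → ℚ) where

  rational : List A → ℚ → ℚ
  rational []       t = inv t
  rational (a ∷ as) t = rational as t * ((t - w a) * inv (t - z a))

  residues : List A → (ℚ → ℚ) → ℚ
  residues []       φ = φ 0ℚ
  -- At the old poles the factor of `a` is absorbed into the test function; the new simple pole at
  -- `z a` contributes `z a - w a` times the remaining factors.
  residues (a ∷ as) φ =
    residues as (λ t → φ t * ((t - w a) * inv (t - z a))) + φ (z a) * ((z a - w a) * rational as (z a))

  Pole : List A → ℚ → Set
  Pole []       t = t ≡ 0ℚ
  Pole (a ∷ as) t = t ≡ z a ⊎ Pole as t

  -- Makes all poles simple. The base case of `Pole` is the pole 0 of `inv t`, so each `z a` must be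
  -- nonzero as well.
  Distinct : List A → Set
  Distinct []       = ⊤
  Distinct (a ∷ as) = ¬ Pole as (z a) × Distinct as

  -- Agreement at the poles suffices, and there `t - z a` can be cancelled against its inverse.
  residues-cong : ∀ as {φ ψ} → (∀ t → Pole as t → φ t ≡ ψ t) → residues as φ ≡ residues as ψ
  residues-cong []       e = e 0ℚ refl
  residues-cong (a ∷ as) e = cong₂ _+_
    (residues-cong as (λ t t∈ → cong (_* _) (e t (inj₂ t∈)))) (cong (_* _) (e (z a) (inj₁ refl)))

  residues-cong′ : ∀ as {φ ψ} → (∀ t → φ t ≡ ψ t) → residues as φ ≡ residues as ψ
  residues-cong′ as e = residues-cong as (λ t _ → e t)

  residues-+ : ∀ as φ ψ → residues as (λ t → φ t + ψ t) ≡ residues as φ + residues as ψ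
  residues-+ []       φ ψ = refl
  residues-+ (a ∷ as) φ ψ = begin
    residues as (λ t → (φ t + ψ t) * g t) + (φ (z a) + ψ (z a)) * c
      ≡⟨ cong₂ _+_ (trans (residues-cong′ as (λ t → ℚ.*-distribʳ-+ (g t) (φ t) (ψ t))) (residues-+ as _ _))
           (ℚ.*-distribʳ-+ c (φ (z a)) (ψ (z a))) ⟩
    (x + y) + (φ (z a) * c + ψ (z a) * c)
      ≡⟨ solve 4 (λ x y u v → x :+ y :+ (u :+ v) := x :+ u :+ (y :+ v)) refl x y (φ (z a) * c) (ψ (z a) * c) ⟩
    (x + φ (z a) * c) + (y + ψ (z a) * c) ∎
    where
    g = λ t → (t - w a) * inv (t - z a)
    c = (z a - w a) * rational as (z a)
    x = residues as (λ t → φ t * g t)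
    y = residues as (λ t → ψ t * g t)

  residues-* : ∀ as c φ → residues as (λ t → c * φ t) ≡ c * residues as φ
  residues-* []       c φ = refl
  residues-* (a ∷ as) c φ = begin
    residues as (λ t → c * φ t * g t) + c * φ (z a) * d
      ≡⟨ cong₂ _+_ (trans (residues-cong′ as (λ t → ℚ.*-assoc c (φ t) (g t))) (residues-* as c _))
           (ℚ.*-assoc c (φ (z a)) d) ⟩
    c * x + c * (φ (z a) * d) ≡⟨ ℚ.*-distribˡ-+ c x _ ⟨
    c * (x + φ (z a) * d)       ∎
    where
    g = λ t → (t - w a) * inv (t - z a)
    d = (z a - w a) * rational as (z a)
    x = residues as (λ t → φ t * g t)

  private
    split-factor : ∀ {t a} → t ≢ z a → (t - w a) * inv (t - z a) ≡ 1ℚ + (z a - w a) * inv (t - z a)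
    split-factor {t} {a} t≢z = begin
      (t - w a) * i ≡⟨ solve 4 (λ t z w i → (t :- w) :* i := (t :- z) :* i :+ (z :- w) :* i)
                                                refl t (z a) (w a) i ⟩
      (t - z a) * i + (z a - w a) * i ≡⟨ cong (_+ (z a - w a) * i) (inv-inverse (≢⇒-≢0 t≢z)) ⟩
      1ℚ + (z a - w a) * i                 ∎
      where i = inv (t - z a)

    partial-fraction : ∀ {t s u} → t ≢ s → t ≢ u → s ≢ u →
      inv (t - s) * inv (s - u) ≡ inv (t - u) * (inv (t - s) + inv (s - u))
    partial-fraction {t} {s} {u} t≢s t≢u s≢u = *-cancel (≢⇒-≢0 t≢u) (begin
      (t - u) * (i * j)
        ≡⟨ solve 5 (λ t s u i j → (t :- u) :* (i :* j) := (t :- s) :* i :* j :+ (s :- u) :* j :* i) refl t s u i j ⟩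
      (t - s) * i * j + (s - u) * j * i
        ≡⟨ cong₂ (λ x y → x * j + y * i) (inv-inverse (≢⇒-≢0 t≢s)) (inv-inverse (≢⇒-≢0 s≢u)) ⟩
      1ℚ * j + 1ℚ * i
        ≡⟨ solve 2 (λ i j → con 1ℚ :* j :+ con 1ℚ :* i := con 1ℚ :* (i :+ j)) refl i j ⟩
      1ℚ * (i + j)
        ≡⟨ cong (_* (i + j)) (inv-inverse (≢⇒-≢0 t≢u)) ⟨
      (t - u) * inv (t - u) * (i + j)
        ≡⟨ ℚ.*-assoc (t - u) (inv (t - u)) (i + j) ⟩
      (t - u) * (inv (t - u) * (i + j)) ∎)
      where
      i = inv (t - s)
      j = inv (s - u)

  -- The partial fraction expansion of a function vanishing at infinity. The new factor times
  -- `inv (t - s)` splits into multiples of `inv (t - s)` and `inv (u - s)`, so the induction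
  -- hypothesis is used at `t` and at the new pole `u`.
  residues-inv : ∀ as → Distinct as → ∀ {t} → ¬ Pole as t → residues as (λ s → inv (t - s)) ≡ rational as t
  residues-inv []       _         {t} _  = cong inv (solve 1 (λ t → t :- con 0ℚ := t) refl t)
  residues-inv (a ∷ as) (z∉ , ds) {t} t∉ = begin
    residues as (λ s → inv (t - s) * ((s - w a) * inv (s - u))) + inv (t - u) * ((u - w a) * r)
      ≡⟨ cong (_+ inv (t - u) * ((u - w a) * r)) (residues-cong as (λ s s∈ → step s s∈)) ⟩
    residues as (λ s → (1ℚ + c) * inv (t - s) + - c * inv (u - s)) + inv (t - u) * ((u - w a) * r)
      ≡⟨ cong (_+ inv (t - u) * ((u - w a) * r)) (trans (residues-+ as _ _)
           (cong₂ _+_ (trans (residues-* as (1ℚ + c) _) (cong ((1ℚ + c) *_) (residues-inv as ds (t∉ ∘ inj₂))))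
             (trans (residues-* as (- c) _) (cong (- c *_) (residues-inv as ds z∉))))) ⟩
    (1ℚ + c) * p + - c * r + inv (t - u) * ((u - w a) * r)
      ≡⟨ solve 5 (λ v i p r o → (o :+ v :* i) :* p :+ (:- (v :* i)) :* r :+ i :* (v :* r) := p :* (o :+ v :* i))
           refl (u - w a) (inv (t - u)) p r 1ℚ ⟩
    p * (1ℚ + c)
      ≡⟨ cong (p *_) (split-factor (t∉ ∘ inj₁)) ⟨
    p * ((t - w a) * inv (t - u)) ∎
    where
    u = z a
    p = rational as t
    r = rational as u
    c = (u - w a) * inv (t - u)
    step : ∀ s → Pole as s →
      inv (t - s) * ((s - w a) * inv (s - u)) ≡ (1ℚ + c) * inv (t - s) + - c * inv (u - s)
    step s s∈ = begin
      i * ((s - w a) * j)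
        ≡⟨ cong (i *_) (split-factor s≢u) ⟩
      i * (1ℚ + v * j)
        ≡⟨ solve 4 (λ i v j o → i :* (o :+ v :* j) := o :* i :+ v :* (i :* j)) refl i v j 1ℚ ⟩
      1ℚ * i + v * (i * j)
        ≡⟨ cong (λ x → 1ℚ * i + v * x) (partial-fraction t≢s (t∉ ∘ inj₁) s≢u) ⟩
      1ℚ * i + v * (k * (i + j))
        ≡⟨ cong (λ x → 1ℚ * i + v * (k * (i + x))) j≡ ⟩
      1ℚ * i + v * (k * (i + - inv (u - s)))
        ≡⟨ solve 5 (λ o i v k l → o :* i :+ v :* (k :* (i :+ :- l)) := (o :+ v :* k) :* i :+ (:- (v :* k)) :* l)
             refl 1ℚ i v k (inv (u - s)) ⟩
      (1ℚ + c) * i + - c * inv (u - s) ∎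
      where
      i = inv (t - s)
      j = inv (s - u)
      k = inv (t - u)
      v = u - w a
      s≢u : s ≢ u
      s≢u refl = z∉ s∈
      t≢s : t ≢ s
      t≢s refl = t∉ (inj₂ s∈)
      j≡ : j ≡ - inv (u - s)
      j≡ = trans (cong inv (solve 2 (λ s u → s :- u := :- (u :- s)) refl s u)) (inv-neg (≢⇒-≢0 (s≢u ∘ sym)))

  -- The residues add up to the coefficient of 1/t at infinity, and each factor tends to 1 there.
  residues-1 : ∀ as → Distinct as → residues as (λ _ → 1ℚ) ≡ 1ℚ
  residues-1 []       _         = refl
  residues-1 (a ∷ as) (z∉ , ds) = begin
    residues as (λ s → 1ℚ * ((s - w a) * inv (s - u))) + 1ℚ * (v * r)
      ≡⟨ cong (_+ 1ℚ * (v * r)) (residues-cong as step) ⟩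
    residues as (λ s → 1ℚ + - v * inv (u - s)) + 1ℚ * (v * r)
      ≡⟨ cong (_+ 1ℚ * (v * r)) (trans (residues-+ as _ _)
           (cong₂ _+_ (residues-1 as ds) (trans (residues-* as (- v) _) (cong (- v *_) (residues-inv as ds z∉))))) ⟩
    1ℚ + - v * r + 1ℚ * (v * r)
      ≡⟨ solve 2 (λ v r → con 1ℚ :+ :- v :* r :+ con 1ℚ :* (v :* r) := con 1ℚ) refl v r ⟩
    1ℚ ∎
    where
    u = z a
    v = u - w a
    r = rational as u
    step : ∀ s → Pole as s → 1ℚ * ((s - w a) * inv (s - u)) ≡ 1ℚ + - v * inv (u - s)
    step s s∈ = begin
      1ℚ * ((s - w a) * inv (s - u)) ≡⟨ ℚ.*-identityˡ _ ⟩
      (s - w a) * inv (s - u) ≡⟨ split-factor s≢u ⟩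
      1ℚ + v * inv (s - u) ≡⟨ cong (λ x → 1ℚ + v * x)
        (trans (cong inv (solve 2 (λ s u → s :- u := :- (u :- s)) refl s u)) (inv-neg (≢⇒-≢0 (s≢u ∘ sym)))) ⟩
      1ℚ + v * - inv (u - s) ≡⟨ solve 3 (λ o v l → o :+ v :* :- l := o :+ :- v :* l) refl 1ℚ v (inv (u - s)) ⟩
      1ℚ + - v * inv (u - s)           ∎
      where
      s≢u : s ≢ u
      s≢u refl = z∉ s∈

  -- The factor `t - z a` removes the pole at `z a` and leaves the numerator `t - w a` to the
  -- remaining poles.
  residues-shift : ∀ a as → Distinct (a ∷ as) → ∀ (φ : ℚ → ℚ) →
    residues (a ∷ as) (λ t → φ t * (t - z a)) ≡ residues as (λ t → φ t * (t - w a))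
  residues-shift a as (z∉ , ds) φ = begin
    residues as (λ t → φ t * (t - z a) * ((t - w a) * inv (t - z a))) + φ (z a) * (z a - z a) * c
      ≡⟨ cong₂ _+_ (residues-cong as step) (solve 3 (λ p z c → p :* (z :- z) :* c := con 0ℚ) refl (φ (z a)) (z a) c) ⟩
    residues as (λ t → φ t * (t - w a)) + 0ℚ
      ≡⟨ ℚ.+-identityʳ _ ⟩
    residues as (λ t → φ t * (t - w a)) ∎
    where
    c = (z a - w a) * rational as (z a)
    step : ∀ t → Pole as t → φ t * (t - z a) * ((t - w a) * inv (t - z a)) ≡ φ t * (t - w a)
    step t t∈ = begin
      φ t * (t - z a) * ((t - w a) * inv (t - z a))
        ≡⟨ solve 4 (λ p x y i → p :* x :* (y :* i) := p :* y :* (x :* i)) refl (φ t) (t - z a) (t - w a) _ ⟩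
      φ t * (t - w a) * ((t - z a) * inv (t - z a))
        ≡⟨ cong (φ t * (t - w a) *_) (inv-inverse (≢⇒-≢0 t≢z)) ⟩
      φ t * (t - w a) * 1ℚ
        ≡⟨ ℚ.*-identityʳ _ ⟩
      φ t * (t - w a) ∎
      where
      t≢z : t ≢ z a
      t≢z refl = z∉ t∈

  -- Moments of the residues and their Newton identities

  infixr 8 _^ℚ_
  _^ℚ_ : ℚ → ℕ → ℚ
  t ^ℚ zero  = 1ℚ
  t ^ℚ suc k = t * t ^ℚ k

  -- For distinct poles, the coefficient of xᵏ in ∏ (1 - w a x)/(1 - z a x), that is, of 1/tᵏ⁺¹ in
  -- the expansion of `rational as` at infinity.
  moment : List A → ℕ → ℚ
  moment as k = residues as (_^ℚ k)

  powerDifference : List A → ℕ → ℚ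
  powerDifference as k = ∑ as (λ a → z a ^ℚ k - w a ^ℚ k)

  -- conv q M k = q₁ Mₖ₋₁ + q₂ Mₖ₋₂ + … + qₖ M₀, where q₁, q₂, … are the values q 0, q 1, ….
  conv : (ℕ → ℚ) → (ℕ → ℚ) → ℕ → ℚ
  conv q M zero    = 0ℚ
  conv q M (suc k) = q 0 * M k + conv (q ∘ suc) M k

  conv-cong : ∀ {q q′ M M′} k → (∀ i → q i ≡ q′ i) → (∀ i → M i ≡ M′ i) → conv q M k ≡ conv q′ M′ k
  conv-cong zero    e e′ = refl
  conv-cong (suc k) e e′ = cong₂ _+_ (cong₂ _*_ (e 0) (e′ k)) (conv-cong k (e ∘ suc) e′)

  conv-- : ∀ q q′ M k → conv (λ i → q i - q′ i) M k ≡ conv q M k - conv q′ M k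
  conv-- q q′ M zero    = refl
  conv-- q q′ M (suc k) = trans (cong ((q 0 - q′ 0) * M k +_) (conv-- (q ∘ suc) (q′ ∘ suc) M k))
    (solve 5 (λ a b m c d → (a :- b) :* m :+ (c :- d) := (a :* m :+ c) :- (b :* m :+ d)) refl (q 0) (q′ 0) (M k) _ _)

  -- Coefficients of (1 - v t) M(t).
  times : ℚ → (ℕ → ℚ) → ℕ → ℚ
  times v M zero    = M 0
  times v M (suc k) = M (suc k) - v * M k

  conv-times : ∀ v q M k → conv q (times v M) (suc k) ≡ conv q M (suc k) - v * conv q M k
  conv-times v q M zero    = solve 3 (λ q m v → q :* m :+ con 0ℚ := q :* m :+ con 0ℚ :- v :* con 0ℚ) refl (q 0) (M 0) v
  conv-times v q M (suc k) = trans (cong (q 0 * (M (suc k) - v * M k) +_) (conv-times v (q ∘ suc) M k))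
    (solve 6 (λ q m n v x y → q :* (m :- v :* n) :+ (x :- v :* y) := q :* m :+ x :- v :* (q :* n :+ y))
      refl (q 0) (M (suc k)) (M k) v _ _)

  conv-* : ∀ v q M k → conv (λ i → v * q i) M k ≡ v * conv q M k
  conv-* v q M zero    = sym (ℚ.*-zeroʳ v)
  conv-* v q M (suc k) = trans (cong (v * q 0 * M k +_) (conv-* v (q ∘ suc) M k))
    (solve 4 (λ v q m x → v :* q :* m :+ v :* x := v :* (q :* m :+ x)) refl v (q 0) (M k) _)

  -- In generating functions: v x/(1 - v x) times (1 - v x) M(x) is v x M(x).
  conv-geometric : ∀ v M k → conv (λ i → v ^ℚ suc i) (times v M) (suc k) ≡ v * M k
  conv-geometric v M zero    = solve 2 (λ v m → v :* con 1ℚ :* m :+ con 0ℚ := v :* m) refl v (M 0)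
  conv-geometric v M (suc k) = begin
    v * 1ℚ * (M (suc k) - v * M k) + conv (λ i → v ^ℚ suc (suc i)) (times v M) (suc k)
      ≡⟨ cong (v * 1ℚ * (M (suc k) - v * M k) +_)
           (trans (conv-* v (λ i → v ^ℚ suc i) (times v M) (suc k)) (cong (v *_) (conv-geometric v M k))) ⟩
    v * 1ℚ * (M (suc k) - v * M k) + v * (v * M k)
      ≡⟨ solve 3 (λ v m n → v :* con 1ℚ :* (m :- v :* n) :+ v :* (v :* n) := v :* m) refl v (M (suc k)) (M k) ⟩
    v * M (suc k) ∎

  -- The coefficients of x M′(x) - q(x) M(x); their vanishing says that q(x) is the logarithmic
  -- derivative x M′/M.
  defect : (ℕ → ℚ) → (ℕ → ℚ) → ℕ → ℚ
  defect q M k = fromℕ k * M k - conv q M k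

  -- Newton's identities pass from (q, M) to (qᵢ - vⁱ, (1 - v t) M(t)).  By moment-times
  -- the moments of a ∷ as (with v = z a) and of as (with v = w a) yield the same pair.
  defect-times : ∀ v q M k →
    defect (λ i → q i - v ^ℚ suc i) (times v M) (suc k) ≡ defect q M (suc k) - v * defect q M k
  defect-times v q M k = begin
    fromℕ (suc k) * (M (suc k) - v * M k) - conv (λ i → q i - v ^ℚ suc i) (times v M) (suc k)
      ≡⟨ cong₂ (λ n c → n * (M (suc k) - v * M k) - c) (fromℕ-suc k)
           (trans (conv-- q (λ i → v ^ℚ suc i) (times v M) (suc k)) (cong₂ _-_ (conv-times v q M k) (conv-geometric v M k))) ⟩
    (1ℚ + n) * (M (suc k) - v * M k) - ((x - v * y) - v * M k)
      ≡⟨ solve 7 (λ o n m l v x y → (o :+ n) :* (m :- v :* l) :- ((x :- v :* y) :- v :* l)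
           := (o :+ n) :* m :- x :- v :* (n :* l :- y) :+ (v :* l :- o :* (v :* l))) refl 1ℚ n (M (suc k)) (M k) v x y ⟩
    (1ℚ + n) * M (suc k) - x - v * (n * M k - y) + (v * M k - 1ℚ * (v * M k))
      ≡⟨ cong₂ (λ m u → m * M (suc k) - x - v * (n * M k - y) + u) (sym (fromℕ-suc k))
           (trans (cong (λ u → v * M k - u) (ℚ.*-identityˡ _)) (ℚ.+-inverseʳ (v * M k))) ⟩
    fromℕ (suc k) * M (suc k) - x - v * (n * M k - y) + 0ℚ
      ≡⟨ ℚ.+-identityʳ _ ⟩
    defect q M (suc k) - v * defect q M k ∎
    where
    n = fromℕ k
    x = conv q M (suc k)
    y = conv q M k

  -- Both sides are the moments after clearing one factor: 1 - z a x cancels the denominator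
  -- belonging to `a`, 1 - w a x supplies its numerator.
  moment-times : ∀ a as → Distinct (a ∷ as) → ∀ k → times (z a) (moment (a ∷ as)) k ≡ times (w a) (moment as) k
  moment-times a as ds zero    = trans (residues-1 (a ∷ as) ds) (sym (residues-1 as (proj₂ ds)))
  moment-times a as ds (suc k) = begin
    moment (a ∷ as) (suc k) - z a * moment (a ∷ as) k ≡⟨ expand (a ∷ as) (z a) ⟨
    residues (a ∷ as) (λ t → t ^ℚ k * (t - z a)) ≡⟨ residues-shift a as ds (_^ℚ k) ⟩
    residues as (λ t → t ^ℚ k * (t - w a)) ≡⟨ expand as (w a) ⟩
    moment as (suc k) - w a * moment as k                    ∎
    where
    expand : ∀ as v → residues as (λ t → t ^ℚ k * (t - v)) ≡ moment as (suc k) - v * moment as k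
    expand as v = begin
      residues as (λ t → t ^ℚ k * (t - v))
        ≡⟨ residues-cong′ as (λ t → solve 3 (λ p t v → p :* (t :- v) := t :* p :+ :- v :* p) refl (t ^ℚ k) t v) ⟩
      residues as (λ t → t ^ℚ suc k + - v * t ^ℚ k)
        ≡⟨ trans (residues-+ as _ _) (cong (moment as (suc k) +_) (residues-* as (- v) _)) ⟩
      moment as (suc k) + - v * moment as k
        ≡⟨ solve 3 (λ x v y → x :+ :- v :* y := x :- v :* y) refl (moment as (suc k)) v (moment as k) ⟩
      moment as (suc k) - v * moment as k ∎

  -- The logarithmic derivative of ∏ (1 - w a x)/(1 - z a x). The induction runs over the list and
  -- over `k`, because `defect-times` links consecutive defects.
  newton : ∀ as → Distinct as → ∀ k → fromℕ k * moment as k ≡ conv (powerDifference as ∘ suc) (moment as) k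
  newton as ds k = trans (solve 2 (λ x y → x := x :- y :+ y) refl (fromℕ k * moment as k) c)
    (trans (cong (_+ c) (defect≡0 as ds k)) (ℚ.+-identityˡ c))
    where
    c = conv (powerDifference as ∘ suc) (moment as) k
    defect≡0 : ∀ as → Distinct as → ∀ k → defect (powerDifference as ∘ suc) (moment as) k ≡ 0ℚ
    defect≡0 as       ds       zero    = solve 1 (λ x → con 0ℚ :* x :- con 0ℚ := con 0ℚ) refl (moment as 0)
    defect≡0 []       ds       (suc k) = cong₂ _-_
      (trans (cong (fromℕ (suc k) *_) (ℚ.*-zeroˡ (0ℚ ^ℚ k))) (ℚ.*-zeroʳ (fromℕ (suc k)))) (conv-zero (suc k))
      where
      conv-zero : ∀ k → conv (λ _ → 0ℚ) (moment []) k ≡ 0ℚ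
      conv-zero zero    = refl
      conv-zero (suc k) = cong₂ _+_ (ℚ.*-zeroˡ (moment [] k)) (conv-zero k)
    defect≡0 (a ∷ as) ds (suc k) = begin
      defect Q′ M′ (suc k)
        ≡⟨ solve 3 (λ x y v → x := (x :- v :* y) :+ v :* y) refl (defect Q′ M′ (suc k)) (defect Q′ M′ k) (z a) ⟩
      (defect Q′ M′ (suc k) - z a * defect Q′ M′ k) + z a * defect Q′ M′ k
        ≡⟨ cong₂ _+_ (trans (sym (defect-times (z a) Q′ M′ k)) (trans same (defect-times (w a) Q M k)))
             (trans (cong (z a *_) (defect≡0 (a ∷ as) ds k)) (ℚ.*-zeroʳ (z a))) ⟩
      (defect Q M (suc k) - w a * defect Q M k) + 0ℚ
        ≡⟨ cong₂ (λ x y → (x - w a * y) + 0ℚ) (defect≡0 as (proj₂ ds) (suc k)) (defect≡0 as (proj₂ ds) k) ⟩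
      (0ℚ - w a * 0ℚ) + 0ℚ
        ≡⟨ solve 1 (λ v → (con 0ℚ :- v :* con 0ℚ) :+ con 0ℚ := con 0ℚ) refl (w a) ⟩
      0ℚ ∎
      where
      Q′ = powerDifference (a ∷ as) ∘ suc
      M′ = moment (a ∷ as)
      Q = powerDifference as ∘ suc
      M = moment as
      same : defect (λ i → Q′ i - z a ^ℚ suc i) (times (z a) M′) (suc k)
           ≡ defect (λ i → Q i - w a ^ℚ suc i) (times (w a) M) (suc k)
      same = cong₂ _-_ (cong (fromℕ (suc k) *_) (moment-times a as ds (suc k)))
        (conv-cong (suc k) (λ i → solve 3 (λ z w q → z :- w :+ q :- z := q :- w) refl (z a ^ℚ suc i) (w a ^ℚ suc i) (Q i))
          (moment-times a as ds))

-- Diagrams and hook lengths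

upTo-suc : ∀ n → upTo (suc n) ≡ 0 ∷ map suc (upTo n)
upTo-suc n = cong (0 ∷_) (sym (List.map-upTo suc n))

range-suc : ∀ n → range (suc n) ≡ 1 ∷ map suc (range n)
range-suc n = cong (map suc) (upTo-suc n)

∈-range⁻ : ∀ {k n} → k ∈ range n → 1 ≤ k × k ≤ n
∈-range⁻ k∈ with i , i∈ , refl ← ∈-map⁻ suc k∈ = s≤s z≤n , ∈-upTo⁻ i∈

∈-range⁺ : ∀ {k n} → 1 ≤ k → k ≤ n → k ∈ range n
∈-range⁺ (s≤s _) k≤n = ∈-map⁺ suc (∈-upTo⁺ k≤n)

concatMap-rows : ∀ {B : Set} (g : ℕ → ℕ → List B) a as →
  concatMap (λ i → g i (nth (a ∷ as) i)) (range (length (a ∷ as)))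
    ≡ g 1 a ++ concatMap (λ i → g (suc i) (nth as i)) (range (length as))
concatMap-rows g a as = begin
  concatMap G (range (suc (length as))) ≡⟨ cong (concatMap G) (range-suc (length as)) ⟩
  g 1 a ++ concatMap G (map suc (range (length as)))
    ≡⟨ cong (g 1 a ++_) (trans (List.concatMap-map G suc (range (length as))) (trans (List.concatMap-map (G ∘ suc) suc (upTo (length as)))
         (sym (List.concatMap-map (λ i → g (suc i) (nth as i)) suc (upTo (length as)))))) ⟩
  g 1 a ++ concatMap (λ i → g (suc i) (nth as i)) (range (length as)) ∎
  where G = λ i → g i (nth (a ∷ as) i)

shift : Box → Box
shift (i , j) = suc i , suc j

firstRow : ℕ → List Box
firstRow a = map (λ k → 1 , suc k) (range a)

-- Deleting the first row of a shifted diagram leaves the diagram of the tail moved along the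
-- diagonal, which preserves contents and hook lengths.
boxes : List ℕ → List Box
boxes []       = []
boxes (a ∷ as) = firstRow a ++ map shift (boxes as)

rowBoxes : ℕ → ℕ → List Box
rowBoxes i a = map (λ k → i , i ℕ.+ k) (range a)

diagram≡boxes : ∀ ρ → diagram ρ ≡ boxes (parts ρ)
diagram≡boxes ρ = rows (parts ρ)
  where
  rows : ∀ as → concatMap (λ i → rowBoxes i (nth as i)) (range (length as)) ≡ boxes as
  rows []       = refl
  rows (a ∷ as) = begin
    concatMap (λ i → rowBoxes i (nth (a ∷ as) i)) (range (length (a ∷ as)))
      ≡⟨ concatMap-rows rowBoxes a as ⟩
    rowBoxes 1 a ++ concatMap (λ i → rowBoxes (suc i) (nth as i)) (range (length as))
      ≡⟨ cong (rowBoxes 1 a ++_) (List.concatMap-cong (λ i → List.map-∘ (range (nth as i))) (range (length as))) ⟩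
    rowBoxes 1 a ++ concatMap (λ i → map shift (rowBoxes i (nth as i))) (range (length as))
      ≡⟨ cong (rowBoxes 1 a ++_) (sym (List.map-concatMap shift (λ i → rowBoxes i (nth as i)) (range (length as)))) ⟩
    rowBoxes 1 a ++ map shift (concatMap (λ i → rowBoxes i (nth as i)) (range (length as)))
      ≡⟨ cong (λ bs → rowBoxes 1 a ++ map shift bs) (rows as) ⟩
    boxes (a ∷ as) ∎

contents-boxes : ∀ as → map content (boxes as) ≡ concatMap range as
contents-boxes []       = refl
contents-boxes (a ∷ as) = begin
  map content (firstRow a ++ map shift (boxes as))
    ≡⟨ List.map-++ content (firstRow a) (map shift (boxes as)) ⟩
  map content (firstRow a) ++ map content (map shift (boxes as))
    ≡⟨ cong₂ _++_ (trans (sym (List.map-∘ (range a))) (List.map-id (range a))) (sym (List.map-∘ (boxes as))) ⟩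
  range a ++ map content (boxes as)
    ≡⟨ cong (range a ++_) (contents-boxes as) ⟩
  range a ++ concatMap range as ∎

data IsSuc : ℕ → Set where
  isSuc : ∀ {n} → IsSuc (suc n)

boxes-positive : ∀ as {b} → b ∈ boxes as → IsSuc (row b) × IsSuc (col b)
boxes-positive (a ∷ as) b∈ with ∈-++⁻ (firstRow a) b∈
... | inj₁ b∈₁ with _ , _ , refl ← ∈-map⁻ _ b∈₁ = isSuc , isSuc
... | inj₂ b∈₂ with _ , _ , refl ← ∈-map⁻ shift b∈₂ = isSuc , isSuc

module _ {A : Set} {p} {P : A → Set p} (P? : Decidable P) where

  count-++ : ∀ as bs → length (filter P? (as ++ bs)) ≡ length (filter P? as) ℕ.+ length (filter P? bs)
  count-++ as bs = trans (cong length (List.filter-++ P? as bs)) (List.length-++ (filter P? as))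

  count-none : ∀ as → (∀ {x} → x ∈ as → does (P? x) ≡ false) → length (filter P? as) ≡ 0
  count-none []       _ = refl
  count-none (a ∷ as) e rewrite e (here refl) = count-none as (e ∘ there)

  count-all : ∀ as → (∀ {x} → x ∈ as → does (P? x) ≡ true) → length (filter P? as) ≡ length as
  count-all []       _ = refl
  count-all (a ∷ as) e rewrite e (here refl) = cong suc (count-all as (e ∘ there))

  count-map : ∀ {B : Set} {q} {Q : B → Set q} (Q? : Decidable Q) (g : B → A) bs →
    (∀ {x} → x ∈ bs → does (P? (g x)) ≡ does (Q? x)) → length (filter P? (map g bs)) ≡ length (filter Q? bs)
  count-map Q? g []       _ = refl
  count-map Q? g (b ∷ bs) e with does (P? (g b)) | does (Q? b) | e (here refl)
  ... | true  | true  | _ = cong suc (count-map Q? g bs (e ∘ there))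
  ... | false | false | _ = count-map Q? g bs (e ∘ there)

-- The diagram is a parameter so that `boxes` can take the place of `diagram`.
hookIn : List Box → List ℕ → Box → ℕ
hookIn bs as b = suc (length (filter (λ b′ → (row b′ ℕ.≟ row b) ×-dec (col b ℕ.<? col b′)) bs)
  ℕ.+ length (filter (λ b′ → (col b′ ℕ.≟ col b) ×-dec (row b ℕ.<? row b′)) bs) ℕ.+ nth as (col b))

hookProduct : List ℕ → ℕ
hookProduct as = product (map (hookIn (boxes as) as) (boxes as))

H≡hookProduct : ∀ ρ → H ρ ≡ hookProduct (parts ρ)
H≡hookProduct ρ = cong (λ bs → product (map (hookIn bs (parts ρ)) bs)) (diagram≡boxes ρ)

∧-false : ∀ x → (x ∧ false) ≡ false
∧-false true  = refl
∧-false false = refl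

hook-shift : ∀ a as {b} → b ∈ boxes as → hookIn (boxes (a ∷ as)) (a ∷ as) (shift b) ≡ hookIn (boxes as) as b
hook-shift a as {i , j} b∈ with boxes-positive as b∈
... | isSuc , isSuc = cong (suc ∘ (ℕ._+ nth as j)) (cong₂ ℕ._+_
  (trans (count-++ _ (firstRow a) (map shift (boxes as))) (cong₂ ℕ._+_
    (count-none _ (firstRow a) (λ x∈ → case ∈-map⁻ _ x∈ of λ { (_ , _ , refl) → refl }))
    (count-map _ _ shift (boxes as) (λ _ → refl))))
  (trans (count-++ _ (firstRow a) (map shift (boxes as))) (cong₂ ℕ._+_
    (count-none _ (firstRow a) (λ x∈ → case ∈-map⁻ _ x∈ of λ { (k , _ , refl) → ∧-false (k ℕ.≡ᵇ j) }))
    (count-map _ _ shift (boxes as) (λ _ → refl)))))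

∏< : ℕ → (ℕ → ℕ) → ℕ
∏< zero    g = 1
∏< (suc n) g = g 0 ℕ.* ∏< n (g ∘ suc)

∏<-cong : ∀ n {g h} → (∀ {i} → i < n → g i ≡ h i) → ∏< n g ≡ ∏< n h
∏<-cong zero    e = refl
∏<-cong (suc n) e = cong₂ ℕ._*_ (e (s≤s z≤n)) (∏<-cong n (e ∘ s≤s))

∏<-+ : ∀ m n g → ∏< (m ℕ.+ n) g ≡ ∏< m g ℕ.* ∏< n (g ∘ (m ℕ.+_))
∏<-+ zero    n g = sym (ℕ.+-identityʳ _)
∏<-+ (suc m) n g = trans (cong (g 0 ℕ.*_) (∏<-+ m n (g ∘ suc))) (sym (ℕ.*-assoc (g 0) _ _))

product-upTo : ∀ n g → product (map g (upTo n)) ≡ ∏< n g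
product-upTo zero    g = refl
product-upTo (suc n) g = cong (g 0 ℕ.*_) (begin
  product (map g (applyUpTo suc n)) ≡⟨ cong (product ∘ map g) (sym (List.map-upTo suc n)) ⟩
  product (map g (map suc (upTo n))) ≡⟨ cong product (sym (List.map-∘ (upTo n))) ⟩
  product (map (g ∘ suc) (upTo n)) ≡⟨ product-upTo n (g ∘ suc) ⟩
  ∏< n (g ∘ suc)                       ∎)

∏<-descending : ∀ n → ∏< n (λ i → suc (n ∸ suc i)) ≡ n ℕ.!
∏<-descending zero    = refl
∏<-descending (suc n) = cong (suc n ℕ.*_) (∏<-descending n)

-- What the rows `as` contribute to the hook of the box in column `k + 1` of a row placed above
-- them: the boxes of that column, and the whole row `k + 1` that belongs to a shifted hook.
legPart : List ℕ → ℕ → ℕ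
legPart as k = length (filter (λ b → col b ℕ.≟ k) (boxes as)) ℕ.+ nth as k

-- The hook lengths along the first row of `a ∷ as`; the index `i` stands for column `i + 2`.
rowProduct : ℕ → List ℕ → ℕ
rowProduct a as = ∏< a (λ i → suc (a ∸ suc i ℕ.+ legPart as (suc i)))

multiplicity : ℕ → ℕ → ℕ
multiplicity a k = length (filter (ℕ._≟ k) (range a))

multiplicity-suc : ∀ a k → multiplicity (suc a) (suc (suc k)) ≡ multiplicity a (suc k)
multiplicity-suc a k = trans (cong (length ∘ filter (ℕ._≟ suc (suc k))) (range-suc a))
  (count-map (ℕ._≟ suc (suc k)) (ℕ._≟ suc k) suc (range a) (λ _ → refl))

multiplicity-< : ∀ {a k} → k < a → multiplicity a (suc k) ≡ 1
multiplicity-< {suc a} {zero}  _         = trans (cong (length ∘ filter (ℕ._≟ 1)) (range-suc a))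
  (cong suc (count-none (ℕ._≟ 1) (map suc (range a))
    (λ x∈ → case ∈-map⁻ suc x∈ of λ { (_ , y∈ , refl) → case ∈-map⁻ suc y∈ of λ { (_ , _ , refl) → refl } })))
multiplicity-< {suc a} {suc k} (s≤s k<a) = trans (multiplicity-suc a k) (multiplicity-< k<a)

multiplicity-≥ : ∀ {a k} → a ≤ k → multiplicity a (suc k) ≡ 0
multiplicity-≥ {a} {k} a≤k = count-none (ℕ._≟ suc k) (range a) λ {x} x∈ → dec-false (x ℕ.≟ suc k)
  (λ { refl → ℕ.<⇒≱ (proj₂ (∈-range⁻ x∈)) a≤k })

count-> : ∀ a k → length (filter (λ k′ → k ℕ.<? k′) (range a)) ≡ a ∸ k
count-> zero    k       = sym (ℕ.0∸n≡0 k)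
count-> (suc a) zero    = trans (count-all (0 ℕ.<?_) (range (suc a))
  (λ x∈ → case ∈-map⁻ suc x∈ of λ { (_ , _ , refl) → refl })) (trans (List.length-map suc (upTo (suc a))) (List.length-upTo (suc a)))
count-> (suc a) (suc k) = trans (cong (length ∘ filter (suc k ℕ.<?_)) (range-suc a))
  (trans (count-map (suc k ℕ.<?_) (k ℕ.<?_) suc (range a) (λ _ → refl)) (count-> a k))

count-columns : ∀ a as k → length (filter (λ b → col b ℕ.≟ suc k) (boxes (a ∷ as)))
  ≡ multiplicity a k ℕ.+ length (filter (λ b → col b ℕ.≟ k) (boxes as))
count-columns a as k = trans (count-++ (λ b → col b ℕ.≟ suc k) (firstRow a) (map shift (boxes as))) (cong₂ ℕ._+_
  (count-map (λ b → col b ℕ.≟ suc k) (ℕ._≟ k) _ (range a) (λ _ → refl))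
  (count-map (λ b → col b ℕ.≟ suc k) (λ b → col b ℕ.≟ k) shift (boxes as) (λ _ → refl)))

legPart-1 : ∀ a as → legPart (a ∷ as) 1 ≡ a
legPart-1 a as = cong (ℕ._+ a) (trans (count-columns a as 0) (cong₂ ℕ._+_
  (count-none (ℕ._≟ 0) (range a) (λ x∈ → case ∈-map⁻ suc x∈ of λ { (_ , _ , refl) → refl }))
  (count-none (λ b → col b ℕ.≟ 0) (boxes as) (λ {x} x∈ → noZero (proj₂ (boxes-positive as x∈))))))
  where
  noZero : ∀ {n} → IsSuc n → does (n ℕ.≟ 0) ≡ false
  noZero isSuc = refl

legPart-suc : ∀ a as k → legPart (a ∷ as) (suc (suc k)) ≡ multiplicity a (suc k) ℕ.+ legPart as (suc k)
legPart-suc a as k = trans (cong (ℕ._+ nth as (suc k)) (count-columns a as (suc k)))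
  (ℕ.+-assoc (multiplicity a (suc k)) (length (filter (λ b → col b ℕ.≟ suc k) (boxes as))) (nth as (suc k)))

-- By strict decrease the rows of `as` end no later than column `b`, and there are at most `b` of
-- them, so neither summand reaches `k + 1`.
legPart-≥ : ∀ {b} as → Linked _>_ (b ∷ as) → ∀ {k} → b ≤ k → legPart as (suc k) ≡ 0
legPart-≥ []       _           _   = refl
legPart-≥ (c ∷ cs) (c<b ∷ lk) {zero}  b≤k = contradiction (ℕ.<-≤-trans c<b b≤k) λ ()
legPart-≥ (c ∷ cs) (c<b ∷ lk) {suc k} b≤k = trans (legPart-suc c cs k)
  (cong₂ ℕ._+_ (multiplicity-≥ c≤k) (legPart-≥ cs lk c≤k))
  where c≤k = ℕ.s≤s⁻¹ (ℕ.<-≤-trans c<b b≤k)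

hook-firstRow : ∀ a as {i} → i < a →
  hookIn (boxes (a ∷ as)) (a ∷ as) (1 , suc (suc i)) ≡ suc (a ∸ suc i ℕ.+ legPart as (suc i))
hook-firstRow a as {i} i<a = cong suc (trans (cong (ℕ._+ nth as (suc i)) (cong₂ ℕ._+_ arm leg))
  (ℕ.+-assoc (a ∸ suc i) (length (filter (λ b → col b ℕ.≟ suc i) (boxes as))) (nth as (suc i))))
  where
  arm? = λ (b : Box) → (row b ℕ.≟ 1) ×-dec (suc (suc i) ℕ.<? col b)
  leg? = λ (b : Box) → (col b ℕ.≟ suc (suc i)) ×-dec (1 ℕ.<? row b)
  arm : length (filter arm? (firstRow a ++ map shift (boxes as))) ≡ a ∸ suc i
  arm = trans (count-++ arm? (firstRow a) (map shift (boxes as))) (trans (cong₂ ℕ._+_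
    (trans (count-map arm? (suc i ℕ.<?_) _ (range a) (λ _ → refl)) (count-> a (suc i)))
    (count-none arm? (map shift (boxes as)) (λ x∈ → case ∈-map⁻ shift x∈ of λ { (y , y∈ , refl) → below {j = col y} (proj₁ (boxes-positive as y∈)) })))
    (ℕ.+-identityʳ _))
    where
    below : ∀ {r j} → IsSuc r → does (arm? (shift (r , j))) ≡ false
    below isSuc = refl
  leg : length (filter leg? (firstRow a ++ map shift (boxes as))) ≡ length (filter (λ b → col b ℕ.≟ suc i) (boxes as))
  leg = trans (count-++ leg? (firstRow a) (map shift (boxes as))) (cong₂ ℕ._+_
    (count-none leg? (firstRow a) (λ x∈ → case ∈-map⁻ _ x∈ of λ { (k , _ , refl) → ∧-false (k ℕ.≡ᵇ suc i) }))
    (count-map leg? (λ b → col b ℕ.≟ suc i) shift (boxes as) (λ {x} x∈ → below x (proj₁ (boxes-positive as x∈)))))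
    where
    below : ∀ b → IsSuc (row b) → does (leg? (shift b)) ≡ does (col b ℕ.≟ suc i)
    below (_ , j) isSuc with j ℕ.≡ᵇ suc i
    ... | true  = refl
    ... | false = refl

hookProduct-∷ : ∀ a as → hookProduct (a ∷ as) ≡ rowProduct a as ℕ.* hookProduct as
hookProduct-∷ a as = begin
  product (map h (firstRow a ++ map shift (boxes as)))
    ≡⟨ cong product (List.map-++ h (firstRow a) (map shift (boxes as))) ⟩
  product (map h (firstRow a) ++ map h (map shift (boxes as)))
    ≡⟨ product-++ (map h (firstRow a)) (map h (map shift (boxes as))) ⟩
  product (map h (firstRow a)) ℕ.* product (map h (map shift (boxes as)))
    ≡⟨ cong₂ ℕ._*_ first (cong product (trans (sym (List.map-∘ (boxes as))) (List.map-cong-local (All.tabulate (hook-shift a as))))) ⟩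
  rowProduct a as ℕ.* hookProduct as ∎
  where
  h = hookIn (boxes (a ∷ as)) (a ∷ as)
  first : product (map h (firstRow a)) ≡ rowProduct a as
  first = begin
    product (map h (map (λ k → 1 , suc k) (map suc (upTo a))))
      ≡⟨ cong product (trans (sym (List.map-∘ (range a))) (sym (List.map-∘ (upTo a)))) ⟩
    product (map (λ i → h (1 , suc (suc i))) (upTo a))
      ≡⟨ product-upTo a (λ i → h (1 , suc (suc i))) ⟩
    ∏< a (λ i → h (1 , suc (suc i)))
      ≡⟨ ∏<-cong a (hook-firstRow a as) ⟩
    rowProduct a as ∎

rowProduct-[] : ∀ a → rowProduct a [] ≡ a ℕ.!
rowProduct-[] a = trans (∏<-cong a (λ _ → cong suc (ℕ.+-identityʳ _))) (∏<-descending a)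

-- In the columns ≤ b the hook lengths of the first row of a ∷ b ∷ bs, shifted by one
-- column, are those of a ∷ bs; further to the right both are consecutive integers.
rowProduct-∷ : ∀ {a b} bs → b < a → Linked _>_ (b ∷ bs) →
  rowProduct a (b ∷ bs) ℕ.* (a ∸ b) ≡ (a ℕ.+ b) ℕ.* rowProduct a bs
rowProduct-∷ {suc a′} {b} bs (s≤s b≤a′) lk with d , refl ← ℕ.m≤n⇒∃[o]m+o≡n b≤a′ = begin
  suc (b ℕ.+ d ℕ.+ legPart (b ∷ bs) 1) ℕ.* ∏< (b ℕ.+ d) g ℕ.* (suc (b ℕ.+ d) ∸ b)
    ≡⟨ cong₂ (λ x y → suc (b ℕ.+ d ℕ.+ x) ℕ.* y ℕ.* (suc (b ℕ.+ d) ∸ b)) (legPart-1 b bs) (∏<-+ b d g) ⟩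
  suc (b ℕ.+ d ℕ.+ b) ℕ.* (∏< b g ℕ.* ∏< d (g ∘ (b ℕ.+_))) ℕ.* (suc (b ℕ.+ d) ∸ b)
    ≡⟨ cong₂ (λ x y → suc (b ℕ.+ d ℕ.+ b) ℕ.* (∏< b g ℕ.* x) ℕ.* y) upper diff ⟩
  suc (b ℕ.+ d ℕ.+ b) ℕ.* (∏< b g ℕ.* d ℕ.!) ℕ.* suc d
    ≡⟨ ℕ.*-assoc (suc (b ℕ.+ d ℕ.+ b)) (∏< b g ℕ.* d ℕ.!) (suc d) ⟩
  suc (b ℕ.+ d ℕ.+ b) ℕ.* (∏< b g ℕ.* d ℕ.! ℕ.* suc d)
    ≡⟨ cong (suc (b ℕ.+ d ℕ.+ b) ℕ.*_) (trans (ℕ.*-assoc (∏< b g) (d ℕ.!) (suc d)) (cong (∏< b g ℕ.*_) (ℕ.*-comm (d ℕ.!) (suc d)))) ⟩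
  suc (b ℕ.+ d ℕ.+ b) ℕ.* (∏< b g ℕ.* suc d ℕ.!)
    ≡⟨ cong (suc (b ℕ.+ d ℕ.+ b) ℕ.*_) (sym target) ⟩
  suc (b ℕ.+ d ℕ.+ b) ℕ.* rowProduct (suc (b ℕ.+ d)) bs ∎
  where
  g h : ℕ → ℕ
  g i = suc (b ℕ.+ d ∸ suc i ℕ.+ legPart (b ∷ bs) (suc (suc i)))
  h i = suc (b ℕ.+ d ∸ i ℕ.+ legPart bs (suc i))
  diff : suc (b ℕ.+ d) ∸ b ≡ suc d
  diff = trans (cong (_∸ b) (sym (ℕ.+-suc b d))) (ℕ.m+n∸m≡n b (suc d))
  upper : ∏< d (g ∘ (b ℕ.+_)) ≡ d ℕ.!
  upper = trans (∏<-cong d (λ {i} _ → cong suc (begin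
    b ℕ.+ d ∸ suc (b ℕ.+ i) ℕ.+ legPart (b ∷ bs) (suc (suc (b ℕ.+ i)))
      ≡⟨ cong₂ ℕ._+_ (trans (cong (b ℕ.+ d ∸_) (sym (ℕ.+-suc b i))) (ℕ.[m+n]∸[m+o]≡n∸o b d (suc i)))
           (trans (legPart-suc b bs (b ℕ.+ i)) (cong₂ ℕ._+_ (multiplicity-≥ (ℕ.m≤m+n b i)) (legPart-≥ bs lk (ℕ.m≤m+n b i)))) ⟩
    d ∸ suc i ℕ.+ 0 ≡⟨ ℕ.+-identityʳ _ ⟩
    d ∸ suc i         ∎))) (∏<-descending d)
  target : rowProduct (suc (b ℕ.+ d)) bs ≡ ∏< b g ℕ.* suc d ℕ.!
  target = begin
    ∏< (suc (b ℕ.+ d)) h ≡⟨ cong (λ n → ∏< n h) (sym (ℕ.+-suc b d)) ⟩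
    ∏< (b ℕ.+ suc d) h ≡⟨ ∏<-+ b (suc d) h ⟩
    ∏< b h ℕ.* ∏< (suc d) (h ∘ (b ℕ.+_))
      ≡⟨ cong₂ ℕ._*_ (∏<-cong b lower) (trans (∏<-cong (suc d) (λ {i} _ → cong suc (trans
           (cong₂ ℕ._+_ (ℕ.[m+n]∸[m+o]≡n∸o b d i) (legPart-≥ bs lk (ℕ.m≤m+n b i))) (ℕ.+-identityʳ _)))) (∏<-descending (suc d))) ⟩
    ∏< b g ℕ.* suc d ℕ.! ∎
    where
    -- The arm is one box shorter in the next column, while the row of `b` adds one box to the leg.
    lower : ∀ {i} → i < b → h i ≡ g i
    lower {i} i<b = cong suc (begin
      b ℕ.+ d ∸ i ℕ.+ legPart bs (suc i)
        ≡⟨ cong (ℕ._+ legPart bs (suc i)) (sym (ℕ.suc-pred (b ℕ.+ d ∸ i) {{ℕ.>-nonZero (ℕ.m<n⇒0<n∸m (ℕ.<-≤-trans i<b (ℕ.m≤m+n b d)))}})) ⟩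
      suc (ℕ.pred (b ℕ.+ d ∸ i) ℕ.+ legPart bs (suc i))
        ≡⟨ cong (λ x → suc (x ℕ.+ legPart bs (suc i))) (ℕ.pred[m∸n]≡m∸[1+n] (b ℕ.+ d) i) ⟩
      suc (b ℕ.+ d ∸ suc i ℕ.+ legPart bs (suc i))
        ≡⟨ ℕ.+-suc (b ℕ.+ d ∸ suc i) (legPart bs (suc i)) ⟨
      b ℕ.+ d ∸ suc i ℕ.+ (1 ℕ.+ legPart bs (suc i))
        ≡⟨ cong (λ m → b ℕ.+ d ∸ suc i ℕ.+ (m ℕ.+ legPart bs (suc i))) (sym (multiplicity-< i<b)) ⟩
      b ℕ.+ d ∸ suc i ℕ.+ (multiplicity b (suc i) ℕ.+ legPart bs (suc i))
        ≡⟨ cong (b ℕ.+ d ∸ suc i ℕ.+_) (sym (legPart-suc b bs i)) ⟩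
      b ℕ.+ d ∸ suc i ℕ.+ legPart (b ∷ bs) (suc (suc i)) ∎)

-- The hook formula

opaque

  -- Opaque, so that they are atoms for unification and the ring solver instead of unfolding to
  -- binomial coefficients.
  z w : ℕ → ℚ
  z a = fromℕ (suc a C 2)
  w a = fromℕ (a C 2)

  z-def : ∀ a → z a ≡ fromℕ (suc a C 2)
  z-def a = refl

  w-def : ∀ a → w a ≡ fromℕ (a C 2)
  w-def a = refl

w-suc : ∀ a → w (suc a) ≡ z a
w-suc a = trans (w-def (suc a)) (sym (z-def a))

z-0 : z 0 ≡ 0ℚ
z-0 = z-def 0

z≡w+ : ∀ a → z a ≡ fromℕ a + w a
z≡w+ a = trans (trans (z-def a) (cong fromℕ (trans (sym (Comb.nCk+nC[k+1]≡[n+1]C[k+1] a 1)) (cong (ℕ._+ a C 2) (Comb.nC1≡n a)))))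
  (trans (fromℕ-+ a (a C 2)) (cong (fromℕ a +_) (sym (w-def a))))

w-formula : ∀ a → w a ≡ ½ * (fromℕ a * fromℕ a - fromℕ a)
w-formula zero    = w-def 0
w-formula (suc a) = begin
  w (suc a) ≡⟨ w-suc a ⟩
  z a ≡⟨ z≡w+ a ⟩
  fromℕ a + w a ≡⟨ cong (fromℕ a +_) (w-formula a) ⟩
  A + ½ * (A * A - A)
    ≡⟨ solve 1 (λ A → A :+ con ½ :* (A :* A :- A) := con ½ :* ((con 1ℚ :+ A) :* (con 1ℚ :+ A) :- (con 1ℚ :+ A))) refl A ⟩
  ½ * ((1ℚ + A) * (1ℚ + A) - (1ℚ + A)) ≡⟨ cong (λ S → ½ * (S * S - S)) (fromℕ-suc a) ⟨
  ½ * (fromℕ (suc a) * fromℕ (suc a) - fromℕ (suc a)) ∎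
  where A = fromℕ a

z-formula : ∀ a → z a ≡ ½ * (fromℕ a * fromℕ a + fromℕ a)
z-formula a = trans (z≡w+ a) (trans (cong (fromℕ a +_) (w-formula a))
  (solve 1 (λ A → A :+ con ½ :* (A :* A :- A) := con ½ :* (A :* A :+ A)) refl (fromℕ a)))

z-z : ∀ a b → z a - z b ≡ ½ * ((fromℕ a - fromℕ b) * (1ℚ + fromℕ a + fromℕ b))
z-z a b = trans (cong₂ _-_ (z-formula a) (z-formula b))
  (solve 2 (λ A B → con ½ :* (A :* A :+ A) :- con ½ :* (B :* B :+ B) := con ½ :* ((A :- B) :* (con 1ℚ :+ A :+ B)))
    refl (fromℕ a) (fromℕ b))

z-w : ∀ a b → z a - w b ≡ ½ * ((fromℕ a + fromℕ b) * (1ℚ + fromℕ a - fromℕ b))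
z-w a b = trans (cong₂ _-_ (z-formula a) (w-formula b))
  (solve 2 (λ A B → con ½ :* (A :* A :+ A) :- con ½ :* (B :* B :- B) := con ½ :* ((A :+ B) :* (con 1ℚ :+ A :- B)))
    refl (fromℕ a) (fromℕ b))

½≢0 : ½ ≢ 0ℚ
½≢0 ()

1+m+n≢0 : ∀ m n → 1ℚ + fromℕ m + fromℕ n ≢ 0ℚ
1+m+n≢0 m n e = fromℕ-≢0 {suc (m ℕ.+ n)} (s≤s z≤n)
  (trans (fromℕ-+ (suc m) n) (trans (cong (_+ fromℕ n) (fromℕ-suc m)) e))

m+n≢0 : ∀ {m n} → n < m → fromℕ m + fromℕ n ≢ 0ℚ
m+n≢0 {m} {n} n<m e = fromℕ-≢0 {m ℕ.+ n} (ℕ.<-≤-trans (ℕ.≤-<-trans z≤n n<m) (ℕ.m≤m+n m n)) (trans (fromℕ-+ m n) e)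

z-injective : ∀ {a b} → a ≢ b → z a ≢ z b
z-injective {a} {b} a≢b e = *-≢0 ½≢0 (*-≢0 (≢⇒-≢0 (a≢b ∘ fromℕ-injective)) (1+m+n≢0 a b))
  (trans (sym (z-z a b)) (trans (cong (_- z b) e) (ℚ.+-inverseʳ (z b))))

z-z≢0 : ∀ {a b} → a ≢ b → z a - z b ≢ 0ℚ
z-z≢0 a≢b = ≢⇒-≢0 (z-injective a≢b)

z≢0 : ∀ {a} → 0 < a → z a ≢ 0ℚ
z≢0 0<a e = z-injective (ℕ.<⇒≢ 0<a ∘ sym) (trans e (sym z-0))

!≢0 : ∀ n → fromℕ (n ℕ.!) ≢ 0ℚ
!≢0 n = fromℕ-≢0 (ℕ.1≤n! n)

open Residues z w

-- The share of a pair a > b in the reciprocal hook product. Its vanishing at a = b disposes of the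
-- enlargements that are not strict.
pairFactor : ℕ → ℕ → ℚ
pairFactor a b = (fromℕ a - fromℕ b) * inv (fromℕ a + fromℕ b)

1/hooks : List ℕ → ℚ
1/hooks []       = 1ℚ
1/hooks (a ∷ as) = 1/hooks as * (inv (fromℕ (a ℕ.!)) * ∏ as (pairFactor a))

Decreasing : List ℕ → Set
Decreasing = AllPairs _>_

Decreasing⇒Linked : ∀ {as} → Decreasing as → Linked _>_ as
Decreasing⇒Linked = LinkedP.AllPairs⇒Linked

strict⇒Decreasing : ∀ {as} → IsStrict as → Decreasing as
strict⇒Decreasing (lk , _) = LinkedP.Linked⇒AllPairs (λ b<a c<b → ℕ.<-trans c<b b<a) lk

fromℕ-∸ : ∀ {m n} → n ≤ m → fromℕ (m ∸ n) ≡ fromℕ m - fromℕ n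
fromℕ-∸ {m} {n} n≤m = begin
  fromℕ (m ∸ n) ≡⟨ solve 2 (λ x y → x := x :+ y :- y) refl (fromℕ (m ∸ n)) (fromℕ n) ⟩
  fromℕ (m ∸ n) + fromℕ n - fromℕ n ≡⟨ cong (_- fromℕ n) (sym (fromℕ-+ (m ∸ n) n)) ⟩
  fromℕ (m ∸ n ℕ.+ n) - fromℕ n ≡⟨ cong (λ k → fromℕ k - fromℕ n) (ℕ.m∸n+n≡m n≤m) ⟩
  fromℕ m - fromℕ n                   ∎

-- A single row has the product `a !`, and by `rowProduct-∷` each further part `b` multiplies it by
-- (a + b)/(a - b).
rowProduct-inverse : ∀ a as → Decreasing (a ∷ as) →
  fromℕ (rowProduct a as) * (inv (fromℕ (a ℕ.!)) * ∏ as (pairFactor a)) ≡ 1ℚ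
rowProduct-inverse a [] _ = trans (cong₂ (λ x y → fromℕ x * y) (rowProduct-[] a) (ℚ.*-identityʳ _)) (inv-inverse (!≢0 a))
rowProduct-inverse a (b ∷ bs) ((b<a ∷ bs<a) ∷ dec@(_ ∷ dec′)) = begin
  r * (i * ((A - B) * j * p))
    ≡⟨ solve 5 (λ r i d j p → r :* (i :* (d :* j :* p)) := (r :* d) :* j :* (i :* p)) refl r i (A - B) j p ⟩
  r * (A - B) * j * (i * p)
    ≡⟨ cong (λ x → x * j * (i * p)) row≡ ⟩
  (A + B) * s * j * (i * p)
    ≡⟨ solve 5 (λ c s j i p → c :* s :* j :* (i :* p) := (c :* j) :* (s :* (i :* p))) refl (A + B) s j i p ⟩
  (A + B) * j * (s * (i * p))
    ≡⟨ cong₂ _*_ (inv-inverse (m+n≢0 b<a)) (rowProduct-inverse a bs (bs<a ∷ dec′)) ⟩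
  1ℚ * 1ℚ ∎
  where
  A = fromℕ a
  B = fromℕ b
  r = fromℕ (rowProduct a (b ∷ bs))
  s = fromℕ (rowProduct a bs)
  i = inv (fromℕ (a ℕ.!))
  j = inv (A + B)
  p = ∏ bs (pairFactor a)
  row≡ : r * (A - B) ≡ (A + B) * s
  row≡ = begin
    r * (A - B) ≡⟨ cong (r *_) (fromℕ-∸ (ℕ.<⇒≤ b<a)) ⟨
    r * fromℕ (a ∸ b) ≡⟨ fromℕ-* (rowProduct a (b ∷ bs)) (a ∸ b) ⟨
    fromℕ (rowProduct a (b ∷ bs) ℕ.* (a ∸ b)) ≡⟨ cong fromℕ (rowProduct-∷ bs b<a (Decreasing⇒Linked dec)) ⟩
    fromℕ ((a ℕ.+ b) ℕ.* rowProduct a bs) ≡⟨ fromℕ-* (a ℕ.+ b) (rowProduct a bs) ⟩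
    fromℕ (a ℕ.+ b) * s ≡⟨ cong (_* s) (fromℕ-+ a b) ⟩
    (A + B) * s                                         ∎

hookProduct-inverse : ∀ as → Decreasing as → fromℕ (hookProduct as) * 1/hooks as ≡ 1ℚ
hookProduct-inverse []       _ = refl
hookProduct-inverse (a ∷ as) dec@(_ ∷ dec′) = begin
  fromℕ (hookProduct (a ∷ as)) * (1/hooks as * k)
    ≡⟨ cong (_* (1/hooks as * k)) (trans (cong fromℕ (hookProduct-∷ a as)) (fromℕ-* (rowProduct a as) (hookProduct as))) ⟩
  fromℕ (rowProduct a as) * fromℕ (hookProduct as) * (1/hooks as * k)
    ≡⟨ solve 4 (λ r h i k → r :* h :* (i :* k) := (r :* k) :* (h :* i)) refl
         (fromℕ (rowProduct a as)) (fromℕ (hookProduct as)) (1/hooks as) k ⟩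
  fromℕ (rowProduct a as) * k * (fromℕ (hookProduct as) * 1/hooks as)
    ≡⟨ cong₂ _*_ (rowProduct-inverse a as dec) (hookProduct-inverse as dec′) ⟩
  1ℚ * 1ℚ ∎
  where k = inv (fromℕ (a ℕ.!)) * ∏ as (pairFactor a)

fromℕ-reciprocal : ∀ n {{_ : NonZero n}} → fromℕ n * (ℤ.+ 1 / n) ≡ 1ℚ
fromℕ-reciprocal (suc n) = ℚ.toℚᵘ-injective (ℚᵘ.≃-trans (ℚ.toℚᵘ-homo-* (fromℕ (suc n)) (ℤ.+ 1 / suc n))
  (ℚᵘ.≃-trans (ℚᵘ.*-cong (ℚ.toℚᵘ-fromℚᵘ (ℤ.+ suc n ℚᵘ./ 1)) (ℚ.toℚᵘ-fromℚᵘ (ℤ.+ 1 ℚᵘ./ suc n)))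
    (ℚᵘ.*≡* (trans (ℤ.*-identityʳ _) (trans (ℤ.*-identityʳ _) (trans (cong ℤ.+_ (sym (ℕ.+-identityʳ (suc n)))) (sym (ℤ.*-identityˡ _))))))))

decreasing-parts : ∀ ρ → Decreasing (parts ρ)
decreasing-parts (mkStrict as s) = strict⇒Decreasing (recompute (isStrict? as) s)

/H≡1/hooks : ∀ x ρ → x /H ρ ≡ x * 1/hooks (parts ρ)
/H≡1/hooks x ρ = cong (x *_) (*-cancel (fromℕ-≢0 (ℕ.>-nonZero⁻¹ (H ρ) {{H≢0 ρ}}))
  (trans (fromℕ-reciprocal (H ρ) {{H≢0 ρ}}) (sym (trans (cong (λ h → fromℕ h * 1/hooks as) (H≡hookProduct ρ))
    (hookProduct-inverse as (decreasing-parts ρ))))))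
  where as = parts ρ

-- Reciprocal hook products under enlargement of a part

-- The pairs (a , bs), bs arising from as by enlarging a part a to a + 1, where
-- a = 0 stands for a new row.  bs need not be strict, but then 1/hooks bs = 0.
enlargements : List ℕ → List (ℕ × List ℕ)
enlargements []       = [ 0 , [ 1 ] ]
enlargements (a ∷ as) = (a , suc a ∷ as) ∷ map (λ (b , bs) → b , a ∷ bs) (enlargements as)

weight : ℕ → ℚ
weight zero    = 1ℚ
weight (suc _) = fromℕ 2

-- The change of the pair factor is the factor of `a` in the rational function, taken at the pole
-- `z b` of the enlarged part. In `pairFactor-sucˡ` the larger part grows, and the roles of `a` and
-- `b` are exchanged.
pairFactor-sucʳ : ∀ {a b} → b < a → pairFactor a (suc b) ≡ pairFactor a b * ((z b - w a) * inv (z b - z a))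
pairFactor-sucʳ {a} {b} b<a = begin
  (A - fromℕ (suc b)) * inv (A + fromℕ (suc b))
    ≡⟨ fraction-≡ {A - fromℕ (suc b)} {r = (A - B) * (z b - w a)} m+sn≢0 (*-≢0 (m+n≢0 b<a) (z-z≢0 (ℕ.<⇒≢ b<a))) identity ⟩
  (A - B) * (z b - w a) * inv ((A + B) * (z b - z a))
    ≡⟨ cong ((A - B) * (z b - w a) *_) (inv-* (m+n≢0 b<a) (z-z≢0 (ℕ.<⇒≢ b<a))) ⟩
  (A - B) * (z b - w a) * (inv (A + B) * inv (z b - z a))
    ≡⟨ solve 4 (λ a b c d → a :* b :* (c :* d) := a :* c :* (b :* d)) refl (A - B) (z b - w a) _ _ ⟩
  pairFactor a b * ((z b - w a) * inv (z b - z a)) ∎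
  where
  A = fromℕ a
  B = fromℕ b
  m+sn≢0 : A + fromℕ (suc b) ≢ 0ℚ
  m+sn≢0 e = 1+m+n≢0 a b (trans (solve 2 (λ A B → con 1ℚ :+ A :+ B := A :+ (con 1ℚ :+ B)) refl A B)
    (trans (cong (A +_) (sym (fromℕ-suc b))) e))
  identity : (A - fromℕ (suc b)) * ((A + B) * (z b - z a)) ≡ (A - B) * (z b - w a) * (A + fromℕ (suc b))
  identity = begin
    (A - fromℕ (suc b)) * ((A + B) * (z b - z a))
      ≡⟨ cong₂ (λ x y → (A - x) * ((A + B) * y)) (fromℕ-suc b) (z-z b a) ⟩
    (A - (1ℚ + B)) * ((A + B) * (½ * ((B - A) * (1ℚ + B + A))))
      ≡⟨ solve 4 (λ A B o h → (A :- (o :+ B)) :* ((A :+ B) :* (h :* ((B :- A) :* (o :+ B :+ A))))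
           := (A :- B) :* (h :* ((B :+ A) :* (o :+ B :- A))) :* (A :+ (o :+ B))) refl A B 1ℚ ½ ⟩
    (A - B) * (½ * ((B + A) * (1ℚ + B - A))) * (A + (1ℚ + B))
      ≡⟨ cong₂ (λ x y → (A - B) * y * (A + x)) (fromℕ-suc b) (z-w b a) ⟨
    (A - B) * (z b - w a) * (A + fromℕ (suc b)) ∎

pairFactor-sucˡ : ∀ {a b} → b < a → pairFactor (suc a) b ≡ pairFactor a b * ((z a - w b) * inv (z a - z b))
pairFactor-sucˡ {a} {b} b<a = begin
  (fromℕ (suc a) - B) * inv (fromℕ (suc a) + B)
    ≡⟨ fraction-≡ {fromℕ (suc a) - B} {r = (A - B) * (z a - w b)} (m+n≢0 (ℕ.m<n⇒m<1+n b<a)) (*-≢0 (m+n≢0 b<a) (z-z≢0 (ℕ.<⇒≢ b<a ∘ sym))) identity ⟩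
  (A - B) * (z a - w b) * inv ((A + B) * (z a - z b))
    ≡⟨ cong ((A - B) * (z a - w b) *_) (inv-* (m+n≢0 b<a) (z-z≢0 (ℕ.<⇒≢ b<a ∘ sym))) ⟩
  (A - B) * (z a - w b) * (inv (A + B) * inv (z a - z b))
    ≡⟨ solve 4 (λ a b c d → a :* b :* (c :* d) := a :* c :* (b :* d)) refl (A - B) (z a - w b) _ _ ⟩
  pairFactor a b * ((z a - w b) * inv (z a - z b)) ∎
  where
  A = fromℕ a
  B = fromℕ b
  identity : (fromℕ (suc a) - B) * ((A + B) * (z a - z b)) ≡ (A - B) * (z a - w b) * (fromℕ (suc a) + B)
  identity = begin
    (fromℕ (suc a) - B) * ((A + B) * (z a - z b))
      ≡⟨ cong₂ (λ x y → (x - B) * ((A + B) * y)) (fromℕ-suc a) (z-z a b) ⟩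
    (1ℚ + A - B) * ((A + B) * (½ * ((A - B) * (1ℚ + A + B))))
      ≡⟨ solve 4 (λ A B o h → (o :+ A :- B) :* ((A :+ B) :* (h :* ((A :- B) :* (o :+ A :+ B))))
           := (A :- B) :* (h :* ((A :+ B) :* (o :+ A :- B))) :* (o :+ A :+ B)) refl A B 1ℚ ½ ⟩
    (A - B) * (½ * ((A + B) * (1ℚ + A - B))) * (1ℚ + A + B)
      ≡⟨ cong₂ (λ x y → (A - B) * y * (x + B)) (fromℕ-suc a) (z-w a b) ⟨
    (A - B) * (z a - w b) * (fromℕ (suc a) + B) ∎

-- The multiplier is exactly the one by which `residues (a ∷ as)` alters the test function at the
-- old poles.
pairFactors-enlarge : ∀ {a} as {b bs} → 0 < a → All (a >_) as → (b , bs) ∈ enlargements as →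
  ∏ bs (pairFactor a) ≡ ∏ as (pairFactor a) * ((z b - w a) * inv (z b - z a))
pairFactors-enlarge {a} [] 0<a _ (here refl) = begin
  pairFactor a 1 * 1ℚ ≡⟨ ℚ.*-identityʳ _ ⟩
  pairFactor a 1 ≡⟨ pairFactor-sucʳ 0<a ⟩
  -- An absent row behaves like a part 0, whose pair factor a/a is 1.
  pairFactor a 0 * x ≡⟨ cong (_* x) (trans
    (cong₂ (λ p q → p * inv q) (ℚ.+-identityʳ (fromℕ a)) (ℚ.+-identityʳ (fromℕ a))) (inv-inverse (fromℕ-≢0 0<a))) ⟩
  1ℚ * x                           ∎
  where x = (z 0 - w a) * inv (z 0 - z a)
pairFactors-enlarge {a} (c ∷ cs) 0<a (c<a ∷ cs<a) (here refl) = trans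
  (cong (_* ∏ cs (pairFactor a)) (pairFactor-sucʳ c<a))
  (solve 3 (λ x y u → x :* y :* u := x :* u :* y) refl (pairFactor a c) _ (∏ cs (pairFactor a)))
pairFactors-enlarge {a} (c ∷ cs) 0<a (c<a ∷ cs<a) (there b∈) with (b , bs) , b∈′ , refl ← ∈-map⁻ _ b∈ = trans
  (cong (pairFactor a c *_) (pairFactors-enlarge cs 0<a cs<a b∈′))
  (sym (ℚ.*-assoc (pairFactor a c) (∏ cs (pairFactor a)) _))

-- The extra `z a` compensates the factor `inv t` of `rational` at t = z a.
pairFactors-suc : ∀ {a} as → 0 < a → All (a >_) as →
  ∏ as (pairFactor (suc a)) ≡ ∏ as (pairFactor a) * (z a * rational as (z a))
pairFactors-suc {a} []       0<a _            = sym (cong (1ℚ *_) (inv-inverse (z≢0 0<a)))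
pairFactors-suc {a} (b ∷ bs) 0<a (b<a ∷ bs<a) = trans
  (cong₂ _*_ (pairFactor-sucˡ b<a) (pairFactors-suc bs 0<a bs<a))
  (solve 5 (λ f x p z r → f :* x :* (p :* (z :* r)) := f :* p :* (z :* (r :* x))) refl
    (pairFactor a b) ((z a - w b) * inv (z a - z b)) (∏ bs (pairFactor a)) (z a) (rational bs (z a)))

decreasing⇒Distinct : ∀ {as} → Decreasing as → All (0 <_) as → Distinct as
decreasing⇒Distinct []            []          = tt
decreasing⇒Distinct {a ∷ as} (as<a ∷ dec) (0<a ∷ 0<as) = notPole as as<a , decreasing⇒Distinct dec 0<as
  where
  notPole : ∀ bs → All (a >_) bs → ¬ Pole bs (z a)
  notPole []       _            e        = z≢0 0<a e
  notPole (b ∷ bs) (b<a ∷ _)    (inj₁ e) = z-injective (ℕ.<⇒≢ b<a ∘ sym) e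
  notPole (b ∷ bs) (_ ∷ bs<a)   (inj₂ p) = notPole bs bs<a p

-- Both sides follow one recursion: enlarging the first part is the new pole `z a`, enlarging a
-- later part is an old pole with the test function modified by `pairFactors-enlarge`.
∑-enlargements : ∀ as → Decreasing as → All (0 <_) as → ∀ (φ : ℚ → ℚ) →
  ∑ (enlargements as) (λ (b , bs) → weight b * (1/hooks bs * φ (z b))) ≡ 1/hooks as * residues as φ
∑-enlargements []       _            _            φ =
  trans (solve 1 (λ x → con 1ℚ :* (con 1ℚ :* x) :+ con 0ℚ := con 1ℚ :* x) refl (φ (z 0))) (cong (λ t → 1ℚ * φ t) z-0)
∑-enlargements (a ∷ as) (as<a ∷ dec) (0<a ∷ 0<as) φ = begin
  weight a * (1/hooks (suc a ∷ as) * φ (z a))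
    + ∑ (map (λ (b , bs) → b , a ∷ bs) (enlargements as)) (λ (b , bs) → weight b * (1/hooks bs * φ (z b)))
    ≡⟨ cong₂ _+_ (head 0<a as<a) tail ⟩
  k * p * (φ (z a) * ((z a - w a) * r)) + p * (k * residues as φ′)
    ≡⟨ solve 4 (λ k p x y → k :* p :* x :+ p :* (k :* y) := k :* p :* (y :+ x)) refl k p (φ (z a) * ((z a - w a) * r)) _ ⟩
  k * p * (residues as φ′ + φ (z a) * ((z a - w a) * r)) ∎
  where
  k = 1/hooks as
  p = inv (fromℕ (a ℕ.!)) * ∏ as (pairFactor a)
  r = rational as (z a)
  φ′ : ℚ → ℚ
  φ′ t = φ t * ((t - w a) * inv (t - z a))

  head : 0 < a → All (a >_) as → weight a * (1/hooks (suc a ∷ as) * φ (z a)) ≡ k * p * (φ (z a) * ((z a - w a) * r))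
  head 0<a@(s≤s _) as<a = begin
    fromℕ 2 * (k * (inv (fromℕ (suc a ℕ.!)) * ∏ as (pairFactor (suc a))) * x)
      ≡⟨ cong₂ (λ i q → fromℕ 2 * (k * (i * q) * x))
           (trans (cong inv (fromℕ-* (suc a) (a ℕ.!))) (inv-* (fromℕ-≢0 {suc a} (s≤s z≤n)) (!≢0 a))) (pairFactors-suc as 0<a as<a) ⟩
    fromℕ 2 * (k * (inv (fromℕ (suc a)) * i * (pf * (z a * r))) * x)
      ≡⟨ solve 8 (λ t k s i q z r x → t :* (k :* (s :* i :* (q :* (z :* r))) :* x) := (t :* z :* s) :* (k :* (i :* q) :* (x :* r)))
           refl (fromℕ 2) k (inv (fromℕ (suc a))) i pf (z a) r x ⟩
    fromℕ 2 * z a * inv (fromℕ (suc a)) * (k * p * (x * r))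
      ≡⟨ cong (_* (k * p * (x * r))) 2z ⟩
    (z a - w a) * (k * p * (x * r))
      ≡⟨ solve 5 (λ d k p x r → d :* (k :* p :* (x :* r)) := k :* p :* (x :* (d :* r))) refl (z a - w a) k p x r ⟩
    k * p * (x * ((z a - w a) * r)) ∎
    where
    x = φ (z a)
    i = inv (fromℕ (a ℕ.!))
    pf = ∏ as (pairFactor a)
    A = fromℕ a
    -- The coefficient 2 of `D` is used here: together with the 1/(a + 1) from the factorial it
    -- yields the numerator of the residue.
    2z : fromℕ 2 * z a * inv (fromℕ (suc a)) ≡ z a - w a
    2z = begin
      fromℕ 2 * z a * inv (fromℕ (suc a))
        ≡⟨ cong (λ y → fromℕ 2 * y * inv (fromℕ (suc a))) (z-formula a) ⟩
      fromℕ 2 * (½ * (A * A + A)) * inv (fromℕ (suc a))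
        ≡⟨ solve 2 (λ A s → con (fromℕ 2) :* (con ½ :* (A :* A :+ A)) :* s := A :* ((con 1ℚ :+ A) :* s)) refl A (inv (fromℕ (suc a))) ⟩
      A * ((1ℚ + A) * inv (fromℕ (suc a)))
        ≡⟨ cong (λ y → A * (y * inv (fromℕ (suc a)))) (fromℕ-suc a) ⟨
      A * (fromℕ (suc a) * inv (fromℕ (suc a)))
        ≡⟨ cong (A *_) (inv-inverse (fromℕ-≢0 {suc a} (s≤s z≤n))) ⟩
      A * 1ℚ
        ≡⟨ solve 2 (λ A v → A :* con 1ℚ := A :+ v :- v) refl A (w a) ⟩
      A + w a - w a
        ≡⟨ cong (_- w a) (z≡w+ a) ⟨
      z a - w a ∎

  tail : ∑ (map (λ (b , bs) → b , a ∷ bs) (enlargements as)) (λ (b , bs) → weight b * (1/hooks bs * φ (z b)))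
       ≡ p * (k * residues as φ′)
  tail = begin
    ∑ (map (λ (b , bs) → b , a ∷ bs) (enlargements as)) (λ (b , bs) → weight b * (1/hooks bs * φ (z b)))
      ≡⟨ ∑-map _ (enlargements as) (λ (b , bs) → weight b * (1/hooks bs * φ (z b))) ⟩
    ∑ (enlargements as) (λ (b , bs) → weight b * (1/hooks (a ∷ bs) * φ (z b)))
      ≡⟨ ∑-cong (enlargements as) (λ {(b , bs)} b∈ → trans
           (cong (λ q → weight b * (1/hooks bs * (inv (fromℕ (a ℕ.!)) * q) * φ (z b))) (pairFactors-enlarge as 0<a as<a b∈))
           (solve 6 (λ u h i q y x → u :* (h :* (i :* (q :* y)) :* x) := i :* q :* (u :* (h :* (x :* y)))) refl
             (weight b) (1/hooks bs) (inv (fromℕ (a ℕ.!))) (∏ as (pairFactor a)) _ (φ (z b)))) ⟩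
    ∑ (enlargements as) (λ (b , bs) → p * (weight b * (1/hooks bs * φ′ (z b))))
      ≡⟨ ∑-*ˡ (enlargements as) p (λ (b , bs) → weight b * (1/hooks bs * φ′ (z b))) ⟩
    p * ∑ (enlargements as) (λ (b , bs) → weight b * (1/hooks bs * φ′ (z b)))
      ≡⟨ cong (p *_) (∑-enlargements as dec 0<as φ′) ⟩
    p * (k * residues as φ′) ∎

-- Functions of bounded weight

-- The value of Σ c(α) x^α, the exponents in α being at most n.
expand : ℕ → (List ℕ → ℚ) → List ℕ → ℚ
expand n c []       = c []
expand n c (x ∷ xs) = ∑ (upTo (suc n)) (λ j → fromℕ (x ^ j) * expand n (c ∘ (j ∷_)) xs)

expand-cong : ∀ n {c c′} xs → (∀ α → c α ≡ c′ α) → expand n c xs ≡ expand n c′ xs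
expand-cong n []       e = e []
expand-cong n (x ∷ xs) e = ∑-cong′ (upTo (suc n)) (λ j → cong (fromℕ (x ^ j) *_) (expand-cong n xs (e ∘ (j ∷_))))

expand-0 : ∀ n {c} xs → (∀ α → c α ≡ 0ℚ) → expand n c xs ≡ 0ℚ
expand-0 n []       e = e []
expand-0 n (x ∷ xs) e = trans (∑-cong′ (upTo (suc n)) (λ j →
  trans (cong (fromℕ (x ^ j) *_) (expand-0 n xs (e ∘ (j ∷_)))) (ℚ.*-zeroʳ (fromℕ (x ^ j))))) (∑-0 (upTo (suc n)))

-- A new box ends its row, so its value appears in the middle of the list; symmetry of the
-- coefficients moves its exponent to the front.
expand-insert : ∀ n {c} us v vs → (∀ {α β} → α ↭ β → c α ≡ c β) →
  expand n c (us ++ v ∷ vs) ≡ ∑ (upTo (suc n)) (λ j → fromℕ (v ^ j) * expand n (c ∘ (j ∷_)) (us ++ vs))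
expand-insert n         []       v vs c-sym = refl
expand-insert n {c} (u ∷ us) v vs c-sym = begin
  ∑ js (λ i → fromℕ (u ^ i) * expand n (c ∘ (i ∷_)) (us ++ v ∷ vs))
    ≡⟨ ∑-cong′ js (λ i → trans (cong (fromℕ (u ^ i) *_) (expand-insert n us v vs (c-sym ∘ prep i)))
         (sym (∑-*ˡ js (fromℕ (u ^ i)) (inner i)))) ⟩
  ∑ js (λ i → ∑ js (λ j → fromℕ (u ^ i) * inner i j))
    ≡⟨ ∑-swap js js (λ i j → fromℕ (u ^ i) * inner i j) ⟩
  ∑ js (λ j → ∑ js (λ i → fromℕ (u ^ i) * inner i j))
    ≡⟨ ∑-cong′ js (λ j → trans (∑-cong′ js (λ i → trans
         (cong (λ x → fromℕ (u ^ i) * (fromℕ (v ^ j) * x)) (expand-cong n (us ++ vs) (λ α → c-sym (swap i j ↭-refl))))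
         (exchange (fromℕ (u ^ i)) (fromℕ (v ^ j)) _)))
         (∑-*ˡ js (fromℕ (v ^ j)) (λ i → fromℕ (u ^ i) * expand n (c ∘ (j ∷_) ∘ (i ∷_)) (us ++ vs)))) ⟩
  ∑ js (λ j → fromℕ (v ^ j) * ∑ js (λ i → fromℕ (u ^ i) * expand n (c ∘ (j ∷_) ∘ (i ∷_)) (us ++ vs))) ∎
  where
  js = upTo (suc n)
  inner : ℕ → ℕ → ℚ
  inner i j = fromℕ (v ^ j) * expand n (c ∘ (i ∷_) ∘ (j ∷_)) (us ++ vs)
  exchange : ∀ x y t → x * (y * t) ≡ y * (x * t)
  exchange = solve 3 (λ x y t → x :* (y :* t) := y :* (x :* t)) refl

∑-words : ∀ (as : List ℕ) k (g : List ℕ → ℚ) →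
  ∑ (words as (suc k)) g ≡ ∑ as (λ a → ∑ (words as k) (g ∘ (a ∷_)))
∑-words as k g = go as
  where
  go : ∀ bs → ∑ (cartesianProductWith _∷_ bs (words as k)) g ≡ ∑ bs (λ a → ∑ (words as k) (g ∘ (a ∷_)))
  go []       = refl
  go (b ∷ bs) = trans (∑-++ (map (b ∷_) (words as k)) _ g) (cong₂ _+_ (∑-map (b ∷_) (words as k) g) (go bs))

evaluate≡expand : ∀ Q xs → evaluate Q xs ≡ expand (SymmetricFunction.degree Q) (SymmetricFunction.coeff Q) xs
evaluate≡expand Q xs = go (SymmetricFunction.coeff Q) xs
  where
  n = SymmetricFunction.degree Q
  js = upTo (suc n)
  go : ∀ c xs → ∑ (words js (length xs)) (λ α → c α * fromℕ (product (zipWith _^_ xs α))) ≡ expand n c xs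
  go c []       = trans (ℚ.+-identityʳ _) (ℚ.*-identityʳ (c []))
  go c (x ∷ xs) = trans (∑-words js (length xs) (λ α → c α * fromℕ (product (zipWith _^_ (x ∷ xs) α)))) (∑-cong′ js (λ j → begin
    ∑ (words js (length xs)) (λ α → c (j ∷ α) * fromℕ (x ^ j ℕ.* product (zipWith _^_ xs α)))
      ≡⟨ ∑-cong′ (words js (length xs)) (λ α → trans (cong (c (j ∷ α) *_) (fromℕ-* (x ^ j) (product (zipWith _^_ xs α))))
           (exchange (c (j ∷ α)) (fromℕ (x ^ j)) _)) ⟩
    ∑ (words js (length xs)) (λ α → fromℕ (x ^ j) * (c (j ∷ α) * fromℕ (product (zipWith _^_ xs α))))
      ≡⟨ trans (∑-*ˡ (words js (length xs)) (fromℕ (x ^ j)) (λ α → c (j ∷ α) * fromℕ (product (zipWith _^_ xs α)))) (cong (fromℕ (x ^ j) *_) (go (c ∘ (j ∷_)) xs)) ⟩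
    fromℕ (x ^ j) * expand n (c ∘ (j ∷_)) xs ∎))
    where
    exchange : ∀ x y t → x * (y * t) ≡ y * (x * t)
    exchange = solve 3 (λ x y t → x :* (y :* t) := y :* (x :* t)) refl

contentValues : List ℕ → List ℕ
contentValues as = map (_C 2) (concatMap range as)

Good : List ℕ → Set
Good as = Decreasing as × All (0 <_) as

-- The index is an upper bound for the weight. In `contents`, `n` bounds the single exponents and
-- stays fixed while the degree `d` drops. `ext` compares on good lists because the moments are
-- polynomials in the power differences where the poles are distinct.
data Weighted : ℕ → (List ℕ → ℚ) → Set where
  const    : ∀ c → Weighted 0 (λ _ → c)
  powers   : ∀ k → Weighted k (λ as → powerDifference as k)
  contents : ∀ n d c → (∀ {α β} → α ↭ β → c α ≡ c β) → (∀ α → c (0 ∷ α) ≡ c α) → (∀ α → d < sum α → c α ≡ 0ℚ) →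
    Weighted (d ℕ.+ d) (λ as → expand n c (contentValues as))
  _⊕_      : ∀ {d F G} → Weighted d F → Weighted d G → Weighted d (λ as → F as + G as)
  _⊗_      : ∀ {d e F G} → Weighted d F → Weighted e G → Weighted (d ℕ.+ e) (λ as → F as * G as)
  weaken   : ∀ {d e F} → d ≤ e → Weighted d F → Weighted e F
  ext      : ∀ {d F G} → (∀ as → Good as → F as ≡ G as) → Weighted d F → Weighted d G

-- A polynomial in t, where t counts as weight 1.
data Below (d : ℕ) : (List ℕ → ℚ → ℚ) → Set where
  none  : Below d (λ _ _ → 0ℚ)
  term  : ∀ {e F} j → e ℕ.+ j < d → Weighted e F → Below d (λ as t → F as * t ^ℚ j)
  _⊕_   : ∀ {Φ Ψ} → Below d Φ → Below d Ψ → Below d (λ as t → Φ as t + Ψ as t)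
  ext   : ∀ {Φ Ψ} → (∀ as t → Φ as t ≡ Ψ as t) → Below d Φ → Below d Ψ

^ℚ-+ : ∀ t i j → t ^ℚ (i ℕ.+ j) ≡ t ^ℚ i * t ^ℚ j
^ℚ-+ t zero    j = sym (ℚ.*-identityˡ _)
^ℚ-+ t (suc i) j = trans (cong (t *_) (^ℚ-+ t i j)) (sym (ℚ.*-assoc t (t ^ℚ i) (t ^ℚ j)))

below-weaken : ∀ {d e Φ} → d ≤ e → Below d Φ → Below e Φ
below-weaken d≤e none            = none
below-weaken d≤e (term j lt wF)  = term j (ℕ.≤-trans lt d≤e) wF
below-weaken d≤e (p ⊕ q)         = below-weaken d≤e p ⊕ below-weaken d≤e q
below-weaken d≤e (ext e p)       = ext e (below-weaken d≤e p)

below-*ˡ : ∀ {d e F Φ} → Weighted e F → Below d Φ → Below (e ℕ.+ d) (λ as t → F as * Φ as t)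
below-*ˡ {F = F} wF none = ext (λ as t → sym (ℚ.*-zeroʳ (F as))) none
below-*ˡ {d} {e} {F} wF (term {e′} {G} j lt wG) = ext (λ as t → ℚ.*-assoc (F as) (G as) (t ^ℚ j))
  (term j (subst (_< e ℕ.+ d) (sym (ℕ.+-assoc e e′ j)) (ℕ.+-monoʳ-< e lt)) (wF ⊗ wG))
below-*ˡ {F = F} wF (_⊕_ {Φ} {Ψ} p q) = ext (λ as t → sym (ℚ.*-distribˡ-+ (F as) (Φ as t) (Ψ as t))) (below-*ˡ wF p ⊕ below-*ˡ wF q)
below-*ˡ {F = F} wF (ext e p) = ext (λ as t → cong (F as *_) (e as t)) (below-*ˡ wF p)

below-^ : ∀ {d Φ} j → Below d Φ → Below (j ℕ.+ d) (λ as t → t ^ℚ j * Φ as t)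
below-^ j none = ext (λ as t → sym (ℚ.*-zeroʳ (t ^ℚ j))) none
below-^ {d} j (term {e} {F} i lt wF) = ext
  (λ as t → trans (cong (F as *_) (^ℚ-+ t j i)) (solve 3 (λ f x y → f :* (x :* y) := x :* (f :* y)) refl (F as) (t ^ℚ j) (t ^ℚ i)))
  (term (j ℕ.+ i) (subst (_< j ℕ.+ d) (trans (sym (ℕ.+-assoc j e i)) (trans (cong (ℕ._+ i) (ℕ.+-comm j e)) (ℕ.+-assoc e j i)))
    (ℕ.+-monoʳ-< j lt)) wF)
below-^ j (_⊕_ {Φ} {Ψ} p q) = ext (λ as t → sym (ℚ.*-distribˡ-+ (t ^ℚ j) (Φ as t) (Ψ as t))) (below-^ j p ⊕ below-^ j q)
below-^ j (ext e p) = ext (λ as t → cong (t ^ℚ j *_) (e as t)) (below-^ j p)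

below-* : ∀ {d e Φ Ψ} → Below d Φ → Below e Ψ → Below (d ℕ.+ e) (λ as t → Φ as t * Ψ as t)
below-* {Ψ = Ψ} none b = ext (λ as t → sym (ℚ.*-zeroˡ (Ψ as t))) none
below-* {d} {e} {Ψ = Ψ} (term {e′} {F} j lt wF) b = ext (λ as t → sym (ℚ.*-assoc (F as) (t ^ℚ j) (Ψ as t)))
  -- The bound on `Ψ` is strict already, so the one on this term may be relaxed.
  (below-weaken (ℕ.≤-trans (ℕ.≤-reflexive (sym (ℕ.+-assoc e′ j e))) (ℕ.+-monoˡ-≤ e (ℕ.<⇒≤ lt))) (below-*ˡ wF (below-^ j b)))
below-* {Ψ = Χ} (_⊕_ {Φ} {Ψ} p q) b = ext (λ as t → sym (ℚ.*-distribʳ-+ (Χ as t) (Φ as t) (Ψ as t))) (below-* p b ⊕ below-* q b)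
below-* {Ψ = Ψ} (ext e p) b = ext (λ as t → cong (_* Ψ as t) (e as t)) (below-* p b)

below-∑ : ∀ {d} (js : List ℕ) (Φ : ℕ → List ℕ → ℚ → ℚ) → (∀ {j} → j ∈ js → Below d (Φ j)) → Below d (λ as t → ∑ js (λ j → Φ j as t))
below-∑ []       Φ b = none
below-∑ (j ∷ js) Φ b = b (here refl) ⊕ below-∑ js Φ (b ∘ there)

-- Change under the addition of a box

-- δ k (z b) = z (b + 1)ᵏ + w bᵏ - 2 (z b)ᵏ, because z (b + 1) and w b have the
-- sum 2 (z b) + 1 and the product (z b)² - z b.
δ : ℕ → ℚ → ℚ
δ 0             t = 0ℚ
δ 1             t = 1ℚ
-- The powers of z (b + 1) and w b satisfy the homogeneous recurrence with this sum and product; the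
-- last term is the amount by which 2 tᵏ violates it.
δ (suc (suc k)) t = (fromℕ 2 * t + 1ℚ) * δ (suc k) t + (t - t * t) * δ k t + fromℕ 4 * t ^ℚ suc k

below-δ : ∀ k → Below k (λ _ → δ k)
below-δ 0             = none
below-δ 1             = ext (λ as t → ℚ.*-identityˡ 1ℚ) (term 0 (s≤s z≤n) (const 1ℚ))
below-δ (suc (suc k)) = ext
  (λ as t → solve 5 (λ t x y p o → con (fromℕ 2) :* (t :* con 1ℚ :* x) :+ o :* x :+ (con (- 1ℚ) :* (t :* (t :* con 1ℚ) :* y) :+ t :* con 1ℚ :* y) :+ con (fromℕ 4) :* p
     := (con (fromℕ 2) :* t :+ o) :* x :+ (t :- t :* t) :* y :+ con (fromℕ 4) :* p) refl t (δ (suc k) t) (δ k t) (t ^ℚ suc k) 1ℚ)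
  (((below-*ˡ (const (fromℕ 2)) (below-^ 1 (below-δ (suc k))) ⊕ below-weaken (ℕ.n≤1+n (suc k)) (below-*ˡ (const 1ℚ) (below-δ (suc k))))
    ⊕ (below-*ˡ (const (- 1ℚ)) (below-^ 2 (below-δ k)) ⊕ below-weaken (ℕ.n≤1+n (suc k)) (below-^ 1 (below-δ k))))
    ⊕ term (suc k) (ℕ.≤-refl) (const (fromℕ 4)))

z-suc : ∀ b → z (suc b) ≡ 1ℚ + fromℕ b + z b
z-suc b = trans (z≡w+ (suc b)) (cong₂ _+_ (fromℕ-suc b) (w-suc b))

δ-z : ∀ k b → δ k (z b) ≡ z (suc b) ^ℚ k + w b ^ℚ k - fromℕ 2 * z b ^ℚ k
δ-z 0             b = refl
δ-z 1             b = sym (begin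
  z (suc b) * 1ℚ + w b * 1ℚ - fromℕ 2 * (z b * 1ℚ)
    ≡⟨ cong (λ x → x * 1ℚ + w b * 1ℚ - fromℕ 2 * (z b * 1ℚ)) (z-suc b) ⟩
  (1ℚ + fromℕ b + z b) * 1ℚ + w b * 1ℚ - fromℕ 2 * (z b * 1ℚ)
    ≡⟨ cong (λ x → (1ℚ + fromℕ b + x) * 1ℚ + w b * 1ℚ - fromℕ 2 * (x * 1ℚ)) (z≡w+ b) ⟩
  (1ℚ + fromℕ b + (fromℕ b + w b)) * 1ℚ + w b * 1ℚ - fromℕ 2 * ((fromℕ b + w b) * 1ℚ)
    ≡⟨ solve 2 (λ B w → (con 1ℚ :+ B :+ (B :+ w)) :* con 1ℚ :+ w :* con 1ℚ :- con (fromℕ 2) :* ((B :+ w) :* con 1ℚ) := con 1ℚ) refl (fromℕ b) (w b) ⟩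
  1ℚ ∎)
δ-z (suc (suc k)) b = begin
  (fromℕ 2 * t + 1ℚ) * δ (suc k) t + (t - t * t) * δ k t + fromℕ 4 * t ^ℚ suc k
    ≡⟨ cong₂ (λ x y → (fromℕ 2 * t + 1ℚ) * x + (t - t * t) * y + fromℕ 4 * t ^ℚ suc k) (δ-z (suc k) b) (δ-z k b) ⟩
  (fromℕ 2 * t + 1ℚ) * (u * x + v * y - fromℕ 2 * (t * p)) + (t - t * t) * (x + y - fromℕ 2 * p) + fromℕ 4 * (t * p)
    ≡⟨ cong₂ (λ s m → s * (u * x + v * y - fromℕ 2 * (t * p)) + m * (x + y - fromℕ 2 * p) + fromℕ 4 * (t * p)) (sym u+v) (sym -uv) ⟩
  (u + v) * (u * x + v * y - fromℕ 2 * (t * p)) + - (u * v) * (x + y - fromℕ 2 * p) + fromℕ 4 * (t * p)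
    ≡⟨ solve 7 (λ u v x y t p c → (u :+ v) :* (u :* x :+ v :* y :- c :* (t :* p)) :+ :- (u :* v) :* (x :+ y :- c :* p) :+ con (fromℕ 4) :* (t :* p)
         := u :* (u :* x) :+ v :* (v :* y) :+ (c :* p :* (u :* v :- t :* (u :+ v)) :+ con (fromℕ 4) :* (t :* p))) refl u v x y t p (fromℕ 2) ⟩
  u * (u * x) + v * (v * y) + (fromℕ 2 * p * (u * v - t * (u + v)) + fromℕ 4 * (t * p))
    ≡⟨ cong₂ (λ s m → u * (u * x) + v * (v * y) + (fromℕ 2 * p * (m - t * s) + fromℕ 4 * (t * p))) u+v uv ⟩
  u * (u * x) + v * (v * y) + (fromℕ 2 * p * (t * t - t - t * (fromℕ 2 * t + 1ℚ)) + fromℕ 4 * (t * p))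
    ≡⟨ cong (u * (u * x) + v * (v * y) +_) (solve 2 (λ t p → con (fromℕ 2) :* p :* (t :* t :- t :- t :* (con (fromℕ 2) :* t :+ con 1ℚ)) :+ con (fromℕ 4) :* (t :* p)
         := :- (con (fromℕ 2) :* (t :* (t :* p)))) refl t p) ⟩
  u * (u * x) + v * (v * y) - fromℕ 2 * (t * (t * p)) ∎
  where
  t = z b
  u = z (suc b)
  v = w b
  x = u ^ℚ k
  y = v ^ℚ k
  p = t ^ℚ k
  B = fromℕ b
  u≡ : u ≡ 1ℚ + B + t
  u≡ = z-suc b
  v≡ : v ≡ t - B
  v≡ = trans (solve 2 (λ v B → v := B :+ v :- B) refl v B) (cong (_- B) (sym (z≡w+ b)))
  u+v : u + v ≡ fromℕ 2 * t + 1ℚ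
  u+v = trans (cong₂ _+_ u≡ v≡) (solve 2 (λ t B → con 1ℚ :+ B :+ t :+ (t :- B) := con (fromℕ 2) :* t :+ con 1ℚ) refl t B)
  uv : u * v ≡ t * t - t
  uv = begin
    u * v ≡⟨ cong₂ _*_ u≡ v≡ ⟩
    (1ℚ + B + t) * (t - B)
      ≡⟨ solve 2 (λ t B → (con 1ℚ :+ B :+ t) :* (t :- B) := t :* t :+ t :- con (fromℕ 2) :* (con ½ :* (B :* B :+ B))) refl t B ⟩
    t * t + t - fromℕ 2 * (½ * (B * B + B)) ≡⟨ cong (λ s → t * t + t - fromℕ 2 * s) (sym (z-formula b)) ⟩
    t * t + t - fromℕ 2 * t ≡⟨ solve 1 (λ t → t :* t :+ t :- con (fromℕ 2) :* t := t :* t :- t) refl t ⟩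
    t * t - t                      ∎
  -uv : - (u * v) ≡ t - t * t
  -uv = trans (cong -_ uv) (solve 1 (λ t → :- (t :* t :- t) := t :- t :* t) refl t)

-- The pole `z b` moves to `z (b + 1)` and the zero `w b` to `w (b + 1) = z b`, hence a second
-- difference. A new row is the part 0, which contributes nothing beforehand since z 0 = w 0.
powerDifference-enlarge : ∀ k as {b bs} → (b , bs) ∈ enlargements as →
  powerDifference bs k ≡ powerDifference as k + δ k (z b)
powerDifference-enlarge k [] (here refl) = begin
  z 1 ^ℚ k - w 1 ^ℚ k + 0ℚ ≡⟨ cong (λ y → z 1 ^ℚ k - y ^ℚ k + 0ℚ) (w-suc 0) ⟩
  z 1 ^ℚ k - z 0 ^ℚ k + 0ℚ ≡⟨ rearrange (z 1 ^ℚ k) (z 0 ^ℚ k) ⟩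
  0ℚ + (z 1 ^ℚ k + z 0 ^ℚ k - fromℕ 2 * z 0 ^ℚ k)
    ≡⟨ cong (λ y → 0ℚ + (z 1 ^ℚ k + y ^ℚ k - fromℕ 2 * z 0 ^ℚ k)) (trans z-0 (sym (w-def 0))) ⟩
  0ℚ + (z 1 ^ℚ k + w 0 ^ℚ k - fromℕ 2 * z 0 ^ℚ k) ≡⟨ cong (0ℚ +_) (δ-z k 0) ⟨
  0ℚ + δ k (z 0)                                    ∎
  where
  rearrange : ∀ x y → x - y + 0ℚ ≡ 0ℚ + (x + y - fromℕ 2 * y)
  rearrange = solve 2 (λ x y → x :- y :+ con 0ℚ := con 0ℚ :+ (x :+ y :- con (fromℕ 2) :* y)) refl
powerDifference-enlarge k (a ∷ as) (here refl) = begin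
  z (suc a) ^ℚ k - w (suc a) ^ℚ k + p ≡⟨ cong (λ y → z (suc a) ^ℚ k - y ^ℚ k + p) (w-suc a) ⟩
  z (suc a) ^ℚ k - z a ^ℚ k + p ≡⟨ rearrange (z (suc a) ^ℚ k) (z a ^ℚ k) (w a ^ℚ k) p ⟩
  z a ^ℚ k - w a ^ℚ k + p + (z (suc a) ^ℚ k + w a ^ℚ k - fromℕ 2 * z a ^ℚ k)
    ≡⟨ cong (z a ^ℚ k - w a ^ℚ k + p +_) (δ-z k a) ⟨
  z a ^ℚ k - w a ^ℚ k + p + δ k (z a)               ∎
  where
  p = powerDifference as k
  rearrange : ∀ x y v s → x - y + s ≡ y - v + s + (x + v - fromℕ 2 * y)
  rearrange = solve 4 (λ x y v s → x :- y :+ s := y :- v :+ s :+ (x :+ v :- con (fromℕ 2) :* y)) refl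
powerDifference-enlarge k (a ∷ as) (there b∈) with (b , bs) , b∈′ , refl ← ∈-map⁻ _ b∈ = trans
  (cong (z a ^ℚ k - w a ^ℚ k +_) (powerDifference-enlarge k as b∈′)) (sym (ℚ.+-assoc (z a ^ℚ k - w a ^ℚ k) (powerDifference as k) _))

contentValues-enlarge : ∀ as {b bs} → (b , bs) ∈ enlargements as →
  ∃[ us ] ∃[ vs ] (contentValues bs ≡ us ++ (suc b C 2) ∷ vs × contentValues as ≡ us ++ vs)
contentValues-enlarge []       (here refl) = [] , [] , refl , refl
contentValues-enlarge (a ∷ as) (here refl) = map (_C 2) (range a) , contentValues as , larger , smaller a as
  where
  smaller : ∀ a as → contentValues (a ∷ as) ≡ map (_C 2) (range a) ++ contentValues as
  smaller a as = List.map-++ (_C 2) (range a) (concatMap range as)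
  larger : contentValues (suc a ∷ as) ≡ map (_C 2) (range a) ++ (suc a C 2) ∷ contentValues as
  larger = begin
    contentValues (suc a ∷ as) ≡⟨ smaller (suc a) as ⟩
    map (_C 2) (map suc (upTo (suc a))) ++ contentValues as ≡⟨ cong (λ l → map (_C 2) (map suc l) ++ contentValues as) (sym (List.upTo-∷ʳ a)) ⟩
    map (_C 2) (map suc (upTo a ++ [ a ])) ++ contentValues as
      ≡⟨ cong (λ l → map (_C 2) l ++ contentValues as) (List.map-++ suc (upTo a) [ a ]) ⟩
    map (_C 2) (range a ++ [ suc a ]) ++ contentValues as ≡⟨ cong (_++ contentValues as) (List.map-++ (_C 2) (range a) [ suc a ]) ⟩
    (map (_C 2) (range a) ++ [ suc a C 2 ]) ++ contentValues as ≡⟨ List.++-assoc (map (_C 2) (range a)) [ suc a C 2 ] (contentValues as) ⟩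
    map (_C 2) (range a) ++ (suc a C 2) ∷ contentValues as    ∎
contentValues-enlarge (a ∷ as) (there b∈) with (b , bs) , b∈′ , refl ← ∈-map⁻ _ b∈
  with us , vs , e , e′ ← contentValues-enlarge as b∈′ = map (_C 2) (range a) ++ us , vs , extend bs e , extend as e′
  where
  extend : ∀ cs {us′ vs′} → contentValues cs ≡ us′ ++ vs′ → contentValues (a ∷ cs) ≡ (map (_C 2) (range a) ++ us′) ++ vs′
  extend cs {us′} {vs′} e = trans (List.map-++ (_C 2) (range a) (concatMap range cs))
    (trans (cong (map (_C 2) (range a) ++_) e) (sym (List.++-assoc (map (_C 2) (range a)) us′ vs′)))

fromℕ-^ : ∀ m k → fromℕ (m ^ k) ≡ fromℕ m ^ℚ k
fromℕ-^ m zero    = refl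
fromℕ-^ m (suc k) = trans (fromℕ-* m (m ^ k)) (cong (fromℕ m *_) (fromℕ-^ m k))

-- A discrete derivative in the direction of the added box, with t = C(c, 2). Products obey the
-- Leibniz rule with an additional product of both increments. Goodness of both lists serves `ext`.
increment : ∀ {d F} → Weighted d F → ∃[ Φ ] (Below d Φ ×
  (∀ {as b bs} → (b , bs) ∈ enlargements as → Good as → Good bs → F bs ≡ F as + Φ as (z b)))
increment (const c) = _ , none , λ _ _ _ → sym (ℚ.+-identityʳ c)
increment (powers k) = _ , below-δ k , λ {as} b∈ _ _ → powerDifference-enlarge k as b∈
increment (contents n d c c-sym c-zero c-bound) = Φ , below-∑ (range n) Ψ below-Ψ , eq
  where
  Ψ : ℕ → List ℕ → ℚ → ℚ
  Ψ j as t = expand n (c ∘ (j ∷_)) (contentValues as) * t ^ℚ j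
  Φ : List ℕ → ℚ → ℚ
  Φ as t = ∑ (range n) (λ j → Ψ j as t)
  below-Ψ : ∀ {j} → j ∈ range n → Below (d ℕ.+ d) (Ψ j)
  below-Ψ {j} j∈ with ℕ.≤-<-connex j d
  ... | inj₁ j≤d with e , refl ← ℕ.m≤n⇒∃[o]m+o≡n j≤d =
    term j lt (contents n e (c ∘ (j ∷_)) (c-sym ∘ prep j) (λ α → trans (c-sym (swap j 0 ↭-refl)) (c-zero (j ∷ α)))
      (λ α e< → c-bound (j ∷ α) (ℕ.+-monoʳ-< j e<)))
    where
    -- The doubled weight pays off: 2e + j < 2 (j + e) because j ≥ 1.
    lt : e ℕ.+ e ℕ.+ j < j ℕ.+ e ℕ.+ (j ℕ.+ e)
    lt = subst (_< j ℕ.+ e ℕ.+ (j ℕ.+ e)) (trans (cong (e ℕ.+_) (ℕ.+-comm j e)) (sym (ℕ.+-assoc e e j)))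
      (ℕ.+-monoˡ-< (j ℕ.+ e) (ℕ.+-monoˡ-≤ e (proj₁ (∈-range⁻ j∈))))
  ... | inj₂ d<j = ext (λ as t → sym (trans (cong (_* t ^ℚ j) (expand-0 n (contentValues as)
      (λ α → c-bound (j ∷ α) (ℕ.<-≤-trans d<j (ℕ.m≤m+n j (sum α)))))) (ℚ.*-zeroˡ (t ^ℚ j)))) none
  eq : ∀ {as b bs} → (b , bs) ∈ enlargements as → Good as → Good bs →
    expand n c (contentValues bs) ≡ expand n c (contentValues as) + Φ as (z b)
  eq {as} {b} {bs} b∈ _ _ with us , vs , e , e′ ← contentValues-enlarge as b∈ = begin
    expand n c (contentValues bs)
      ≡⟨ cong (expand n c) e ⟩
    expand n c (us ++ (suc b C 2) ∷ vs)
      ≡⟨ expand-insert n us (suc b C 2) vs c-sym ⟩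
    -- Exponent 0 of the new variable restores the old value through `c-zero`; the exponents 1, ...,
    -- n make up `Φ`.
    1ℚ * expand n (c ∘ (0 ∷_)) (us ++ vs) + ∑ (applyUpTo suc n) (λ j → fromℕ ((suc b C 2) ^ j) * expand n (c ∘ (j ∷_)) (us ++ vs))
      ≡⟨ cong₂ _+_ (trans (ℚ.*-identityˡ _) (expand-cong n (us ++ vs) c-zero))
           (cong (λ l → ∑ l (λ j → fromℕ ((suc b C 2) ^ j) * expand n (c ∘ (j ∷_)) (us ++ vs))) (sym (List.map-upTo suc n))) ⟩
    expand n c (us ++ vs) + ∑ (range n) (λ j → fromℕ ((suc b C 2) ^ j) * expand n (c ∘ (j ∷_)) (us ++ vs))
      ≡⟨ cong (expand n c (us ++ vs) +_) (∑-cong′ (range n) (λ j →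
           trans (ℚ.*-comm (fromℕ ((suc b C 2) ^ j)) _) (cong (expand n (c ∘ (j ∷_)) (us ++ vs) *_) (trans (fromℕ-^ (suc b C 2) j) (cong (_^ℚ j) (sym (z-def b))))))) ⟩
    expand n c (us ++ vs) + ∑ (range n) (λ j → expand n (c ∘ (j ∷_)) (us ++ vs) * z b ^ℚ j)
      ≡⟨ cong (λ l → expand n c l + ∑ (range n) (λ j → expand n (c ∘ (j ∷_)) l * z b ^ℚ j)) (sym e′) ⟩
    expand n c (contentValues as) + Φ as (z b) ∎
increment (_⊕_ {F = F} {G} wF wG) with Φ , pΦ , eΦ ← increment wF | Ψ , pΨ , eΨ ← increment wG =
  _ , pΦ ⊕ pΨ , λ {as} {b} b∈ good good′ → trans (cong₂ _+_ (eΦ b∈ good good′) (eΨ b∈ good good′))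
    (solve 4 (λ f g x y → f :+ x :+ (g :+ y) := f :+ g :+ (x :+ y)) refl (F as) (G as) (Φ as (z b)) (Ψ as (z b)))
increment (_⊗_ {d} {e} {F} {G} wF wG) with Φ , pΦ , eΦ ← increment wF | Ψ , pΨ , eΨ ← increment wG =
  _ , (below-*ˡ wF pΨ ⊕ below-weaken (ℕ.≤-reflexive (ℕ.+-comm e d)) (below-*ˡ wG pΦ)) ⊕ below-* pΦ pΨ ,
  λ {as} {b} b∈ good good′ → trans (cong₂ _*_ (eΦ b∈ good good′) (eΨ b∈ good good′))
    (solve 4 (λ f g x y → (f :+ x) :* (g :+ y) := f :* g :+ (f :* y :+ g :* x :+ x :* y)) refl (F as) (G as) (Φ as (z b)) (Ψ as (z b)))
increment (weaken d≤e wF) with Φ , pΦ , eΦ ← increment wF = Φ , below-weaken d≤e pΦ , eΦ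
increment (ext e wF) with Φ , pΦ , eΦ ← increment wF =
  Φ , pΦ , λ {as} {b} {bs} b∈ good good′ → trans (sym (e bs good′)) (trans (eΦ b∈ good good′) (cong (_+ Φ as (z b)) (e as good)))

-- The offset `e` counts the leading power differences that the recursion of `conv` has already
-- passed.
conv-weighted : ∀ k e (p : ℕ → List ℕ → ℚ) (M : List ℕ → ℕ → ℚ) → (∀ i → Weighted (e ℕ.+ suc i) (p i)) →
  (∀ {j} → j < k → Weighted j (λ as → M as j)) → Weighted (e ℕ.+ k) (λ as → conv (λ i → p i as) (M as) k)
conv-weighted zero    e p M wp wM = weaken z≤n (const 0ℚ)
conv-weighted (suc k) e p M wp wM =
  weaken (ℕ.≤-reflexive (ℕ.+-assoc e 1 k)) (wp 0 ⊗ wM ℕ.≤-refl)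
  ⊕ weaken (ℕ.≤-reflexive (sym (ℕ.+-suc e k))) (conv-weighted k (suc e) (p ∘ suc) M
      (λ i → weaken (ℕ.≤-reflexive (ℕ.+-suc e (suc i))) (wp (suc i))) (λ j<k → wM (ℕ.m<n⇒m<1+n j<k)))

-- Newton's identity divided by `k` expresses a moment through earlier ones; the bound `n` in
-- `upTo-k` makes the induction strong.
moment-weighted : ∀ k → Weighted k (λ as → moment as k)
moment-weighted k = upTo-k k ℕ.≤-refl
  where
  upTo-k : ∀ n {k} → k ≤ n → Weighted k (λ as → moment as k)
  upTo-k n {zero} _ = ext (λ as (dec , pos) → sym (residues-1 as (decreasing⇒Distinct dec pos))) (const 1ℚ)
  upTo-k (suc n) {suc k} (s≤s k≤n) = ext eq (const (inv N) ⊗ conv-weighted (suc k) 0 (λ i as → powerDifference as (suc i)) moment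
    (λ i → powers (suc i)) (λ j<1+k → upTo-k n (ℕ.≤-trans (ℕ.s≤s⁻¹ j<1+k) k≤n)))
    where
    N = fromℕ (suc k)
    eq : ∀ as → Good as → inv N * conv (powerDifference as ∘ suc) (moment as) (suc k) ≡ moment as (suc k)
    eq as (dec , pos) = begin
      inv N * conv (powerDifference as ∘ suc) (moment as) (suc k)
        ≡⟨ cong (inv N *_) (newton as (decreasing⇒Distinct dec pos) (suc k)) ⟨
      inv N * (N * moment as (suc k))
        ≡⟨ solve 3 (λ i n m → i :* (n :* m) := n :* i :* m) refl (inv N) N (moment as (suc k)) ⟩
      N * inv N * moment as (suc k)
        ≡⟨ cong (_* moment as (suc k)) (inv-inverse (fromℕ-≢0 {suc k} (s≤s z≤n))) ⟩
      1ℚ * moment as (suc k)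
        ≡⟨ ℚ.*-identityˡ _ ⟩
      moment as (suc k) ∎

-- Taking residues replaces tʲ by the j-th moment, again of weight j, so the strict bound on `Φ`
-- becomes the bound `d`.
residues-weighted : ∀ {d Φ} → Below (suc d) Φ → Weighted d (λ as → residues as (Φ as))
residues-weighted none = ext (λ as _ → sym (trans (residues-cong′ as (λ _ → sym (ℚ.*-zeroˡ 0ℚ)))
  (trans (residues-* as 0ℚ (λ _ → 0ℚ)) (ℚ.*-zeroˡ (residues as (λ _ → 0ℚ)))))) (weaken z≤n (const 0ℚ))
residues-weighted (term {F = F} j lt wF) = ext (λ as _ → sym (residues-* as (F as) (_^ℚ j)))
  (weaken (ℕ.s≤s⁻¹ lt) (wF ⊗ moment-weighted j))
residues-weighted (_⊕_ {Φ} {Ψ} p p′) = ext (λ as _ → sym (residues-+ as (Φ as) (Ψ as))) (residues-weighted p ⊕ residues-weighted p′)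
residues-weighted (ext e p) = ext (λ as _ → residues-cong′ as (e as)) (residues-weighted p)

-- The operator D on functions of bounded weight

below-0 : ∀ {Φ} → Below 0 Φ → ∀ as t → Φ as t ≡ 0ℚ
below-0 none      as t = refl
below-0 (p ⊕ p′)  as t = cong₂ _+_ (below-0 p as t) (below-0 p′ as t)
below-0 (ext e p) as t = trans (sym (e as t)) (below-0 p as t)

head≤ : ∀ {a as b c cs} → All (a >_) as → 0 < a → (b , c ∷ cs) ∈ enlargements as → c ≤ a
head≤ {as = []}    _         0<a (here refl) = 0<a
head≤ {as = _ ∷ _} (x<a ∷ _) _   (here refl) = x<a
head≤ {as = _ ∷ _} (x<a ∷ _) _   (there b∈) with _ , _ , refl ← ∈-map⁻ _ b∈ = ℕ.<⇒≤ x<a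

-- If the new head of `bs` has caught up with `a`, the pair factor of two equal parts is 0.
∷-good : ∀ {a bs} → 0 < a → Good bs → (∀ {c cs} → bs ≡ c ∷ cs → c ≤ a) → Good (a ∷ bs) ⊎ 1/hooks (a ∷ bs) ≡ 0ℚ
∷-good {a} {[]}     0<a _ _ = inj₁ (([] ∷ []) , (0<a ∷ []))
∷-good {a} {c ∷ cs} 0<a (cs<c ∷ dec , pos) head≤a with ℕ.m≤n⇒m<n∨m≡n (head≤a refl)
... | inj₁ c<a  = inj₁ (((c<a ∷ All.map (λ x<c → ℕ.<-trans x<c c<a) cs<c) ∷ cs<c ∷ dec) , (0<a ∷ pos))
... | inj₂ refl = inj₂ (trans (cong (λ x → k * (i * (x * inv (fromℕ a + fromℕ a) * p))) (ℚ.+-inverseʳ (fromℕ a)))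
  (solve 4 (λ k i j p → k :* (i :* (con 0ℚ :* j :* p)) := con 0ℚ) refl k i (inv (fromℕ a + fromℕ a)) p))
  where
  k = 1/hooks (a ∷ cs)
  i = inv (fromℕ (a ℕ.!))
  p = ∏ cs (pairFactor a)

enlargement-good : ∀ {as b bs} → Good as → (b , bs) ∈ enlargements as → Good bs ⊎ 1/hooks bs ≡ 0ℚ
enlargement-good {[]}     _ (here refl) = inj₁ (([] ∷ []) , (s≤s z≤n ∷ []))
enlargement-good {a ∷ as} (as<a ∷ dec , 0<a ∷ 0<as) (here refl) =
  inj₁ ((All.map ℕ.m<n⇒m<1+n as<a ∷ dec) , (s≤s z≤n ∷ 0<as))
enlargement-good {a ∷ as} (as<a ∷ dec , 0<a ∷ 0<as) (there b∈) with (b , bs) , b∈′ , refl ← ∈-map⁻ _ b∈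
  with enlargement-good (dec , 0<as) b∈′
... | inj₁ good = ∷-good 0<a good (λ { refl → head≤ as<a 0<a b∈′ })
... | inj₂ e    = inj₂ (trans (cong (_* p) e) (ℚ.*-zeroˡ p))
  where p = inv (fromℕ (a ℕ.!)) * ∏ bs (pairFactor a)

difference : (List ℕ → ℚ) → List ℕ → ℚ
difference F as = ∑ (enlargements as) (λ (b , bs) → weight b * (1/hooks bs * F bs)) - 1/hooks as * F as

-- The old value `F as` does not depend on the pole, so by `residues-1` its residue sum cancels the
-- subtracted term and only the increment remains.
difference-weighted : ∀ {d F} → Weighted d F → ∃[ Φ ] (Below d Φ ×
  (∀ as → Good as → difference F as ≡ 1/hooks as * residues as (Φ as)))
difference-weighted {F = F} wF with Φ , pΦ , eΦ ← increment wF = Φ , pΦ , eq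
  where
  eq : ∀ as → Good as → difference F as ≡ 1/hooks as * residues as (Φ as)
  eq as good@(dec , pos) = begin
    ∑ (enlargements as) (λ (b , bs) → weight b * (1/hooks bs * F bs)) - h * F as
      ≡⟨ cong (_- h * F as) (∑-cong (enlargements as) (λ {(b , bs)} b∈ → cong (weight b *_) (enlarged b∈ (enlargement-good good b∈)))) ⟩
    ∑ (enlargements as) (λ (b , bs) → weight b * (1/hooks bs * (F as + Φ as (z b)))) - h * F as
      ≡⟨ cong (_- h * F as) (∑-enlargements as dec pos (λ t → F as + Φ as t)) ⟩
    h * residues as (λ t → F as + Φ as t) - h * F as
      ≡⟨ cong (λ x → h * x - h * F as) (trans (residues-+ as (λ _ → F as) (Φ as)) (cong (_+ residues as (Φ as)) constant)) ⟩
    h * (F as + residues as (Φ as)) - h * F as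
      ≡⟨ solve 3 (λ h f r → h :* (f :+ r) :- h :* f := h :* r) refl h (F as) (residues as (Φ as)) ⟩
    h * residues as (Φ as) ∎
    where
    h = 1/hooks as
    constant : residues as (λ _ → F as) ≡ F as
    constant = begin
      residues as (λ _ → F as) ≡⟨ residues-cong′ as (λ _ → sym (ℚ.*-identityʳ (F as))) ⟩
      residues as (λ _ → F as * 1ℚ) ≡⟨ residues-* as (F as) (λ _ → 1ℚ) ⟩
      F as * residues as (λ _ → 1ℚ) ≡⟨ cong (F as *_) (residues-1 as (decreasing⇒Distinct dec pos)) ⟩
      F as * 1ℚ ≡⟨ ℚ.*-identityʳ (F as) ⟩
      F as                            ∎
    enlarged : ∀ {b bs} → (b , bs) ∈ enlargements as → Good bs ⊎ 1/hooks bs ≡ 0ℚ →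
      1/hooks bs * F bs ≡ 1/hooks bs * (F as + Φ as (z b))
    enlarged {b} {bs} b∈ (inj₁ good′) = cong (1/hooks bs *_) (eΦ b∈ good good′)
    enlarged {b} {bs} b∈ (inj₂ e)     = trans (cong (_* F bs) e) (trans (trans (ℚ.*-zeroˡ (F bs)) (sym (ℚ.*-zeroˡ (F as + Φ as (z b)))))
      (cong (_* (F as + Φ as (z b))) (sym e)))

-- Strict partitions with one box more

good-parts : ∀ ρ → Good (parts ρ)
good-parts (mkStrict as s) = decreasing-parts (mkStrict as s) , proj₂ (recompute (isStrict? as) s)

good⇒strict : ∀ {as} → Good as → IsStrict as
good⇒strict (dec , pos) = Decreasing⇒Linked dec , pos

parts-injective : ∀ {ρ κ} → parts ρ ≡ parts κ → ρ ≡ κ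
parts-injective refl = refl

toStrict-parts : ∀ ρ → toStrict (parts ρ) ≡ just ρ
toStrict-parts (mkStrict as s) with isStrict? as
... | yes _ = refl
... | no ¬s = contradiction (recompute (isStrict? as) s) ¬s

parts-toStrict : ∀ as {ρ} → toStrict as ≡ just ρ → parts ρ ≡ as
parts-toStrict as e with isStrict? as
parts-toStrict as refl | yes _ = refl

toStrict-nothing : ∀ as → ¬ IsStrict as → toStrict as ≡ nothing
toStrict-nothing as ¬s with isStrict? as
... | yes s = contradiction s ¬s
... | no _  = refl

∈-toStrict⁻ : ∀ ass {ρ} → ρ ∈ mapMaybe toStrict ass → parts ρ ∈ ass
∈-toStrict⁻ (as ∷ ass) ρ∈ with toStrict as in e
∈-toStrict⁻ (as ∷ ass) (here refl) | just κ = here (parts-toStrict as e)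
∈-toStrict⁻ (as ∷ ass) (there ρ∈) | just κ  = there (∈-toStrict⁻ ass ρ∈)
... | nothing = there (∈-toStrict⁻ ass ρ∈)

∈-toStrict⁺ : ∀ {ass} ρ → parts ρ ∈ ass → ρ ∈ mapMaybe toStrict ass
∈-toStrict⁺ ρ (here refl) rewrite toStrict-parts ρ = here refl
∈-toStrict⁺ {as ∷ _} ρ (there ρ∈) with toStrict as
... | just _  = there (∈-toStrict⁺ ρ ρ∈)
... | nothing = ∈-toStrict⁺ ρ ρ∈

unique-toStrict : ∀ {ass} → Unique ass → Unique (mapMaybe toStrict ass)
unique-toStrict []                 = []
unique-toStrict {as ∷ ass} (as∉ ∷ u) with toStrict as in e
... | nothing = unique-toStrict u
... | just κ  = All.tabulate (λ {ρ} ρ∈ κ≡ρ → All.lookup as∉ (∈-toStrict⁻ ass ρ∈)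
    (trans (sym (parts-toStrict as e)) (cong parts κ≡ρ))) ∷ unique-toStrict u

∑-toStrict : ∀ ass (g : List ℕ → ℚ) → (∀ {as} → as ∈ ass → ¬ IsStrict as → g as ≡ 0ℚ) →
  ∑ (mapMaybe toStrict ass) (g ∘ parts) ≡ ∑ ass g
∑-toStrict []         g g≡0 = refl
∑-toStrict (as ∷ ass) g g≡0 = by (isStrict? as)
  where
  rest = ∑-toStrict ass g (g≡0 ∘ there)
  by : Dec (IsStrict as) → ∑ (mapMaybe toStrict (as ∷ ass)) (g ∘ parts) ≡ g as + ∑ ass g
  by (yes s) rewrite toStrict-parts (mkStrict as s) = cong (g as +_) rest
  by (no ¬s) rewrite toStrict-nothing as ¬s = trans rest (trans (sym (ℚ.+-identityˡ _)) (cong (_+ ∑ ass g) (sym (g≡0 (here refl) ¬s))))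

∈-decreasing⁻ : ∀ m {as} → as ∈ decreasing m → All (_≤ m) as
∈-decreasing⁻ zero    (here refl) = []
∈-decreasing⁻ (suc m) as∈ with ∈-++⁻ (map (suc m ∷_) (decreasing m)) as∈
... | inj₁ as∈₁ with _ , bs∈ , refl ← ∈-map⁻ (suc m ∷_) as∈₁ = ℕ.≤-refl ∷ All.map ℕ.m≤n⇒m≤1+n (∈-decreasing⁻ m bs∈)
... | inj₂ as∈₂ = All.map ℕ.m≤n⇒m≤1+n (∈-decreasing⁻ m as∈₂)

∈-decreasing⁺ : ∀ m {as} → Good as → All (_≤ m) as → as ∈ decreasing m
∈-decreasing⁺ zero    {[]}     _ _ = here refl
∈-decreasing⁺ zero    {a ∷ as} (_ , 0<a ∷ _) (a≤0 ∷ _) = contradiction (ℕ.<-≤-trans 0<a a≤0) λ ()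
∈-decreasing⁺ (suc m) {[]}     good _ = ∈-++⁺ʳ (map (suc m ∷_) (decreasing m)) (∈-decreasing⁺ m good [])
∈-decreasing⁺ (suc m) {a ∷ as} good@(as<a ∷ dec , _ ∷ pos) (a≤1+m ∷ as≤) with ℕ.m≤n⇒m<n∨m≡n a≤1+m
... | inj₁ a<1+m = ∈-++⁺ʳ (map (suc m ∷_) (decreasing m))
  (∈-decreasing⁺ m good (ℕ.s≤s⁻¹ a<1+m ∷ All.map (λ x<a → ℕ.s≤s⁻¹ (ℕ.<-trans x<a a<1+m)) as<a))
... | inj₂ refl  = ∈-++⁺ˡ (∈-map⁺ (suc m ∷_) (∈-decreasing⁺ m (dec , pos) (All.map ℕ.s≤s⁻¹ as<a)))

unique-decreasing : ∀ m → Unique (decreasing m)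
unique-decreasing zero    = [] ∷ []
unique-decreasing (suc m) = Unique.++⁺ (Unique.map⁺ List.∷-injectiveʳ (unique-decreasing m)) (unique-decreasing m)
  (λ (as∈₁ , as∈₂) → case ∈-map⁻ (suc m ∷_) as∈₁ of λ { (_ , _ , refl) → ℕ.1+n≰n (All.head (∈-decreasing⁻ m as∈₂)) })

≤-sum : ∀ as → All (_≤ sum as) as
≤-sum []       = []
≤-sum (a ∷ as) = ℕ.m≤m+n a (sum as) ∷ All.map (λ le → ℕ.≤-trans le (ℕ.m≤n+m (sum as) a)) (≤-sum as)

∈-strictPartitions⁻ : ∀ n {ρ} → ρ ∈ strictPartitions n → size ρ ≡ n
∈-strictPartitions⁻ n ρ∈ = proj₂ (∈-filter⁻ (λ as → sum as ℕ.≟ n) {xs = decreasing n} (∈-toStrict⁻ _ ρ∈))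

∈-strictPartitions⁺ : ∀ ρ → ρ ∈ strictPartitions (size ρ)
∈-strictPartitions⁺ ρ = ∈-toStrict⁺ ρ (∈-filter⁺ (λ as → sum as ℕ.≟ size ρ)
  (∈-decreasing⁺ (size ρ) (good-parts ρ) (≤-sum (parts ρ))) refl)

unique-strictPartitions : ∀ n → Unique (strictPartitions n)
unique-strictPartitions n = unique-toStrict (Unique.filter⁺ (λ as → sum as ℕ.≟ n) (unique-decreasing n))

∈-above⁻ : ∀ μ n {ρ} → ρ ∈ above μ n → μ ⊆ ρ × size ρ ≡ size μ ℕ.+ n
∈-above⁻ μ n ρ∈ with ρ∈′ , μ⊆ρ ← ∈-filter⁻ (μ ⊆?_) ρ∈ = μ⊆ρ , ∈-strictPartitions⁻ (size μ ℕ.+ n) ρ∈′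

∈-above⁺ : ∀ μ n {ρ} → μ ⊆ ρ → size ρ ≡ size μ ℕ.+ n → ρ ∈ above μ n
∈-above⁺ μ n {ρ} μ⊆ρ e = ∈-filter⁺ (μ ⊆?_) (subst (λ s → ρ ∈ strictPartitions s) e (∈-strictPartitions⁺ ρ)) μ⊆ρ

unique-above : ∀ μ n → Unique (above μ n)
unique-above μ n = Unique.filter⁺ (μ ⊆?_) (unique-strictPartitions (size μ ℕ.+ n))

infix 4 _≼_

-- An inductive form of containment that also compares lengths; for positive parts it agrees with
-- `_⊆_`.
data _≼_ : List ℕ → List ℕ → Set where
  []  : ∀ {bs} → [] ≼ bs
  _∷_ : ∀ {a b as bs} → a ≤ b → as ≼ bs → a ∷ as ≼ b ∷ bs

≼-refl : ∀ {as} → as ≼ as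
≼-refl {[]}     = []
≼-refl {a ∷ as} = ℕ.≤-refl ∷ ≼-refl

≼-trans : ∀ {as bs cs} → as ≼ bs → bs ≼ cs → as ≼ cs
≼-trans []        _         = []
≼-trans (p ∷ ps)  (q′ ∷ qs) = ℕ.≤-trans p q′ ∷ ≼-trans ps qs

≼-sum : ∀ {as bs} → as ≼ bs → sum as ≤ sum bs
≼-sum []       = z≤n
≼-sum (p ∷ ps) = ℕ.+-mono-≤ p (≼-sum ps)

≼-length : ∀ {as bs} → as ≼ bs → length as ≤ length bs
≼-length []       = z≤n
≼-length (p ∷ ps) = s≤s (≼-length ps)

≼-nth : ∀ {as bs} → as ≼ bs → ∀ i → nth as i ≤ nth bs i
≼-nth []       i             = z≤n
≼-nth (p ∷ ps) 0             = z≤n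
≼-nth (p ∷ ps) 1             = p
≼-nth (p ∷ ps) (suc (suc i)) = ≼-nth ps (suc i)

nth-≼ : ∀ {as bs} → All (0 <_) as → (∀ i → i < length as → nth as (suc i) ≤ nth bs (suc i)) → as ≼ bs
nth-≼ {[]}     {_}      _           _ = []
nth-≼ {a ∷ as} {[]}     (0<a ∷ _)   h = contradiction (ℕ.<-≤-trans 0<a (h 0 (s≤s z≤n))) λ ()
nth-≼ {a ∷ as} {b ∷ bs} (_ ∷ 0<as)  h = h 0 (s≤s z≤n) ∷ nth-≼ 0<as (λ i i< → h (suc i) (s≤s i<))

⊆⇒≼ : ∀ μ ρ → μ ⊆ ρ → parts μ ≼ parts ρ
⊆⇒≼ μ ρ μ⊆ρ = nth-≼ (proj₂ (good-parts μ)) (λ i i< → All.lookup μ⊆ρ (∈-range⁺ (s≤s z≤n) i<))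

≼⇒⊆ : ∀ μ ρ → parts μ ≼ parts ρ → μ ⊆ ρ
≼⇒⊆ μ ρ le = All.tabulate (λ {i} _ → ≼-nth le i)

positive-sum-0 : ∀ {as} → All (0 <_) as → sum as ≡ 0 → as ≡ []
positive-sum-0 []            _ = refl
positive-sum-0 (s≤s _ ∷ _)   ()

≼-sum-≡ : ∀ {as bs} → All (0 <_) bs → as ≼ bs → sum as ≡ sum bs → as ≡ bs
≼-sum-≡ 0<bs [] e = sym (positive-sum-0 0<bs (sym e))
≼-sum-≡ {a ∷ as} {b ∷ bs} (_ ∷ 0<bs) (p ∷ ps) e with ℕ.m≤n⇒m<n∨m≡n p
... | inj₁ a<b  = contradiction e (ℕ.<⇒≢ (ℕ.+-mono-<-≤ a<b (≼-sum ps)))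
... | inj₂ refl = cong (a ∷_) (≼-sum-≡ 0<bs ps (ℕ.+-cancelˡ-≡ a (sum as) (sum bs) e))

-- The sums differ by one, so the first entry that grows takes up the whole difference, and equality
-- of the remaining sums forces equality of the remaining lists.
≼⇒enlargement : ∀ {as bs} → All (0 <_) bs → as ≼ bs → sum bs ≡ suc (sum as) → ∃[ b ] (b , bs) ∈ enlargements as
≼⇒enlargement {[]} {suc zero ∷ bs}    (_ ∷ 0<bs) [] e with refl ← positive-sum-0 0<bs (ℕ.suc-injective e) = 0 , here refl
≼⇒enlargement {[]} {suc (suc b) ∷ bs} _          [] ()
≼⇒enlargement {[]} {zero ∷ bs}        (() ∷ _)   [] e
≼⇒enlargement {a ∷ as} {b ∷ bs} (_ ∷ 0<bs) (p ∷ ps) e with ℕ.m≤n⇒m<n∨m≡n p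
... | inj₂ refl with c , c∈ ← ≼⇒enlargement 0<bs ps (ℕ.+-cancelˡ-≡ a (sum bs) (suc (sum as)) (trans e (sym (ℕ.+-suc a (sum as)))))
  = c , there (∈-map⁺ _ c∈)
... | inj₁ a<b with ℕ.m≤n⇒m<n∨m≡n a<b
...   | inj₁ 1+a<b = contradiction (sym e) (ℕ.<⇒≢ (ℕ.+-mono-<-≤ 1+a<b (≼-sum ps)))
...   | inj₂ refl with refl ← ≼-sum-≡ 0<bs ps (sym (ℕ.+-cancelˡ-≡ (suc a) (sum bs) (sum as) e)) = a , here refl

enlargement⇒≼ : ∀ as {b bs} → (b , bs) ∈ enlargements as → as ≼ bs
enlargement⇒≼ []       (here refl) = []
enlargement⇒≼ (a ∷ as) (here refl) = ℕ.n≤1+n a ∷ ≼-refl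
enlargement⇒≼ (a ∷ as) (there b∈) with _ , b∈′ , refl ← ∈-map⁻ _ b∈ = ℕ.≤-refl ∷ enlargement⇒≼ as b∈′

enlargement-sum : ∀ as {b bs} → (b , bs) ∈ enlargements as → sum bs ≡ suc (sum as)
enlargement-sum []       (here refl) = refl
enlargement-sum (a ∷ as) (here refl) = refl
enlargement-sum (a ∷ as) (there b∈) with _ , b∈′ , refl ← ∈-map⁻ _ b∈ =
  trans (cong (a ℕ.+_) (enlargement-sum as b∈′)) (ℕ.+-suc a (sum as))

enlargement-length : ∀ {as} b {bs} → All (0 <_) as → (b , bs) ∈ enlargements as →
  length bs ≡ (if does (b ℕ.≟ 0) then suc (length as) else length as)
enlargement-length {[]}     b       _          (here refl) = refl
enlargement-length {_ ∷ _}  .(suc _) (s≤s _ ∷ _) (here refl) = refl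
enlargement-length {_ ∷ as} b       (_ ∷ pos)  (there b∈) with (b , _) , b∈′ , refl ← ∈-map⁻ _ b∈ =
  trans (cong suc (enlargement-length b pos b∈′)) (suc-if (does (b ℕ.≟ 0)))
  where
  suc-if : ∀ c {m n} → suc (if c then m else n) ≡ (if c then suc m else suc n)
  suc-if true  = refl
  suc-if false = refl

unique-enlargements : ∀ as → Unique (map proj₂ (enlargements as))
unique-enlargements []       = [] ∷ []
unique-enlargements (a ∷ as) = All.tabulate (λ {bs} bs∈ → distinct bs∈)
  ∷ subst Unique (trans (sym (List.map-∘ (enlargements as))) (List.map-∘ (enlargements as))) (Unique.map⁺ List.∷-injectiveʳ (unique-enlargements as))
  where
  distinct : ∀ {bs} → bs ∈ map proj₂ (map (λ (b , bs) → b , a ∷ bs) (enlargements as)) → suc a ∷ as ≢ bs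
  distinct bs∈ refl with _ , b∈ , e ← ∈-map⁻ proj₂ bs∈ with _ , _ , refl ← ∈-map⁻ _ b∈ = ℕ.1+n≢n (List.∷-injectiveˡ e)

above-1 : ∀ ρ → above ρ 1 ↭ mapMaybe toStrict (map proj₂ (enlargements (parts ρ)))
above-1 ρ = ↭-sets (unique-above ρ 1) (unique-toStrict (unique-enlargements (parts ρ))) to from
  where
  to : ∀ {κ} → κ ∈ above ρ 1 → κ ∈ mapMaybe toStrict (map proj₂ (enlargements (parts ρ)))
  to {κ} κ∈ with ρ⊆κ , e ← ∈-above⁻ ρ 1 κ∈
    with _ , b∈ ← ≼⇒enlargement (proj₂ (good-parts κ)) (⊆⇒≼ ρ κ ρ⊆κ) (trans e (ℕ.+-comm (size ρ) 1)) = ∈-toStrict⁺ κ (∈-map⁺ proj₂ b∈)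
  from : ∀ {κ} → κ ∈ mapMaybe toStrict (map proj₂ (enlargements (parts ρ))) → κ ∈ above ρ 1
  from {κ} κ∈ with _ , b∈ , refl ← ∈-map⁻ proj₂ {xs = enlargements (parts ρ)} (∈-toStrict⁻ _ κ∈) =
    ∈-above⁺ ρ 1 (≼⇒⊆ ρ κ (enlargement⇒≼ (parts ρ) b∈)) (trans (enlargement-sum (parts ρ) b∈) (ℕ.+-comm 1 (size ρ)))

-- Merges the two filtered sums of `D` into one sum with a coefficient read off from the lengths.
rowWeight : ℕ → ℕ → ℚ
rowWeight m n = (if does (m ℕ.<? n) then 1ℚ else 0ℚ) + fromℕ 2 * (if does (n ℕ.≟ m) then 1ℚ else 0ℚ)

rowWeight-suc : ∀ m → rowWeight m (suc m) ≡ 1ℚ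
rowWeight-suc m = cong₂ (λ x y → (if x then 1ℚ else 0ℚ) + fromℕ 2 * (if y then 1ℚ else 0ℚ))
  (dec-true (m ℕ.<? suc m) ℕ.≤-refl) (dec-false (suc m ℕ.≟ m) ℕ.1+n≢n)

rowWeight-refl : ∀ m → rowWeight m m ≡ fromℕ 2
rowWeight-refl m = cong₂ (λ x y → (if x then 1ℚ else 0ℚ) + fromℕ 2 * (if y then 1ℚ else 0ℚ))
  (dec-false (m ℕ.<? m) (ℕ.<-irrefl refl)) (dec-true (m ℕ.≟ m) refl)

rowWeight-enlargement : ∀ {as b bs} → All (0 <_) as → (b , bs) ∈ enlargements as → rowWeight (length as) (length bs) ≡ weight b
rowWeight-enlargement {as} {zero}  pos b∈ = trans (cong (rowWeight (length as)) (enlargement-length 0 pos b∈)) (rowWeight-suc (length as))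
rowWeight-enlargement {as} {suc b} pos b∈ = trans (cong (rowWeight (length as)) (enlargement-length (suc b) pos b∈)) (rowWeight-refl (length as))

D-sum : ∀ G ρ → D G ρ ≡ ∑ (above ρ 1) (λ κ → rowWeight (ℓ ρ) (ℓ κ) * G κ) - G ρ
D-sum G ρ = cong (_- G ρ) (begin
  ∑ (filter (λ κ → ℓ ρ ℕ.<? ℓ κ) A) G + fromℕ 2 * ∑ (filter (λ κ → ℓ κ ℕ.≟ ℓ ρ) A) G
    ≡⟨ cong₂ (λ x y → x + fromℕ 2 * y) (∑-filter (λ κ → ℓ ρ ℕ.<? ℓ κ) A G) (∑-filter (λ κ → ℓ κ ℕ.≟ ℓ ρ) A G) ⟩
  ∑ A (λ κ → g κ) + fromℕ 2 * ∑ A (λ κ → h κ)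
    ≡⟨ cong (∑ A g +_) (sym (∑-*ˡ A (fromℕ 2) h)) ⟩
  ∑ A g + ∑ A (λ κ → fromℕ 2 * h κ)
    ≡⟨ sym (∑-+ A g (λ κ → fromℕ 2 * h κ)) ⟩
  ∑ A (λ κ → g κ + fromℕ 2 * h κ)
    ≡⟨ ∑-cong′ A (λ κ → indicator (does (ℓ ρ ℕ.<? ℓ κ)) (does (ℓ κ ℕ.≟ ℓ ρ)) (G κ)) ⟩
  ∑ A (λ κ → rowWeight (ℓ ρ) (ℓ κ) * G κ) ∎)
  where
  A = above ρ 1
  g h : StrictPartition → ℚ
  g κ = if does (ℓ ρ ℕ.<? ℓ κ) then G κ else 0ℚ
  h κ = if does (ℓ κ ℕ.≟ ℓ ρ) then G κ else 0ℚ
  select : ∀ c x → (if c then x else 0ℚ) ≡ (if c then 1ℚ else 0ℚ) * x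
  select true  x = sym (ℚ.*-identityˡ x)
  select false x = sym (ℚ.*-zeroˡ x)
  indicator : ∀ c d x → (if c then x else 0ℚ) + fromℕ 2 * (if d then x else 0ℚ)
    ≡ ((if c then 1ℚ else 0ℚ) + fromℕ 2 * (if d then 1ℚ else 0ℚ)) * x
  indicator c d x = trans (cong₂ (λ u v → u + fromℕ 2 * v) (select c x) (select d x))
    (solve 4 (λ u v t x → u :* x :+ t :* (v :* x) := (u :+ t :* v) :* x) refl
      (if c then 1ℚ else 0ℚ) (if d then 1ℚ else 0ℚ) (fromℕ 2) x)

D-difference : ∀ F {G} → (∀ ρ → G ρ ≡ 1/hooks (parts ρ) * F (parts ρ)) → ∀ ρ → D G ρ ≡ difference F (parts ρ)
D-difference F {G} G≡ ρ = trans (D-sum G ρ) (cong₂ _-_ (begin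
  ∑ (above ρ 1) (λ κ → rowWeight (ℓ ρ) (ℓ κ) * G κ)
    ≡⟨ ∑-cong′ (above ρ 1) (λ κ → cong (rowWeight (ℓ ρ) (ℓ κ) *_) (G≡ κ)) ⟩
  ∑ (above ρ 1) (g ∘ parts)
    ≡⟨ ∑-↭ (g ∘ parts) (above-1 ρ) ⟩
  ∑ (mapMaybe toStrict (map proj₂ (enlargements as))) (g ∘ parts)
    ≡⟨ ∑-toStrict (map proj₂ (enlargements as)) g vanish ⟩
  ∑ (map proj₂ (enlargements as)) g
    ≡⟨ ∑-map proj₂ (enlargements as) g ⟩
  ∑ (enlargements as) (g ∘ proj₂)
    ≡⟨ ∑-cong (enlargements as) (λ {(b , bs)} b∈ → cong (_* (1/hooks bs * F bs)) (rowWeight-enlargement (proj₂ (good-parts ρ)) b∈)) ⟩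
  ∑ (enlargements as) (λ (b , bs) → weight b * (1/hooks bs * F bs)) ∎) (G≡ ρ))
  where
  as = parts ρ
  g : List ℕ → ℚ
  g bs = rowWeight (length as) (length bs) * (1/hooks bs * F bs)
  -- `toStrict` discards the enlargements with two equal parts, and these have `1/hooks` equal to 0.
  vanish : ∀ {bs} → bs ∈ map proj₂ (enlargements as) → ¬ IsStrict bs → g bs ≡ 0ℚ
  vanish {bs} bs∈ ¬s with _ , b∈ , refl ← ∈-map⁻ proj₂ {xs = enlargements as} bs∈ with enlargement-good (good-parts ρ) b∈
  ... | inj₁ good = contradiction (good⇒strict good) ¬s
  ... | inj₂ e    = trans (cong (λ x → rowWeight (length as) (length bs) * (x * F bs)) e)
          (trans (cong (rowWeight (length as) (length bs) *_) (ℚ.*-zeroˡ (F bs))) (ℚ.*-zeroʳ (rowWeight (length as) (length bs))))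

-- Each application lowers the weight bound by one, and below weight 0 no increment is left. `G` is
-- given pointwise because `D G` is known to be of this form only pointwise.
D-nilpotent : ∀ {d F} → Weighted d F → ∀ {G} → (∀ ρ → G ρ ≡ 1/hooks (parts ρ) * F (parts ρ)) →
  ∀ ρ → iterate D G (suc d) ρ ≡ 0ℚ
D-nilpotent {zero} {F} wF {G} G≡ ρ with Φ , pΦ , eΦ ← difference-weighted wF = begin
  D G ρ
    ≡⟨ trans (D-difference F G≡ ρ) (eΦ (parts ρ) (good-parts ρ)) ⟩
  1/hooks (parts ρ) * residues (parts ρ) (Φ (parts ρ))
    ≡⟨ cong (1/hooks (parts ρ) *_) (trans (residues-cong′ (parts ρ) (λ t → trans (below-0 pΦ (parts ρ) t) (sym (ℚ.*-zeroˡ 0ℚ))))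
         (trans (residues-* (parts ρ) 0ℚ (λ _ → 0ℚ)) (ℚ.*-zeroˡ (residues (parts ρ) (λ _ → 0ℚ))))) ⟩
  1/hooks (parts ρ) * 0ℚ
    ≡⟨ ℚ.*-zeroʳ (1/hooks (parts ρ)) ⟩
  0ℚ ∎
D-nilpotent {suc d} {F} wF {G} G≡ ρ with Φ , pΦ , eΦ ← difference-weighted wF =
  D-nilpotent (residues-weighted pΦ) (λ κ → trans (D-difference F G≡ κ) (eΦ (parts κ) (good-parts κ))) ρ

-- Outer corners

-- Add as b bs : the diagram of bs is that of as together with the box b.
data Add : List ℕ → Box → List ℕ → Set where
  newRow : Add [] (1 , 2) [ 1 ]
  first  : ∀ {a as} → Add (a ∷ as) (1 , suc (suc a)) (suc a ∷ as)
  later  : ∀ {a as b bs} → Add as b bs → Add (a ∷ as) (shift b) (a ∷ bs)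

enlargement⇒Add : ∀ as {a bs} → (a , bs) ∈ enlargements as → ∃[ b ] Add as b bs
enlargement⇒Add []       (here refl) = _ , newRow
enlargement⇒Add (a ∷ as) (here refl) = _ , first
enlargement⇒Add (a ∷ as) (there b∈) with _ , b∈′ , refl ← ∈-map⁻ _ b∈ with _ , add ← enlargement⇒Add as b∈′ = _ , later add

Add⇒enlargement : ∀ {as b bs} → Add as b bs → ∃[ a ] (a , bs) ∈ enlargements as
Add⇒enlargement newRow      = _ , here refl
Add⇒enlargement first       = _ , here refl
Add⇒enlargement (later add) with _ , a∈ ← Add⇒enlargement add = _ , there (∈-map⁺ _ a∈)

Add-≼ : ∀ {as b bs} → Add as b bs → as ≼ bs
Add-≼ add = enlargement⇒≼ _ (proj₂ (Add⇒enlargement add))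

Add-sum : ∀ {as b bs} → Add as b bs → sum bs ≡ suc (sum as)
Add-sum add = enlargement-sum _ (proj₂ (Add⇒enlargement add))

⊆⇒Add : ∀ κ ρ → κ ⊆ ρ → size ρ ≡ suc (size κ) → ∃[ b ] Add (parts κ) b (parts ρ)
⊆⇒Add κ ρ κ⊆ρ e = enlargement⇒Add (parts κ) (proj₂ (≼⇒enlargement (proj₂ (good-parts ρ)) (⊆⇒≼ κ ρ κ⊆ρ) e))

firstRow-suc : ∀ a → firstRow (suc a) ≡ firstRow a ++ [ (1 , suc (suc a)) ]
firstRow-suc a = trans (cong (map _ ∘ map suc) (sym (List.upTo-∷ʳ a)))
  (trans (cong (map _) (List.map-++ suc (upTo a) [ a ])) (List.map-++ _ (range a) [ suc a ]))

boxes-Add : ∀ {as b bs} → Add as b bs → ∃[ us ] ∃[ vs ] (boxes bs ≡ us ++ b ∷ vs × boxes as ≡ us ++ vs)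
boxes-Add newRow = [] , [] , refl , refl
boxes-Add (first {a} {as}) = firstRow a , map shift (boxes as) ,
  trans (cong (_++ map shift (boxes as)) (firstRow-suc a)) (List.++-assoc (firstRow a) _ (map shift (boxes as))) , refl
boxes-Add (later {a} {as} {b} {bs} add) with us , vs , e , e′ ← boxes-Add add =
  firstRow a ++ map shift us , map shift vs , extend us (b ∷ vs) e , extend us vs e′
  where
  extend : ∀ {bs} us vs → bs ≡ us ++ vs → firstRow a ++ map shift bs ≡ (firstRow a ++ map shift us) ++ map shift vs
  extend us vs refl = trans (cong (firstRow a ++_) (List.map-++ shift us vs))
    (sym (List.++-assoc (firstRow a) (map shift us) (map shift vs)))

∈-boxes⁺ : ∀ as i {k} → 1 ≤ k → k ≤ nth as (suc i) → (suc i , suc i ℕ.+ k) ∈ boxes as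
∈-boxes⁺ []       i       1≤k k≤ = contradiction (ℕ.≤-trans 1≤k k≤) λ ()
∈-boxes⁺ (a ∷ as) zero    1≤k k≤ = ∈-++⁺ˡ (∈-map⁺ _ (∈-range⁺ 1≤k k≤))
∈-boxes⁺ (a ∷ as) (suc i) 1≤k k≤ = ∈-++⁺ʳ (firstRow a) (∈-map⁺ shift (∈-boxes⁺ as i 1≤k k≤))

∈-boxes⁻ : ∀ as {b} → b ∈ boxes as → ∃[ i ] ∃[ k ] (1 ≤ k × k ≤ nth as (suc i) × b ≡ (suc i , suc i ℕ.+ k))
∈-boxes⁻ (a ∷ as) b∈ with ∈-++⁻ (firstRow a) b∈
... | inj₁ b∈₁ with k , k∈ , refl ← ∈-map⁻ _ b∈₁ with 1≤k , k≤a ← ∈-range⁻ k∈ = 0 , k , 1≤k , k≤a , refl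
... | inj₂ b∈₂ with b , b∈′ , refl ← ∈-map⁻ shift b∈₂ with i , k , 1≤k , k≤ , refl ← ∈-boxes⁻ as b∈′ = suc i , k , 1≤k , k≤ , refl

unique-boxes : ∀ as → Unique (boxes as)
unique-boxes []       = []
unique-boxes (a ∷ as) = Unique.++⁺
  (Unique.map⁺ (λ { refl → refl }) (Unique.map⁺ ℕ.suc-injective (Unique.upTo⁺ a)))
  (Unique.map⁺ (λ { refl → refl }) (unique-boxes as))
  (λ (b∈₁ , b∈₂) → disjoint b∈₁ b∈₂)
  where
  disjoint : ∀ {b} → b ∈ firstRow a → b ∈ map shift (boxes as) → ⊥
  disjoint b∈₁ b∈₂ with _ , _ , refl ← ∈-map⁻ _ b∈₁ with b , b∈ , e ← ∈-map⁻ shift b∈₂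
    with boxes-positive as b∈ | cong proj₁ e
  ... | isSuc , _ | ()

unique-++-∉ : ∀ {A : Set} us {x : A} {vs} → Unique (us ++ x ∷ vs) → x ∉ us ++ vs
unique-++-∉ []       (x∉ ∷ _) x∈         = All.lookup x∉ x∈ refl
unique-++-∉ (u ∷ us) (u∉ ∷ _) (here refl) = All.lookup u∉ (∈-++⁺ʳ us (here refl)) refl
unique-++-∉ (u ∷ us) (_ ∷ un) (there x∈) = unique-++-∉ us un x∈

other? : ∀ b → Decidable (_≢ b)
other? b b′ = ¬? (b′ ≟ᵇ b)

filter-≢ : ∀ us {b vs} → Unique (us ++ b ∷ vs) → filter (other? b) (us ++ b ∷ vs) ≡ us ++ vs
filter-≢ us {b} {vs} un = begin
  filter (other? b) (us ++ b ∷ vs) ≡⟨ List.filter-++ (other? b) us (b ∷ vs) ⟩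
  filter (other? b) us ++ filter (other? b) (b ∷ vs) ≡⟨ cong (filter (other? b) us ++_) (List.filter-reject (other? b) (λ b≢b → b≢b refl)) ⟩
  filter (other? b) us ++ filter (other? b) vs ≡⟨ List.filter-++ (other? b) us vs ⟨
  filter (other? b) (us ++ vs) ≡⟨ List.filter-all (other? b) (All.tabulate (λ { b∈ refl → unique-++-∉ us un b∈ })) ⟩
  us ++ vs                                ∎

-- Names the partition left after removing the box, so that `Add` supports recursion on the rows.
Corner : List ℕ → Box → Set
Corner as b = ∃[ cs ] (Good cs × Add cs b as)

boxes-⊆⇒≼ : ∀ {as bs} → All (0 <_) as → (∀ {b} → b ∈ boxes as → b ∈ boxes bs) → as ≼ bs
boxes-⊆⇒≼ {as} {bs} pos sub = nth-≼ pos le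
  where
  le : ∀ i → i < length as → nth as (suc i) ≤ nth bs (suc i)
  le i _ with nth as (suc i) in e
  ... | zero  = z≤n
  ... | suc k with i′ , k′ , _ , k′≤ , eq ← ∈-boxes⁻ bs (sub (∈-boxes⁺ as i (s≤s z≤n) (ℕ.≤-reflexive (sym e))))
    with refl ← cong proj₁ eq with refl ← ℕ.+-cancelˡ-≡ (suc i) (suc k) k′ (cong proj₂ eq) = k′≤

outerCorner⇒Corner : ∀ ρ {b} → b ∈ boxes (parts ρ) → IsOuterCorner ρ b → Corner (parts ρ) b
outerCorner⇒Corner ρ {b} b∈ oc with κ , κ∈ , e ← Membership.find oc = parts κ , good-parts κ , added κ∈
    (trans (sym (diagram≡boxes κ)) (trans e (cong (filter (other? b)) (diagram≡boxes ρ))))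
  where
  -- The box `b` shows that ρ is not empty, so `size ρ ∸ 1` is not truncated.
  size-suc : ∀ {as} → All (0 <_) as → b ∈ boxes as → sum as ≡ suc (sum as ∸ 1)
  size-suc {_ ∷ _} (s≤s _ ∷ _) _ = refl
  added : ∀ {κ} → κ ∈ strictPartitions (size ρ ∸ 1) → boxes (parts κ) ≡ filter (other? b) (boxes (parts ρ)) →
    Add (parts κ) b (parts ρ)
  added {κ} κ∈ e
    with c , add ← ⊆⇒Add κ ρ
        (≼⇒⊆ κ ρ (boxes-⊆⇒≼ (proj₂ (good-parts κ)) (λ {c} c∈ → proj₁ (∈-filter⁻ (other? b) (subst (c ∈_) e c∈)))))
        (trans (size-suc (proj₂ (good-parts ρ)) b∈) (cong suc (sym (∈-strictPartitions⁻ _ κ∈))))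
    with us , vs , e₁ , e₂ ← boxes-Add add with c ≟ᵇ b
  ... | yes refl = add
  -- Otherwise `c` survives the removal of `b` and lies in κ, although it is the box that κ lacks.
  ... | no c≢b   = contradiction (subst (c ∈_) (trans (sym e) e₂) (∈-filter⁺ (other? b) (subst (c ∈_) (sym e₁) (∈-++⁺ʳ us (here refl))) c≢b))
    (unique-++-∉ us (subst Unique e₁ (unique-boxes (parts ρ))))

Corner⇒outerCorner : ∀ ρ {b} → Corner (parts ρ) b → IsOuterCorner ρ b
Corner⇒outerCorner ρ {b} (cs , good , add) = Membership.lose κ∈ (trans (diagram≡boxes κ) (sym (trans
  (cong (filter (other? b)) (trans (diagram≡boxes ρ) e₁)) (trans (filter-≢ us (subst Unique e₁ (unique-boxes (parts ρ)))) (sym e₂)))))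
  where
  κ = mkStrict cs (good⇒strict good)
  κ∈ : κ ∈ strictPartitions (size ρ ∸ 1)
  κ∈ = subst (λ s → κ ∈ strictPartitions (s ∸ 1)) (sym (Add-sum add)) (∈-strictPartitions⁺ κ)
  us = proj₁ (boxes-Add add)
  e₁ = proj₁ (proj₂ (proj₂ (boxes-Add add)))
  e₂ = proj₂ (proj₂ (proj₂ (boxes-Add add)))

-- On strict lists the end of a row is removable unless the next part is smaller by exactly one. The
-- rows run downwards, whereas the corners α₁ > α₂ > ... run upwards, hence the later `reverse`.
corners : List ℕ → List Box
corners []           = []
corners (a ∷ [])     = [ (1 , suc a) ]
corners (a ∷ b ∷ bs) = (if does (a ℕ.≟ suc b) then [] else [ (1 , suc a) ]) ++ map shift (corners (b ∷ bs))

corners-run : ∀ b bs → corners (suc b ∷ b ∷ bs) ≡ map shift (corners (b ∷ bs))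
corners-run b bs rewrite dec-true (suc b ℕ.≟ suc b) refl = refl

corners-gap : ∀ {a b} bs → a ≢ suc b → corners (a ∷ b ∷ bs) ≡ (1 , suc a) ∷ map shift (corners (b ∷ bs))
corners-gap {a} {b} bs a≢1+b rewrite dec-false (a ℕ.≟ suc b) a≢1+b = refl

≼-bounded : ∀ {a cs as} → cs ≼ as → All (a >_) as → All (a >_) cs
≼-bounded []       _          = []
≼-bounded (p ∷ ps) (q′ ∷ qs)  = ℕ.≤-<-trans p q′ ∷ ≼-bounded ps qs

Add-row-positive : ∀ {as b bs} → Add as b bs → IsSuc (row b)
Add-row-positive newRow    = isSuc
Add-row-positive first     = isSuc
Add-row-positive (later _) = isSuc

filter-map-shift : ∀ {p} {P : Box → Set p} (P? : Decidable P) bs → filter P? (map shift bs) ≡ map shift (filter (P? ∘ shift) bs)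
filter-map-shift P? []       = refl
filter-map-shift P? (b ∷ bs) with does (P? (shift b))
... | true  = cong (shift b ∷_) (filter-map-shift P? bs)
... | false = filter-map-shift P? bs

-- The predicate is arbitrary, equivalent to `Corner` on the boxes, so that the recursion can pass
-- to `P? ∘ shift`.
filter-corners : ∀ as {p} {P : Box → Set p} (P? : Decidable P) → Good as →
  (∀ {b} → b ∈ boxes as → P b → Corner as b) → (∀ {b} → b ∈ boxes as → Corner as b → P b) →
  filter P? (boxes as) ≡ corners as
filter-corners [] P? _ to from = refl
filter-corners (zero ∷ as) P? (_ , () ∷ _) to from
filter-corners (suc a ∷ as) {P = P} P? (as<a ∷ dec , _ ∷ pos) to from = begin
  filter P? (firstRow (suc a) ++ map shift (boxes as))
    ≡⟨ List.filter-++ P? (firstRow (suc a)) (map shift (boxes as)) ⟩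
  filter P? (firstRow (suc a)) ++ filter P? (map shift (boxes as))
    ≡⟨ cong₂ _++_ row₁ rest ⟩
  filter P? [ (1 , suc (suc a)) ] ++ map shift (corners as)
    ≡⟨ lastBox as (as<a ∷ dec , s≤s z≤n ∷ pos) (to (last∈ {as})) (from (last∈ {as})) ⟩
  corners (suc a ∷ as) ∎
  where
  last∈ : ∀ {as} → (1 , suc (suc a)) ∈ boxes (suc a ∷ as)
  last∈ = ∈-++⁺ˡ (∈-map⁺ _ (∈-range⁺ {suc a} (s≤s z≤n) ℕ.≤-refl))
  only-last : ∀ {k cs} → Good cs → Add cs (1 , suc k) (suc a ∷ as) → k ≡ suc a
  only-last _ newRow      = refl
  only-last _ first       = refl
  only-last _ (later add) with () ← Add-row-positive add
  row₁ : filter P? (firstRow (suc a)) ≡ filter P? [ (1 , suc (suc a)) ]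
  row₁ = trans (cong (filter P?) (firstRow-suc a)) (trans (List.filter-++ P? (firstRow a) [ (1 , suc (suc a)) ])
    (cong (_++ filter P? [ (1 , suc (suc a)) ]) (List.filter-none P? (All.tabulate notCorner))))
    where
    notCorner : ∀ {b} → b ∈ firstRow a → ¬ P b
    notCorner b∈ pb with k , k∈ , refl ← ∈-map⁻ _ b∈
      with cs , good , add ← to (∈-++⁺ˡ (∈-map⁺ _ (∈-range⁺ (proj₁ (∈-range⁻ k∈)) (ℕ.m≤n⇒m≤1+n (proj₂ (∈-range⁻ k∈)))))) pb
      = ℕ.<⇒≢ (s≤s (proj₂ (∈-range⁻ k∈))) (only-last good add)
  rest : filter P? (map shift (boxes as)) ≡ map shift (corners as)
  rest = trans (filter-map-shift P? (boxes as)) (cong (map shift) (filter-corners as (P? ∘ shift) (dec , pos) to′ from′))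
    where
    shift∈ : ∀ {b} → b ∈ boxes as → shift b ∈ boxes (suc a ∷ as)
    shift∈ b∈ = ∈-++⁺ʳ (firstRow (suc a)) (∈-map⁺ shift b∈)
    unshift : ∀ {b} → IsSuc (row b) → Corner (suc a ∷ as) (shift b) → Corner as b
    unshift isSuc (_ ∷ cs , (_ ∷ dec , _ ∷ pos) , later add) = cs , (dec , pos) , add
    to′ : ∀ {b} → b ∈ boxes as → P (shift b) → Corner as b
    to′ b∈ pb = unshift (proj₁ (boxes-positive as b∈)) (to (shift∈ b∈) pb)
    from′ : ∀ {b} → b ∈ boxes as → Corner as b → P (shift b)
    from′ b∈ (cs , (dec , pos) , add) = from (shift∈ b∈) (suc a ∷ cs , (≼-bounded (Add-≼ add) as<a ∷ dec , s≤s z≤n ∷ pos) , later add)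
  lastBox : ∀ as → Good (suc a ∷ as) →
    (P (1 , suc (suc a)) → Corner (suc a ∷ as) (1 , suc (suc a))) → (Corner (suc a ∷ as) (1 , suc (suc a)) → P (1 , suc (suc a))) →
    filter P? [ (1 , suc (suc a)) ] ++ map shift (corners as) ≡ corners (suc a ∷ as)
  lastBox [] _ _ from = cong (_++ []) (List.filter-accept P? (from (corner a)))
    where
    corner : ∀ a → Corner [ suc a ] (1 , suc (suc a))
    corner zero    = [] , ([] , []) , newRow
    corner (suc a) = [ suc a ] , (([] ∷ []) , (s≤s z≤n ∷ [])) , first
  lastBox (b ∷ bs) ((b<1+a ∷ bs<1+a) ∷ bs<b ∷ dec , _ ∷ 0<b ∷ pos) to from with suc a ℕ.≟ suc b
  ... | yes refl = trans (cong (_++ map shift (corners (b ∷ bs))) (List.filter-reject P? (notCorner ∘ to))) (sym (corners-run b bs))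
    where
    notCorner : ¬ Corner (suc b ∷ b ∷ bs) (1 , suc (suc b))
    notCorner (_ , ((b<b ∷ _) ∷ _ , _) , first) = ℕ.<-irrefl refl b<b
    notCorner (_ , _ , later add) with () ← Add-row-positive add
  ... | no a≢b = trans (cong (_++ map shift (corners (b ∷ bs))) (List.filter-accept P? (from
      (a ∷ b ∷ bs , ((b<a ∷ All.map (λ x<b → ℕ.<-trans x<b b<a) bs<b) ∷ bs<b ∷ dec , ℕ.<-trans 0<b b<a ∷ 0<b ∷ pos) , first))))
      (sym (corners-gap bs a≢b))
    where
    b<a : b < a
    b<a = ℕ.≤∧≢⇒< (ℕ.s≤s⁻¹ b<1+a) (λ { refl → a≢b refl })

outerCorners≡corners : ∀ ρ → outerCorners ρ ≡ reverse (corners (parts ρ))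
outerCorners≡corners ρ = cong reverse (trans (cong (filter (isOuterCorner? ρ)) (diagram≡boxes ρ))
  (filter-corners (parts ρ) (isOuterCorner? ρ) (good-parts ρ) (outerCorner⇒Corner ρ) (λ _ → Corner⇒outerCorner ρ)))

module _ (g : ℕ → ℚ) where

  -- ∑ g over x₀, …, xₘ except the last one, when β₀ = β and the outer corners are cs.
  initialSum : ℕ → List Box → ℚ
  initialSum β []       = 0ℚ
  initialSum β (c ∷ cs) = g (β ∸ row c) + initialSum (col c) cs

  lastCol : ℕ → List Box → ℕ
  lastCol β []       = β
  lastCol β (c ∷ cs) = lastCol (col c) cs

  ∑-differences : ∀ β cs → ∑ (zipWith _∸_ (β ∷ map col cs) (map row cs ++ [ 0 ])) g ≡ initialSum β cs + g (lastCol β cs)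
  ∑-differences β []       = ℚ.+-comm (g β) 0ℚ
  ∑-differences β (c ∷ cs) = trans (cong (g (β ∸ row c) +_) (∑-differences (col c) cs))
    (sym (ℚ.+-assoc (g (β ∸ row c)) (initialSum (col c) cs) _))

  initialSum-shift : ∀ β cs → initialSum (suc β) (map shift cs) ≡ initialSum β cs
  initialSum-shift β []       = refl
  initialSum-shift β (c ∷ cs) = cong (g (β ∸ row c) +_) (initialSum-shift (col c) cs)

  lastCol-shift : ∀ β cs → lastCol (suc β) (map shift cs) ≡ suc (lastCol β cs)
  lastCol-shift β []       = refl
  lastCol-shift β (c ∷ cs) = lastCol-shift (col c) cs

  initialSum-∷ʳ : ∀ β cs c → initialSum β (cs ++ [ c ]) ≡ initialSum β cs + g (lastCol β cs ∸ row c)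
  initialSum-∷ʳ β []        c = ℚ.+-comm (g (β ∸ row c)) 0ℚ
  initialSum-∷ʳ β (c′ ∷ cs) c = trans (cong (g (β ∸ row c′) +_) (initialSum-∷ʳ (col c′) cs c))
    (sym (ℚ.+-assoc (g (β ∸ row c′)) (initialSum (col c′) cs) _))

  lastCol-∷ʳ : ∀ β cs c → lastCol β (cs ++ [ c ]) ≡ col c
  lastCol-∷ʳ β []        c = refl
  lastCol-∷ʳ β (c′ ∷ cs) c = lastCol-∷ʳ (col c′) cs c

  largest : List ℕ → ℕ
  largest []      = 0
  largest (a ∷ _) = a

  increments : List ℕ → ℚ
  increments as = ∑ as (λ a → g (suc a) - g a)

  -- An invariant under adding rows on top. `g 1` is the value at the empty partition, where x₀ = 1.
  -- The last difference is kept apart since every new row changes it; it is the largest part plus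
  -- one. A row that continues a run of consecutive parts creates no corner and changes this term
  -- alone, so the increments telescope.
  CornerSum : List ℕ → List Box → Set
  CornerSum as cs = lastCol (suc (length as)) cs ≡ suc (largest as)
    × initialSum (suc (length as)) cs + g (suc (largest as)) - ∑ (map content cs) g ≡ g 1 + increments as

  cornerSum-∷ʳ : ∀ a as cs → CornerSum as cs → CornerSum (a ∷ as) (map shift cs ++ [ (1 , suc a) ])
  cornerSum-∷ʳ a as cs (last , e) = lastCol-∷ʳ _ (map shift cs) (1 , suc a) , (begin
    initialSum (suc (suc (length as))) (map shift cs ++ [ (1 , suc a) ]) + g (suc a) - ∑ (map content (map shift cs ++ [ (1 , suc a) ])) g
      ≡⟨ cong₂ (λ x y → x + g (suc a) - y)
           (trans (initialSum-∷ʳ _ (map shift cs) (1 , suc a)) (cong₂ (λ x y → x + g (y ∸ 1)) (initialSum-shift _ cs) (trans (lastCol-shift _ cs) (cong suc last))))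
           (trans (cong (λ l → ∑ l g) (trans (List.map-++ content (map shift cs) [ (1 , suc a) ]) (cong (_++ [ a ]) (sym (List.map-∘ cs)))))
             (∑-++ (map content cs) [ a ] g)) ⟩
    i + g (suc (largest as)) + g (suc a) - (y + (g a + 0ℚ))
      ≡⟨ solve 5 (λ i l b y a → i :+ l :+ b :- (y :+ (a :+ con 0ℚ)) := (i :+ l :- y) :+ (b :- a)) refl i (g (suc (largest as))) (g (suc a)) y (g a) ⟩
    i + g (suc (largest as)) - y + (g (suc a) - g a)
      ≡⟨ cong (_+ (g (suc a) - g a)) e ⟩
    g 1 + increments as + (g (suc a) - g a)
      ≡⟨ solve 3 (λ o s d → o :+ s :+ d := o :+ (d :+ s)) refl (g 1) (increments as) (g (suc a) - g a) ⟩
    g 1 + (g (suc a) - g a + increments as) ∎)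
    where
    i = initialSum (suc (length as)) cs
    y = ∑ (map content cs) g

  cornerSum-shift : ∀ b bs cs → CornerSum (b ∷ bs) cs → CornerSum (suc b ∷ b ∷ bs) (map shift cs)
  cornerSum-shift b bs cs (last , e) = trans (lastCol-shift _ cs) (cong suc last) , (begin
    initialSum (suc (suc (suc (length bs)))) (map shift cs) + g (suc (suc b)) - ∑ (map content (map shift cs)) g
      ≡⟨ cong₂ (λ x l → x + g (suc (suc b)) - ∑ l g) (initialSum-shift _ cs) (sym (List.map-∘ cs)) ⟩
    i + g (suc (suc b)) - y
      ≡⟨ solve 4 (λ i t y s → i :+ t :- y := (i :+ s :- y) :+ (t :- s)) refl i (g (suc (suc b))) y (g (suc b)) ⟩
    i + g (suc b) - y + (g (suc (suc b)) - g (suc b))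
      ≡⟨ cong (_+ (g (suc (suc b)) - g (suc b))) e ⟩
    g 1 + increments (b ∷ bs) + (g (suc (suc b)) - g (suc b))
      ≡⟨ solve 3 (λ o s d → o :+ s :+ d := o :+ (d :+ s)) refl (g 1) (increments (b ∷ bs)) (g (suc (suc b)) - g (suc b)) ⟩
    g 1 + (g (suc (suc b)) - g (suc b) + increments (b ∷ bs)) ∎)
    where
    i = initialSum (suc (suc (length bs))) cs
    y = ∑ (map content cs) g

  cornerSum-∷ : ∀ a b bs → CornerSum (b ∷ bs) (reverse (corners (b ∷ bs))) → CornerSum (a ∷ b ∷ bs) (reverse (corners (a ∷ b ∷ bs)))
  cornerSum-∷ a b bs sums with a ℕ.≟ suc b
  ... | yes refl = subst (CornerSum (suc b ∷ b ∷ bs)) (begin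
    map shift (reverse (corners (b ∷ bs))) ≡⟨ List.reverse-map shift (corners (b ∷ bs)) ⟩
    reverse (map shift (corners (b ∷ bs))) ≡⟨ cong reverse (corners-run b bs) ⟨
    reverse (corners (suc b ∷ b ∷ bs))       ∎)
    (cornerSum-shift b bs (reverse (corners (b ∷ bs))) sums)
  ... | no a≢1+b = subst (CornerSum (a ∷ b ∷ bs)) (begin
    map shift (reverse (corners (b ∷ bs))) ++ [ (1 , suc a) ] ≡⟨ cong (_++ [ (1 , suc a) ]) (List.reverse-map shift (corners (b ∷ bs))) ⟩
    reverse (map shift (corners (b ∷ bs))) ++ [ (1 , suc a) ] ≡⟨ List.unfold-reverse (1 , suc a) (map shift (corners (b ∷ bs))) ⟨
    reverse ((1 , suc a) ∷ map shift (corners (b ∷ bs))) ≡⟨ cong reverse (corners-gap bs a≢1+b) ⟨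
    reverse (corners (a ∷ b ∷ bs))                              ∎)
    (cornerSum-∷ʳ a (b ∷ bs) (reverse (corners (b ∷ bs))) sums)

  cornerSum : ∀ as → CornerSum as (reverse (corners as))
  cornerSum []           = refl , solve 1 (λ x → con 0ℚ :+ x :- con 0ℚ := x :+ con 0ℚ) refl (g 1)
  cornerSum (a ∷ [])     = cornerSum-∷ʳ a [] [] (cornerSum [])
  cornerSum (a ∷ b ∷ bs) = cornerSum-∷ a b bs (cornerSum (b ∷ bs))

-- The exponent is positive because `q 0` is 1, there being one more x than y, while the power
-- difference for exponent 0 is 0.
q≡powerDifference : ∀ k ρ → q (suc k) ρ ≡ powerDifference (parts ρ) (suc k)
q≡powerDifference k ρ = begin
  ∑ (zipWith _∸_ (suc (ℓ ρ) ∷ map col (outerCorners ρ)) (map row (outerCorners ρ) ++ [ 0 ])) g - ∑ (map content (outerCorners ρ)) g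
    ≡⟨ cong (λ cs → ∑ (zipWith _∸_ (suc (ℓ ρ) ∷ map col cs) (map row cs ++ [ 0 ])) g - ∑ (map content cs) g) (outerCorners≡corners ρ) ⟩
  ∑ (zipWith _∸_ (suc (ℓ ρ) ∷ map col cs) (map row cs ++ [ 0 ])) g - ∑ (map content cs) g
    ≡⟨ cong (_- ∑ (map content cs) g) (∑-differences g (suc (ℓ ρ)) cs) ⟩
  initialSum g (suc (ℓ ρ)) cs + g (lastCol g (suc (ℓ ρ)) cs) - ∑ (map content cs) g
    ≡⟨ cong (λ l → initialSum g (suc (ℓ ρ)) cs + g l - ∑ (map content cs) g) (proj₁ (cornerSum g as)) ⟩
  initialSum g (suc (ℓ ρ)) cs + g (suc (largest g as)) - ∑ (map content cs) g
    ≡⟨ proj₂ (cornerSum g as) ⟩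
  -- `g 1` is C(1, 2) to a positive power, hence 0.
  0ℚ + increments g as
    ≡⟨ ℚ.+-identityˡ (increments g as) ⟩
  increments g as
    ≡⟨ ∑-cong′ as (λ a → cong₂ _-_ (trans (fromℕ-^ (suc a C 2) (suc k)) (cong (_^ℚ suc k) (sym (z-def a))))
         (trans (fromℕ-^ (a C 2) (suc k)) (cong (_^ℚ suc k) (sym (w-def a))))) ⟩
  powerDifference as (suc k) ∎
  where
  as = parts ρ
  cs = reverse (corners as)
  g : ℕ → ℚ
  g x = fromℕ ((x C 2) ^ suc k)

-- Fillings and their largest entry

∈-words⁻ : ∀ {A : Set} (as : List A) k {v} → v ∈ words as k → length v ≡ k × All (_∈ as) v
∈-words⁻ as zero    (here refl) = refl , []
∈-words⁻ as (suc k) v∈ with a , v , a∈ , v∈′ , refl ← ∈-cartesianProductWith⁻ _∷_ as (words as k) v∈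
  with e , all ← ∈-words⁻ as k v∈′ = cong suc e , a∈ ∷ all

∈-words⁺ : ∀ {A : Set} {as : List A} {v} → All (_∈ as) v → v ∈ words as (length v)
∈-words⁺ []         = here refl
∈-words⁺ (a∈ ∷ all) = ∈-cartesianProductWith⁺ _∷_ a∈ (∈-words⁺ all)

unique-words : ∀ {A : Set} {as : List A} k → Unique as → Unique (words as k)
unique-words zero    u = [] ∷ []
unique-words (suc k) u = Unique.cartesianProductWith⁺ _∷_ List.∷-injective u (unique-words k u)

unique-range : ∀ n → Unique (range n)
unique-range n = Unique.map⁺ ℕ.suc-injective (Unique.upTo⁺ n)

∈-++-∷⁻ : ∀ {A : Set} us {x y : A} {vs} → y ∈ us ++ x ∷ vs → y ≡ x ⊎ y ∈ us ++ vs
∈-++-∷⁻ us {vs = vs} y∈ with ∈-++⁻ us y∈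
... | inj₁ y∈us         = inj₂ (∈-++⁺ˡ y∈us)
... | inj₂ (here e)     = inj₁ e
... | inj₂ (there y∈vs) = inj₂ (∈-++⁺ʳ us y∈vs)

∈-++-∷⁺ : ∀ {A : Set} us {x y : A} {vs} → y ∈ us ++ vs → y ∈ us ++ x ∷ vs
∈-++-∷⁺ us y∈ with ∈-++⁻ us y∈
... | inj₁ y∈us = ∈-++⁺ˡ y∈us
... | inj₂ y∈vs = ∈-++⁺ʳ us (there y∈vs)

unique-++-∷⁻ : ∀ {A : Set} us {x : A} {vs} → Unique (us ++ x ∷ vs) → Unique (us ++ vs)
unique-++-∷⁻ []       (_ ∷ un)  = un
unique-++-∷⁻ (u ∷ us) (u∉ ∷ un) = All.tabulate (λ y∈ → All.lookup u∉ (∈-++-∷⁺ us y∈)) ∷ unique-++-∷⁻ us un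

unique-++-∷⁺ : ∀ {A : Set} us {x : A} {vs} → Unique (us ++ vs) → x ∉ us ++ vs → Unique (us ++ x ∷ vs)
unique-++-∷⁺ []       un        x∉ = All.tabulate (λ { y∈ refl → x∉ y∈ }) ∷ un
unique-++-∷⁺ (u ∷ us) (u∉ ∷ un) x∉ = All.tabulate (λ y∈ e → case ∈-++-∷⁻ us y∈ of λ
  { (inj₁ refl) → x∉ (here (sym e)) ; (inj₂ y∈′) → All.lookup u∉ y∈′ e }) ∷ unique-++-∷⁺ us un (x∉ ∘ there)

unique-split : ∀ {A : Set} us us′ {x : A} {vs vs′ ws} → Unique ws → ws ≡ us ++ x ∷ vs → ws ≡ us′ ++ x ∷ vs′ → us ≡ us′ × vs ≡ vs′
unique-split []       []         un        refl refl = refl , refl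
unique-split []       (u ∷ us′)  (x∉ ∷ _)  refl e with refl , refl ← List.∷-injective e =
  contradiction refl (All.lookup x∉ (∈-++⁺ʳ us′ (here refl)))
unique-split (u ∷ us) []         (x∉ ∷ _)  refl e with refl , refl ← List.∷-injective e =
  contradiction refl (All.lookup x∉ (∈-++⁺ʳ us (here refl)))
unique-split (u ∷ us) (_ ∷ us′)  (_ ∷ un)  refl e with refl , e′ ← List.∷-injective e
  with refl , e″ ← unique-split us us′ un refl e′ = refl , e″

length-split : ∀ {A : Set} us us′ {x y : A} {vs vs′} → length us ≡ length us′ → us ++ x ∷ vs ≡ us′ ++ y ∷ vs′ → x ≡ y
length-split []       []        _ e = List.∷-injectiveˡ e
length-split (u ∷ us) (_ ∷ us′) l e = length-split us us′ (ℕ.suc-injective l) (List.∷-injectiveʳ e)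

unique-length : ∀ {A : Set} {us vs : List A} → Unique us → (∀ {x} → x ∈ us → x ∈ vs) → length us ≤ length vs
unique-length {us = []}     _         _   = z≤n
unique-length {us = u ∷ us} (u∉ ∷ un) sub with ws , ws′ , refl ← ∈-∃++ (sub (here refl)) = ℕ.≤-trans
  (s≤s (unique-length un (λ x∈ → case ∈-++-∷⁻ ws (sub (there x∈)) of λ
    { (inj₁ refl) → contradiction refl (All.lookup u∉ x∈) ; (inj₂ x∈′) → x∈′ })))
  (ℕ.≤-reflexive (sym (List.length-++-sucʳ ws _ _)))

length-range : ∀ n → length (range n) ≡ n
length-range n = trans (List.length-map suc (upTo n)) (List.length-upTo n)

∈-range-suc : ∀ {m x} → x ∈ range (suc m) → x ≢ suc m → x ∈ range m
∈-range-suc x∈ x≢ with 1≤x , x≤ ← ∈-range⁻ x∈ = ∈-range⁺ 1≤x (ℕ.s≤s⁻¹ (ℕ.≤∧≢⇒< x≤ x≢))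

range-weaken : ∀ {m x} → x ∈ range m → x ∈ range (suc m)
range-weaken x∈ with 1≤x , x≤ ← ∈-range⁻ x∈ = ∈-range⁺ 1≤x (ℕ.m≤n⇒m≤1+n x≤)

zip-++ : ∀ {A B : Set} (us : List A) (v : List B) {us′ v′} → length us ≡ length v → zip (us ++ us′) (v ++ v′) ≡ zip us v ++ zip us′ v′
zip-++ []       []      _ = refl
zip-++ (u ∷ us) (x ∷ v) e = cong ((u , x) ∷_) (zip-++ us v (ℕ.suc-injective e))

∈-zip⁻ : ∀ {A B : Set} (us : List A) (v : List B) {p} → p ∈ zip us v → proj₁ p ∈ us × proj₂ p ∈ v
∈-zip⁻ (u ∷ us) (x ∷ v) (here refl) = here refl , here refl
∈-zip⁻ (u ∷ us) (x ∷ v) (there p∈) with u∈ , x∈ ← ∈-zip⁻ us v p∈ = there u∈ , there x∈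

∈-zip⁺ : ∀ {A B : Set} (us : List A) (v : List B) {u} → length us ≡ length v → u ∈ us → ∃[ x ] (u , x) ∈ zip us v
∈-zip⁺ (u ∷ us) (x ∷ v) e (here refl) = x , here refl
∈-zip⁺ (u ∷ us) (x ∷ v) e (there u∈) with y , y∈ ← ∈-zip⁺ us v (ℕ.suc-injective e) u∈ = y , there y∈

Before : Box → Box → Set
Before b b′ = (row b ≡ row b′ × col b < col b′) ⊎ (col b ≡ col b′ × row b < row b′)

Increasing⁻ : ∀ {T b s b′ t} → Increasing T → (b , s) ∈ T → (b′ , t) ∈ T → Before b b′ → s < t
Increasing⁻ inc p p′ (inj₁ (e , lt)) = proj₁ (All.lookup (All.lookup inc p) p′) e lt
Increasing⁻ inc p p′ (inj₂ (e , lt)) = proj₂ (All.lookup (All.lookup inc p) p′) e lt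

Increasing⁺ : ∀ {T} → (∀ {b s b′ t} → (b , s) ∈ T → (b′ , t) ∈ T → Before b b′ → s < t) → Increasing T
Increasing⁺ h = All.tabulate (λ p → All.tabulate (λ p′ → (λ e lt → h p p′ (inj₁ (e , lt))) , (λ e lt → h p p′ (inj₂ (e , lt)))))

Filling : List Box → List ℕ → Set
Filling bs v = length v ≡ length bs × All (_∈ range (length bs)) v × Unique v × Increasing (zip bs v)

-- `tableaux ρ μ` is by definition `fillings (skew ρ μ)`; an arbitrary list of boxes allows one to
-- be inserted or removed.
fillings : List Box → List (List ℕ)
fillings bs = filter (λ v → unique? v ×-dec increasing? (zip bs v)) (words (range (length bs)) (length bs))

∈-fillings⁻ : ∀ bs {v} → v ∈ fillings bs → Filling bs v
∈-fillings⁻ bs v∈ with v∈′ , u , inc ← ∈-filter⁻ (λ v → unique? v ×-dec increasing? (zip bs v)) {xs = words (range (length bs)) (length bs)} v∈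
  with e , all ← ∈-words⁻ (range (length bs)) (length bs) v∈′ = e , all , u , inc

∈-fillings⁺ : ∀ bs {v} → Filling bs v → v ∈ fillings bs
∈-fillings⁺ bs {v} (e , all , u , inc) = ∈-filter⁺ (λ v → unique? v ×-dec increasing? (zip bs v))
  (subst (λ k → v ∈ words (range (length bs)) k) e (∈-words⁺ all)) (u , inc)

unique-fillings : ∀ bs → Unique (fillings bs)
unique-fillings bs = Unique.filter⁺ _ (unique-words (length bs) (unique-range (length bs)))

-- The pigeonhole principle: m + 1 distinct entries do not fit into {1, ..., m}.
filling-max : ∀ bs {v m} → Filling bs v → length bs ≡ suc m → suc m ∈ v
filling-max bs {v} {m} (e , all , u , _) l with suc m ∈? v
  where open DecMembership ℕ._≟_ using (_∈?_)
... | yes m∈ = m∈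
... | no m∉  = contradiction
  (subst₂ _≤_ (trans e l) (length-range m) (unique-length u (λ {x} x∈ →
    ∈-range-suc (subst (λ n → x ∈ range n) l (All.lookup all x∈)) (λ { refl → m∉ x∈ })))) ℕ.1+n≰n

module _ (us : List Box) {b : Box} {vs : List Box} (v : List ℕ) {v′ : List ℕ} (e : length us ≡ length v) where

  private
    m = length (us ++ vs)

    zipped : zip (us ++ b ∷ vs) (v ++ suc m ∷ v′) ≡ zip us v ++ (b , suc m) ∷ zip vs v′
    zipped = zip-++ us v e

  -- The new entry exceeds all others, so order can fail only at a box that comes after `b`.
  filling-insert : Filling (us ++ vs) (v ++ v′) → (∀ {b′} → b′ ∈ us ++ b ∷ vs → ¬ Before b b′) →
    Filling (us ++ b ∷ vs) (v ++ suc m ∷ v′)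
  filling-insert (l , all , u , inc) maximal =
    trans (List.length-++-sucʳ v _ _) (trans (cong suc l) (sym (List.length-++-sucʳ us _ _))) ,
    All.tabulate (λ {x} x∈ → subst (λ n → x ∈ range n) (sym (List.length-++-sucʳ us _ _)) (case ∈-++-∷⁻ v x∈ of λ
      { (inj₁ refl) → ∈-range⁺ (s≤s z≤n) ℕ.≤-refl ; (inj₂ x∈′) → range-weaken (All.lookup all x∈′) })) ,
    unique-++-∷⁺ v u (λ m∈ → ℕ.1+n≰n (proj₂ (∈-range⁻ (All.lookup all m∈)))) ,
    Increasing⁺ (λ p p′ before → compare (∈-++-∷⁻ (zip us v) (subst (_ ∈_) zipped p)) (∈-++-∷⁻ (zip us v) (subst (_ ∈_) zipped p′))
      (proj₁ (∈-zip⁻ (us ++ b ∷ vs) (v ++ suc m ∷ v′) p′)) before)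
    where
    old : ∀ {p} → p ∈ zip us v ++ zip vs v′ → p ∈ zip (us ++ vs) (v ++ v′)
    old = subst (_ ∈_) (sym (zip-++ us v e))
    compare : ∀ {c s c′ t} → (c , s) ≡ (b , suc m) ⊎ (c , s) ∈ zip us v ++ zip vs v′ →
      (c′ , t) ≡ (b , suc m) ⊎ (c′ , t) ∈ zip us v ++ zip vs v′ → c′ ∈ us ++ b ∷ vs → Before c c′ → s < t
    compare (inj₁ refl) _           c′∈ before = contradiction before (maximal c′∈)
    compare (inj₂ p)    (inj₁ refl) _   before = s≤s (proj₂ (∈-range⁻ (All.lookup all (proj₂ (∈-zip⁻ (us ++ vs) (v ++ v′) (old p))))))
    compare (inj₂ p)    (inj₂ p′)   _   before = Increasing⁻ inc (old p) (old p′) before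

  filling-remove : Filling (us ++ b ∷ vs) (v ++ suc m ∷ v′) → Filling (us ++ vs) (v ++ v′)
  filling-remove (l , all , u , inc) =
    ℕ.suc-injective (trans (sym (List.length-++-sucʳ v _ _)) (trans l (List.length-++-sucʳ us _ _))) ,
    All.tabulate (λ {x} x∈ → ∈-range-suc (subst (λ n → x ∈ range n) (List.length-++-sucʳ us _ _) (All.lookup all (∈-++-∷⁺ v x∈)))
      (λ { refl → unique-++-∉ v u x∈ })) ,
    unique-++-∷⁻ v u ,
    Increasing⁺ (λ p p′ → Increasing⁻ inc (new p) (new p′))
    where
    new : ∀ {p} → p ∈ zip (us ++ vs) (v ++ v′) → p ∈ zip (us ++ b ∷ vs) (v ++ suc m ∷ v′)
    new p∈ = subst (_ ∈_) (sym zipped) (∈-++-∷⁺ (zip us v) (subst (_ ∈_) (zip-++ us v e) p∈))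

  filling-maximal : Filling (us ++ b ∷ vs) (v ++ suc m ∷ v′) → ∀ {b′} → b′ ∈ us ++ b ∷ vs → ¬ Before b b′
  filling-maximal (l , all , u , inc) b′∈ before
    with t , p′ ← ∈-zip⁺ (us ++ b ∷ vs) (v ++ suc m ∷ v′) (sym l) b′∈ = ℕ.<⇒≱
      (Increasing⁻ inc (subst (_ ∈_) (sym zipped) (∈-++⁺ʳ (zip us v) (here refl))) p′ before)
      (subst (t ≤_) (List.length-++-sucʳ us _ _) (proj₂ (∈-range⁻ (All.lookup all (proj₂ (∈-zip⁻ (us ++ b ∷ vs) _ p′))))))

-- Positions beyond the end mean the end, so insertion is injective at every position.
insertAt : ∀ {A : Set} → ℕ → A → List A → List A
insertAt zero    x v       = x ∷ v
insertAt (suc p) x []      = [ x ]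
insertAt (suc p) x (y ∷ v) = y ∷ insertAt p x v

insertAt-++ : ∀ {A : Set} (v : List A) x v′ → insertAt (length v) x (v ++ v′) ≡ v ++ x ∷ v′
insertAt-++ []      x v′ = refl
insertAt-++ (y ∷ v) x v′ = cong (y ∷_) (insertAt-++ v x v′)

insertAt-≢[] : ∀ {A : Set} p {x : A} v → insertAt p x v ≢ []
insertAt-≢[] zero    v       ()
insertAt-≢[] (suc p) []      ()
insertAt-≢[] (suc p) (y ∷ v) ()

insertAt-injective : ∀ {A : Set} p (x : A) {v v′} → insertAt p x v ≡ insertAt p x v′ → v ≡ v′
insertAt-injective zero    x                   e = List.∷-injectiveʳ e
insertAt-injective (suc p) x {[]}    {[]}      e = refl
insertAt-injective (suc p) x {[]}    {_ ∷ v′}  e = contradiction (sym (List.∷-injectiveʳ e)) (insertAt-≢[] p v′)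
insertAt-injective (suc p) x {_ ∷ v} {[]}      e = contradiction (List.∷-injectiveʳ e) (insertAt-≢[] p v)
insertAt-injective (suc p) x {_ ∷ _} {_ ∷ _}   e with refl , e′ ← List.∷-injective e = cong (_ ∷_) (insertAt-injective p x e′)

takeWhile-++ : ∀ {A : Set} {p} {P : A → Set p} (P? : Decidable P) {us x vs} → All P us → ¬ P x → takeWhile P? (us ++ x ∷ vs) ≡ us
takeWhile-++ P? {[]} {x} [] ¬px with P? x
... | yes px = contradiction px ¬px
... | no _   = refl
takeWhile-++ P? {u ∷ us} (pu ∷ all) ¬px with P? u
... | yes _  = cong (u ∷_) (takeWhile-++ P? all ¬px)
... | no ¬pu = contradiction pu ¬pu

-- Each step down costs at least one, which matches the row `d` further down starting `d` columns
-- further right.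
nth-gap : ∀ {as} → Decreasing as → ∀ i d → 0 < nth as (suc (i ℕ.+ d)) → nth as (suc (i ℕ.+ d)) ℕ.+ d ≤ nth as (suc i)
nth-gap {a ∷ as}     (_ ∷ dec)         (suc i) d       0< = nth-gap dec i d 0<
nth-gap {a ∷ as}     _                 zero    zero    0< = ℕ.≤-reflexive (ℕ.+-identityʳ a)
nth-gap {a ∷ c ∷ as} ((c<a ∷ _) ∷ dec) zero    (suc d) 0< =
  ℕ.≤-trans (ℕ.≤-reflexive (ℕ.+-suc (nth (c ∷ as) (suc d)) d)) (ℕ.≤-trans (s≤s (nth-gap dec 0 d 0<)) c<a)

-- Membership of `b` in some diagram `bs` only places it to the right of the diagonal. Along a
-- column the claim is `nth-gap`.
boxes-closed : ∀ {as} bs → Decreasing as → ∀ {b b′} → b ∈ boxes bs → b′ ∈ boxes as → Before b b′ → b ∈ boxes as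
boxes-closed {as} bs dec b∈ b′∈ before with i , k , 1≤k , _ , refl ← ∈-boxes⁻ bs b∈ with i′ , k′ , 1≤k′ , k′≤ , refl ← ∈-boxes⁻ as b′∈
  with before
... | inj₁ (refl , lt) = ∈-boxes⁺ as i 1≤k (ℕ.≤-trans (ℕ.<⇒≤ (ℕ.+-cancelˡ-< (suc i) k k′ lt)) k′≤)
... | inj₂ (e , lt) with d , refl ← ℕ.m≤n⇒∃[o]m+o≡n (ℕ.s≤s⁻¹ (ℕ.<⇒≤ lt)) = ∈-boxes⁺ as i 1≤k
  (ℕ.≤-trans (ℕ.≤-reflexive k≡) (ℕ.≤-trans (ℕ.+-monoˡ-≤ d k′≤) (nth-gap dec i d (ℕ.<-≤-trans 1≤k′ k′≤))))
  where
  k≡ : k ≡ k′ ℕ.+ d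
  k≡ = ℕ.+-cancelˡ-≡ (suc i) k (k′ ℕ.+ d) (trans e (trans (ℕ.+-assoc (suc i) d k′) (cong (suc i ℕ.+_) (ℕ.+-comm d k′))))

boxes-≼ : ∀ {as bs} → as ≼ bs → ∀ {b} → b ∈ boxes as → b ∈ boxes bs
boxes-≼ {as} {bs} le b∈ with i , k , 1≤k , k≤ , refl ← ∈-boxes⁻ as b∈ = ∈-boxes⁺ bs i 1≤k (ℕ.≤-trans k≤ (≼-nth le (suc i)))

removable : ∀ {as} i → Good as → 0 < nth as (suc i) → nth as (suc (suc i)) ≡ 0 ⊎ suc (nth as (suc (suc i))) < nth as (suc i) →
  Corner as (suc i , suc i ℕ.+ nth as (suc i))
removable {suc zero ∷ []}         zero _                     _ _ = [] , ([] , []) , newRow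
removable {suc (suc a) ∷ []}      zero _                     _ _ = [ suc a ] , (([] ∷ []) , (s≤s z≤n ∷ [])) , first
removable {suc zero ∷ c ∷ as}     zero _                     _ (inj₂ (s≤s ()))
removable {a ∷ zero ∷ as}         zero (_ , _ ∷ () ∷ _)
removable {a ∷ suc c ∷ as}        zero _                     _ (inj₁ ())
removable {suc (suc a) ∷ c ∷ as}  zero (_ ∷ cs<c ∷ dec , _ ∷ pos) _ (inj₂ (s≤s c<1+a)) =
  suc a ∷ c ∷ as , ((c<1+a ∷ All.map (λ x<c → ℕ.<-trans x<c c<1+a) cs<c) ∷ cs<c ∷ dec , s≤s z≤n ∷ pos) , first
removable {a ∷ as} (suc i) (as<a ∷ dec , 0<a ∷ pos) 0< gap with cs , (dec′ , pos′) , add ← removable i (dec , pos) 0< gap =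
  a ∷ cs , ((≼-bounded (Add-≼ add) as<a ∷ dec′) , (0<a ∷ pos′)) , later add

-- Skew tableaux

open DecMembership _≟ᵇ_ using (_∈?_)

outside? : ∀ μ → Decidable (_∉ diagram μ)
outside? μ b = ¬? (b ∈? diagram μ)

-- The last two components let `takeWhile` locate `b` in the list of boxes from κ alone.
skew-Add : ∀ μ κ ρ {b} → μ ⊆ κ → Add (parts κ) b (parts ρ) → ∃[ us ] ∃[ vs ]
  (skew ρ μ ≡ us ++ b ∷ vs × skew κ μ ≡ us ++ vs × All (_∈ diagram κ) us × b ∉ diagram κ)
skew-Add μ κ ρ {b} μ⊆κ add with us , vs , e , e′ ← boxes-Add add =
  filter (outside? μ) us , filter (outside? μ) vs ,
  (begin
    filter (outside? μ) (diagram ρ) ≡⟨ cong (filter (outside? μ)) (trans (diagram≡boxes ρ) e) ⟩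
    filter (outside? μ) (us ++ b ∷ vs) ≡⟨ List.filter-++ (outside? μ) us (b ∷ vs) ⟩
    filter (outside? μ) us ++ filter (outside? μ) (b ∷ vs) ≡⟨ cong (filter (outside? μ) us ++_) (List.filter-accept (outside? μ) b∉μ) ⟩
    filter (outside? μ) us ++ b ∷ filter (outside? μ) vs           ∎) ,
  trans (cong (filter (outside? μ)) (trans (diagram≡boxes κ) e′)) (List.filter-++ (outside? μ) us vs) ,
  All.tabulate (λ {c} c∈ → subst (c ∈_) (sym (trans (diagram≡boxes κ) e′)) (∈-++⁺ˡ (proj₁ (∈-filter⁻ (outside? μ) {xs = us} c∈)))) ,
  b∉κ
  where
  b∉κ : b ∉ diagram κ
  b∉κ b∈ with us , vs , e , e′ ← boxes-Add add = unique-++-∉ us (subst Unique e (unique-boxes (parts ρ)))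
    (subst (b ∈_) (trans (diagram≡boxes κ) e′) b∈)
  b∉μ : b ∉ diagram μ
  b∉μ b∈ = b∉κ (subst (b ∈_) (sym (diagram≡boxes κ)) (boxes-≼ (⊆⇒≼ μ κ μ⊆κ) (subst (b ∈_) (diagram≡boxes μ) b∈)))

-- A box of κ after `b` would force `b` into κ by `boxes-closed`.
Add-maximal : ∀ κ ρ {b b′} → Add (parts κ) b (parts ρ) → b ∉ diagram κ → b′ ∈ diagram ρ → ¬ Before b b′
Add-maximal κ ρ {b} {b′} add b∉ b′∈ before with us , vs , e , e′ ← boxes-Add add
  with ∈-++-∷⁻ us (subst (b′ ∈_) (trans (diagram≡boxes ρ) e) b′∈)
... | inj₁ refl = irreflexive before
  where
  irreflexive : ¬ Before b b
  irreflexive (inj₁ (_ , lt)) = ℕ.<-irrefl refl lt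
  irreflexive (inj₂ (_ , lt)) = ℕ.<-irrefl refl lt
... | inj₂ b′∈κ = b∉ (subst (b ∈_) (sym (diagram≡boxes κ)) (boxes-closed (parts ρ) (proj₁ (good-parts κ))
    (subst (b ∈_) (sym e) (∈-++⁺ʳ us (here refl))) (subst (b′ ∈_) (sym e′) b′∈κ) before))

-- No box of ρ at all comes after `b`, since one in μ would put `b` into μ. So `b` ends its row and
-- has no box below it, which keeps the next part away from its own by at least two.
maximal⇒Corner : ∀ μ ρ {b} → b ∈ skew ρ μ → (∀ {b′} → b′ ∈ skew ρ μ → ¬ Before b b′) → Corner (parts ρ) b
maximal⇒Corner μ ρ {b} b∈ maximal with b∈ρ , b∉μ ← ∈-filter⁻ (outside? μ) {xs = diagram ρ} b∈
  with i , k , 1≤k , k≤ , refl ← ∈-boxes⁻ (parts ρ) (subst (b ∈_) (diagram≡boxes ρ) b∈ρ)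
  = subst (λ k → Corner (parts ρ) (suc i , suc i ℕ.+ k)) (sym k≡)
      (removable i (good-parts ρ) (ℕ.<-≤-trans 1≤k k≤) (subst (λ k → below ≡ 0 ⊎ suc below < k) k≡ (gap below refl)))
  where
  below = nth (parts ρ) (suc (suc i))
  notAfter : ∀ {b′} → b′ ∈ boxes (parts ρ) → ¬ Before b b′
  notAfter {b′} b′∈ before = maximal (∈-filter⁺ (outside? μ) (subst (b′ ∈_) (sym (diagram≡boxes ρ)) b′∈)
    (λ b′∈μ → b∉μ (subst (b ∈_) (sym (diagram≡boxes μ)) (boxes-closed (parts ρ) (proj₁ (good-parts μ))
      (subst (b ∈_) (diagram≡boxes ρ) b∈ρ) (subst (b′ ∈_) (diagram≡boxes μ) b′∈μ) before)))) before
  k≡ : k ≡ nth (parts ρ) (suc i)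
  k≡ with ℕ.m≤n⇒m<n∨m≡n k≤
  ... | inj₂ e   = e
  ... | inj₁ k<n = contradiction (inj₁ (refl , ℕ.+-monoʳ-< (suc i) (ℕ.n<1+n k))) (notAfter (∈-boxes⁺ (parts ρ) i (s≤s z≤n) k<n))
  gap : ∀ m → m ≡ below → below ≡ 0 ⊎ suc below < k
  gap zero    e = inj₁ (sym e)
  gap (suc m) e with ℕ.≤-<-connex k (suc below)
  ... | inj₂ lt  = inj₂ lt
  -- The next row is long enough to contain the box directly below `b`, at offset `k - 1`; this
  -- offset is positive since the nonzero next part gives k ≥ 2.
  ... | inj₁ k≤′ = contradiction (inj₂ (e′ , ℕ.n<1+n (suc i))) (notAfter (∈-boxes⁺ (parts ρ) (suc i) 1≤pred (ℕ.pred-mono-≤ k≤′)))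
    where
    0<below : 0 < below
    0<below = subst (0 <_) e (s≤s z≤n)
    below< : suc below ≤ nth (parts ρ) (suc i)
    below< = ℕ.≤-trans (ℕ.≤-reflexive (trans (ℕ.+-comm 1 below) (cong (λ j → nth (parts ρ) (suc j) ℕ.+ 1) (ℕ.+-comm 1 i))))
      (nth-gap (proj₁ (good-parts ρ)) i 1 (subst (λ j → 0 < nth (parts ρ) (suc j)) (ℕ.+-comm 1 i) 0<below))
    2≤k : 2 ≤ k
    2≤k = subst (2 ≤_) (sym k≡) (ℕ.≤-trans (s≤s 0<below) below<)
    1≤pred : 1 ≤ ℕ.pred k
    1≤pred = ℕ.pred-mono-≤ 2≤k
    e′ : suc i ℕ.+ k ≡ suc (suc i) ℕ.+ ℕ.pred k
    e′ = trans (cong (suc i ℕ.+_) (sym (ℕ.suc-pred k {{ℕ.>-nonZero 1≤k}}))) (ℕ.+-suc (suc i) (ℕ.pred k))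

length-concatMap : ∀ {A B : Set} (T : A → List B) as → fromℕ (length (concatMap T as)) ≡ ∑ as (λ a → fromℕ (length (T a)))
length-concatMap T []       = refl
length-concatMap T (a ∷ as) = trans (cong fromℕ (List.length-++ (T a)))
  (trans (fromℕ-+ (length (T a)) (length (concatMap T as))) (cong (fromℕ (length (T a)) +_) (length-concatMap T as)))

unique-allPairs : ∀ {A : Set} {R : A → A → Set} {as} → Unique as → (∀ {a a′} → a ∈ as → a′ ∈ as → a ≢ a′ → R a a′) → AllPairs R as
unique-allPairs []        r = []
unique-allPairs (a∉ ∷ un) r = All.tabulate (λ a′∈ → r (here refl) (there a′∈) (All.lookup a∉ a′∈))
  ∷ unique-allPairs un (λ p p′ → r (there p) (there p′))

splitAt-length : ∀ {A B : Set} (us : List B) {vs} (v : List A) → length v ≡ length (us ++ vs) →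
  ∃[ v₁ ] ∃[ v₂ ] (v ≡ v₁ ++ v₂ × length us ≡ length v₁)
splitAt-length []       v       _ = [] , v , refl , refl
splitAt-length (u ∷ us) (x ∷ v) e with v₁ , v₂ , refl , e′ ← splitAt-length us v (ℕ.suc-injective e) =
  x ∷ v₁ , v₂ , refl , cong suc e′

splitAt-∷ : ∀ {A B : Set} (v : List A) {x v′} (bs : List B) → length (v ++ x ∷ v′) ≡ length bs →
  ∃[ us ] ∃[ b ] ∃[ vs ] (bs ≡ us ++ b ∷ vs × length us ≡ length v)
splitAt-∷ []      (b ∷ bs) e = [] , b , bs , refl , refl
splitAt-∷ (y ∷ v) (b ∷ bs) e with us , b′ , vs , refl , e′ ← splitAt-∷ v bs (ℕ.suc-injective e) = b ∷ us , b′ , vs , refl , cong suc e′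

nonempty-length : ∀ {A : Set} {as : List A} → as ≢ [] → ∃[ m ] length as ≡ suc m
nonempty-length {as = []}     as≢[] = contradiction refl as≢[]
nonempty-length {as = _ ∷ as} _     = length as , refl

filling-peel : ∀ bs {v} → bs ≢ [] → Filling bs v → ∃[ us ] ∃[ b ] ∃[ vs ] ∃[ v₁ ] ∃[ v₂ ]
  (bs ≡ us ++ b ∷ vs × v ≡ v₁ ++ suc (length (us ++ vs)) ∷ v₂ × length us ≡ length v₁)
filling-peel bs bs≢[] fill with m , l ← nonempty-length bs≢[] with v₁ , v₂ , refl ← ∈-∃++ (filling-max bs fill l)
  with us , b , vs , e , len ← splitAt-∷ v₁ bs (proj₁ fill) =
  us , b , vs , v₁ , v₂ , e , cong (λ m → v₁ ++ m ∷ v₂) (trans (sym l) (trans (cong length e) (List.length-++-sucʳ us _ _))) , len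

module _ (μ : StrictPartition) (n : ℕ) (ρ : StrictPartition) (ρ∈ : ρ ∈ above μ (suc n)) where

  private
    smaller : List StrictPartition
    smaller = filter (_⊆? ρ) (above μ n)

    -- For κ with one box less than ρ, the first box of ρ/μ outside κ is the box ρ/κ, so this is the
    -- index at which the largest entry belongs.
    position : StrictPartition → ℕ
    position κ = length (takeWhile (_∈? diagram κ) (skew ρ μ))

    -- The tableaux of shape ρ/μ with their largest entry in the box ρ/κ.
    extensions : StrictPartition → List (List ℕ)
    extensions κ = map (insertAt (position κ) (length (skew ρ μ))) (tableaux κ μ)

    record Cover (κ : StrictPartition) (b : Box) : Set where
      field
        us vs  : List Box
        add    : Add (parts κ) b (parts ρ)
        skewρ  : skew ρ μ ≡ us ++ b ∷ vs
        skewκ  : skew κ μ ≡ us ++ vs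
        b∉     : b ∉ diagram κ
        pos    : position κ ≡ length us

    size-ρ : ∀ {κ} → κ ∈ above μ n → size ρ ≡ suc (size κ)
    size-ρ κ∈ = trans (proj₂ (∈-above⁻ μ (suc n) ρ∈)) (trans (ℕ.+-suc (size μ) n) (cong suc (sym (proj₂ (∈-above⁻ μ n κ∈)))))

    cover-Add : ∀ κ {b} → μ ⊆ κ → Add (parts κ) b (parts ρ) → Cover κ b
    cover-Add κ {b} μ⊆κ add with us , vs , e , e′ , us∈ , b∉ ← skew-Add μ κ ρ μ⊆κ add = record
      { us = us ; vs = vs ; add = add ; skewρ = e ; skewκ = e′ ; b∉ = b∉
      ; pos = cong length (trans (cong (takeWhile (_∈? diagram κ)) e) (takeWhile-++ (_∈? diagram κ) us∈ b∉)) }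

    cover : ∀ {κ} → κ ∈ smaller → ∃[ b ] Cover κ b
    cover {κ} κ∈ = _ , cover-Add κ (proj₁ (∈-above⁻ μ n κ∈′)) (proj₂ (⊆⇒Add κ ρ κ⊆ρ (size-ρ κ∈′)))
      where
      κ∈′ = proj₁ (∈-filter⁻ (_⊆? ρ) {xs = above μ n} κ∈)
      κ⊆ρ = proj₂ (∈-filter⁻ (_⊆? ρ) {xs = above μ n} κ∈)

    skew-length : ∀ {κ b} (c : Cover κ b) → length (skew ρ μ) ≡ suc (length (Cover.us c ++ Cover.vs c))
    skew-length c = trans (cong length (Cover.skewρ c)) (List.length-++-sucʳ (Cover.us c) _ _)

    record Extension {κ : StrictPartition} {b : Box} (c : Cover κ b) (v : List ℕ) : Set where
      field
        v₁ v₂   : List ℕ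
        shape   : v ≡ v₁ ++ suc (length (Cover.us c ++ Cover.vs c)) ∷ v₂
        len     : length (Cover.us c) ≡ length v₁
        filling : Filling (Cover.us c ++ Cover.vs c) (v₁ ++ v₂)

    extension⁻ : ∀ {κ b} (c : Cover κ b) {v} → v ∈ extensions κ → Extension c v
    extension⁻ {κ} c v∈ with v′ , v′∈ , refl ← ∈-map⁻ _ v∈
      with fill ← subst (λ bs → Filling bs v′) (Cover.skewκ c) (∈-fillings⁻ (skew κ μ) v′∈)
      with v₁ , v₂ , refl , e ← splitAt-length (Cover.us c) v′ (proj₁ fill) = record
      { v₁ = v₁ ; v₂ = v₂ ; len = e ; filling = fill
      ; shape = trans (cong₂ (λ p m → insertAt p m (v₁ ++ v₂)) (trans (Cover.pos c) e) (skew-length c)) (insertAt-++ v₁ _ v₂) }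

    extension⁺ : ∀ {κ b} (c : Cover κ b) {v} → Extension c v → v ∈ extensions κ
    extension⁺ {κ} c record { v₁ = v₁ ; v₂ = v₂ ; shape = refl ; len = e ; filling = fill } =
      subst (_∈ extensions κ) (trans (cong₂ (λ p m → insertAt p m (v₁ ++ v₂)) (trans (Cover.pos c) e) (skew-length c)) (insertAt-++ v₁ _ v₂))
        (∈-map⁺ _ (∈-fillings⁺ (skew κ μ) (subst (λ bs → Filling bs (v₁ ++ v₂)) (sym (Cover.skewκ c)) fill)))

    extension-filling : ∀ {κ b} (c : Cover κ b) {v} → Extension c v → Filling (Cover.us c ++ b ∷ Cover.vs c) v
    extension-filling {κ} c record { v₁ = v₁ ; v₂ = v₂ ; shape = refl ; len = e ; filling = fill } =
      filling-insert (Cover.us c) v₁ e fill (λ {b′} b′∈ → Add-maximal κ ρ (Cover.add c) (Cover.b∉ c)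
        (proj₁ (∈-filter⁻ (outside? μ) {xs = diagram ρ} (subst (b′ ∈_) (sym (Cover.skewρ c)) b′∈))))

    sound : ∀ {v} → v ∈ concatMap extensions smaller → v ∈ tableaux ρ μ
    sound {v} v∈ with xs , v∈xs , xs∈ ← ∈-concat⁻′ _ v∈ with κ , κ∈ , refl ← ∈-map⁻ extensions xs∈ =
      ∈-fillings⁺ (skew ρ μ) (subst (λ bs → Filling bs v) (sym (Cover.skewρ c)) (extension-filling c (extension⁻ c v∈xs)))
      where c = proj₂ (cover κ∈)

    unique-skew : Unique (skew ρ μ)
    unique-skew = Unique.filter⁺ _ (subst Unique (sym (diagram≡boxes ρ)) (unique-boxes (parts ρ)))

    skew-nonempty : skew ρ μ ≢ []
    skew-nonempty e = ℕ.<⇒≱ (ℕ.≤-trans (ℕ.≤-reflexive (ℕ.+-comm 1 (size μ))) (ℕ.≤-trans (ℕ.+-monoʳ-≤ (size μ) (s≤s z≤n))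
      (ℕ.≤-reflexive (sym (proj₂ (∈-above⁻ μ (suc n) ρ∈)))))) (≼-sum (boxes-⊆⇒≼ {bs = parts μ} (proj₂ (good-parts ρ)) inside))
      where
      inside : ∀ {b} → b ∈ boxes (parts ρ) → b ∈ boxes (parts μ)
      inside {b} b∈ with b ∈? diagram μ
      ... | yes b∈μ = subst (b ∈_) (diagram≡boxes μ) b∈μ
      ... | no b∉μ  = contradiction (subst (b ∈_) e
              (∈-filter⁺ (outside? μ) (subst (b ∈_) (sym (diagram≡boxes ρ)) b∈) b∉μ)) λ ()

    Corner⇒Cover : ∀ {b} → b ∈ skew ρ μ → Corner (parts ρ) b → ∃[ κ ] (κ ∈ smaller × Cover κ b)
    Corner⇒Cover {b} b∈ (cs , good , add) = κ , κ∈ , cover-Add κ μ⊆κ add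
      where
      κ = mkStrict cs (good⇒strict good)
      -- The removed box lies outside μ, so every box of μ survives.
      μ⊆κ : μ ⊆ κ
      μ⊆κ with us , vs , e , e′ ← boxes-Add add = ≼⇒⊆ μ κ (boxes-⊆⇒≼ (proj₂ (good-parts μ)) (λ {c} c∈ →
        case ∈-++-∷⁻ us (subst (c ∈_) e (boxes-≼ (⊆⇒≼ μ ρ (proj₁ (∈-above⁻ μ (suc n) ρ∈))) c∈)) of λ
          { (inj₁ refl) → contradiction (subst (c ∈_) (sym (diagram≡boxes μ)) c∈)
              (proj₂ (∈-filter⁻ (outside? μ) {xs = diagram ρ} b∈))
          ; (inj₂ c∈′) → subst (c ∈_) (sym e′) c∈′ }))
      κ∈ : κ ∈ smaller
      κ∈ = ∈-filter⁺ (_⊆? ρ) (∈-above⁺ μ n μ⊆κ (ℕ.suc-injective (trans (sym (Add-sum add))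
        (trans (proj₂ (∈-above⁻ μ (suc n) ρ∈)) (ℕ.+-suc (size μ) n))))) (≼⇒⊆ κ ρ (Add-≼ add))

    toExtension : ∀ {κ b} (c : Cover κ b) {us vs} v₁ {v₂ v} → us ≡ Cover.us c × vs ≡ Cover.vs c →
      v ≡ v₁ ++ suc (length (us ++ vs)) ∷ v₂ → length us ≡ length v₁ → Filling (us ++ b ∷ vs) v → Extension c v
    toExtension c v₁ (refl , refl) refl len fill = record
      { v₁ = v₁ ; shape = refl ; len = len ; filling = filling-remove (Cover.us c) v₁ len fill }

    maximal-entry : ∀ us {b vs} v₁ {v₂ v} → v ≡ v₁ ++ suc (length (us ++ vs)) ∷ v₂ → length us ≡ length v₁ →
      Filling (us ++ b ∷ vs) v → ∀ {b′} → b′ ∈ us ++ b ∷ vs → ¬ Before b b′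
    maximal-entry us v₁ refl len fill = filling-maximal us v₁ len fill

    complete : ∀ {v} → v ∈ tableaux ρ μ → v ∈ concatMap extensions smaller
    complete {v} v∈ = assemble (filling-peel (skew ρ μ) skew-nonempty fill)
      where
      fill : Filling (skew ρ μ) v
      fill = ∈-fillings⁻ (skew ρ μ) v∈
      assemble : ∃[ us ] ∃[ b ] ∃[ vs ] ∃[ v₁ ] ∃[ v₂ ]
        (skew ρ μ ≡ us ++ b ∷ vs × v ≡ v₁ ++ suc (length (us ++ vs)) ∷ v₂ × length us ≡ length v₁) → v ∈ concatMap extensions smaller
      assemble (us , b , vs , v₁ , v₂ , e , shape , len) = finish (Corner⇒Cover b∈ (maximal⇒Corner μ ρ b∈
          (λ {b′} b′∈ → maximal-entry us v₁ shape len fill′ (subst (b′ ∈_) e b′∈))))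
        where
        fill′ : Filling (us ++ b ∷ vs) v
        fill′ = subst (λ bs → Filling bs v) e fill
        b∈ : b ∈ skew ρ μ
        b∈ = subst (b ∈_) (sym e) (∈-++⁺ʳ us (here refl))
        finish : ∃[ κ ] (κ ∈ smaller × Cover κ b) → v ∈ concatMap extensions smaller
        finish (κ , κ∈ , c) = ∈-concat⁺′
          (extension⁺ c (toExtension c v₁ (unique-split us (Cover.us c) unique-skew e (Cover.skewρ c)) shape len fill′))
          (∈-map⁺ extensions κ∈)

    Add-unique : ∀ {κ κ′ b} → Add (parts κ) b (parts ρ) → Add (parts κ′) b (parts ρ) → κ ≡ κ′
    Add-unique {κ} {κ′} {b} add add′ = parts-injective (≼-sum-≡ (proj₂ (good-parts κ′)) (boxes-⊆⇒≼ (proj₂ (good-parts κ)) transfer)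
      (ℕ.suc-injective (trans (sym (Add-sum add)) (Add-sum add′))))
      where
      transfer : ∀ {c} → c ∈ boxes (parts κ) → c ∈ boxes (parts κ′)
      transfer {c} c∈ with us , vs , e , e′ ← boxes-Add add | us′ , vs′ , d , d′ ← boxes-Add add′
        with ∈-++-∷⁻ us′ (subst (c ∈_) d (boxes-≼ (Add-≼ add) c∈))
      ... | inj₁ refl = contradiction (subst (c ∈_) e′ c∈) (unique-++-∉ us (subst Unique e (unique-boxes (parts ρ))))
      ... | inj₂ c∈′  = subst (c ∈_) (sym d′) c∈′

    -- The largest entry occurs only once in `v`, so its position, and with it the box, is
    -- determined.
    sameBox : ∀ {κ κ′ b b′ v} (c : Cover κ b) (c′ : Cover κ′ b′) → Extension c v → Extension c′ v → b ≡ b′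
    sameBox c c′ x x′ = length-split (Cover.us c) (Cover.us c′)
      (trans (Extension.len x) (trans (cong length v₁≡) (sym (Extension.len x′)))) (trans (sym (Cover.skewρ c)) (Cover.skewρ c′))
      where
      v₁≡ : Extension.v₁ x ≡ Extension.v₁ x′
      v₁≡ = proj₁ (unique-split (Extension.v₁ x) (Extension.v₁ x′) (proj₁ (proj₂ (proj₂ (extension-filling c x))))
        (Extension.shape x) (trans (Extension.shape x′) (cong (λ m → Extension.v₁ x′ ++ m ∷ Extension.v₂ x′)
          (trans (sym (skew-length c′)) (skew-length c)))))

    sameCover : ∀ {κ κ′ b b′} → Cover κ b → Cover κ′ b′ → b ≡ b′ → κ ≡ κ′
    sameCover {κ} {κ′} c c′ refl = Add-unique {κ} {κ′} (Cover.add c) (Cover.add c′)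

    disjoint : ∀ {κ κ′} → κ ∈ smaller → κ′ ∈ smaller → κ ≢ κ′ → Disjoint (extensions κ) (extensions κ′)
    disjoint κ∈ κ′∈ κ≢κ′ (v∈ , v∈′) = κ≢κ′ (sameCover c c′ (sameBox c c′ (extension⁻ c v∈) (extension⁻ c′ v∈′)))
      where
      c = proj₂ (cover κ∈)
      c′ = proj₂ (cover κ′∈)

  f-recursion : fromℕ (f ρ μ) ≡ ∑ smaller (λ κ → fromℕ (f κ μ))
  f-recursion = begin
    fromℕ (length (tableaux ρ μ))
      ≡⟨ cong fromℕ (Perm.↭-length (↭-sets (unique-fillings (skew ρ μ)) unique complete sound)) ⟩
    fromℕ (length (concatMap extensions smaller))
      ≡⟨ length-concatMap extensions smaller ⟩
    ∑ smaller (λ κ → fromℕ (length (extensions κ)))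
      ≡⟨ ∑-cong′ smaller (λ κ → cong fromℕ (List.length-map _ (tableaux κ μ))) ⟩
    ∑ smaller (λ κ → fromℕ (f κ μ)) ∎
    where
    unique : Unique (concatMap extensions smaller)
    unique = Unique.concat⁺
      (All.map⁺ (All.tabulate (λ {κ} _ → Unique.map⁺ (insertAt-injective (position κ) _) (unique-fillings (skew κ μ)))))
      (AllPairs.map⁺ (unique-allPairs (Unique.filter⁺ (_⊆? ρ) (unique-above μ n)) disjoint))

-- Sums over partitions containing μ

-- Every new row contains a new box; the additive form avoids truncated subtraction.
≼-length-sum : ∀ {as bs} → All (0 <_) bs → as ≼ bs → length bs ℕ.+ sum as ≤ length as ℕ.+ sum bs
≼-length-sum {bs = []}     _          []       = z≤n
≼-length-sum {bs = b ∷ bs} (0<b ∷ 0<bs) []     = ℕ.≤-trans (ℕ.+-monoʳ-≤ 1 (≼-length-sum 0<bs [])) (ℕ.+-monoˡ-≤ (sum bs) 0<b)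
≼-length-sum {a ∷ as} {b ∷ bs} (_ ∷ 0<bs) (p ∷ ps) = s≤s (subst₂ _≤_
  (swap-front a (length bs) (sum as)) (swap-front b (length as) (sum bs)) (ℕ.+-mono-≤ p (≼-length-sum 0<bs ps)))
  where
  swap-front : ∀ x y t → x ℕ.+ (y ℕ.+ t) ≡ y ℕ.+ (x ℕ.+ t)
  swap-front x y t = trans (sym (ℕ.+-assoc x y t)) (trans (cong (ℕ._+ t) (ℕ.+-comm x y)) (ℕ.+-assoc y x t))

exponent : StrictPartition → StrictPartition → ℕ
exponent μ ρ = (size ρ ∸ size μ) ∸ (ℓ ρ ∸ ℓ μ)

-- The sum, over all chains of single-box additions from μ to ρ, of the products of the coefficients
-- in `D`.
paths : StrictPartition → StrictPartition → ℚ
paths μ ρ = fromℕ (2 ^ exponent μ ρ ℕ.* f ρ μ)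

weightedSum : StrictPartition → ℕ → (StrictPartition → ℚ) → ℚ
weightedSum μ n G = ∑ (above μ n) (λ κ → paths μ κ * G κ)

size-∸ : ∀ μ n {κ} → κ ∈ above μ n → size κ ∸ size μ ≡ n
size-∸ μ n κ∈ = trans (cong (_∸ size μ) (proj₂ (∈-above⁻ μ n κ∈))) (ℕ.m+n∸m≡n (size μ) n)

-- The exponent is the number of new boxes minus the number of new rows: a box opening a row leaves
-- it unchanged, any other box raises it by one.
rowWeight-exponent : ∀ μ n {κ ρ} → κ ∈ above μ n → ρ ∈ above μ (suc n) → κ ⊆ ρ →
  rowWeight (ℓ κ) (ℓ ρ) * fromℕ (2 ^ exponent μ κ) ≡ fromℕ (2 ^ exponent μ ρ)
rowWeight-exponent μ n {κ} {ρ} κ∈ ρ∈ κ⊆ρ = begin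
  rowWeight (ℓ κ) (ℓ ρ) * fromℕ (2 ^ exponent μ κ)
    ≡⟨ cong (λ d → rowWeight (ℓ κ) (ℓ ρ) * fromℕ (2 ^ (d ∸ (ℓ κ ∸ ℓ μ)))) (size-∸ μ n κ∈) ⟩
  rowWeight (ℓ κ) (ℓ ρ) * fromℕ (2 ^ (n ∸ (ℓ κ ∸ ℓ μ)))
    ≡⟨ byLength (proj₁ b∈) (enlargement-length (proj₁ b∈) (proj₂ (good-parts κ)) (proj₂ b∈)) ⟩
  fromℕ (2 ^ (suc n ∸ (ℓ ρ ∸ ℓ μ)))
    ≡⟨ cong (λ d → fromℕ (2 ^ (d ∸ (ℓ ρ ∸ ℓ μ)))) (size-∸ μ (suc n) ρ∈) ⟨
  fromℕ (2 ^ exponent μ ρ) ∎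
  where
  μ≼κ : parts μ ≼ parts κ
  μ≼κ = ⊆⇒≼ μ κ (proj₁ (∈-above⁻ μ n κ∈))
  size-ρ : size ρ ≡ suc (size κ)
  size-ρ = trans (proj₂ (∈-above⁻ μ (suc n) ρ∈)) (trans (ℕ.+-suc (size μ) n) (cong suc (sym (proj₂ (∈-above⁻ μ n κ∈)))))
  b∈ : ∃[ b ] (b , parts ρ) ∈ enlargements (parts κ)
  b∈ = ≼⇒enlargement (proj₂ (good-parts ρ)) (⊆⇒≼ κ ρ κ⊆ρ) size-ρ
  -- Guarantees that passing from `n` to `n + 1` really raises the truncated difference when no row
  -- is added.
  rows≤n : ℓ κ ∸ ℓ μ ≤ n
  rows≤n = ℕ.m≤n+o⇒m∸n≤o (ℓ κ) (ℓ μ) (ℕ.+-cancelˡ-≤ (size μ) (ℓ κ) (ℓ μ ℕ.+ n) (subst₂ _≤_ (ℕ.+-comm (ℓ κ) (size μ))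
    (trans (cong (ℓ μ ℕ.+_) (proj₂ (∈-above⁻ μ n κ∈))) (trans (sym (ℕ.+-assoc (ℓ μ) (size μ) n))
      (trans (cong (ℕ._+ n) (ℕ.+-comm (ℓ μ) (size μ))) (ℕ.+-assoc (size μ) (ℓ μ) n))))
    (≼-length-sum (proj₂ (good-parts κ)) μ≼κ)))
  e = n ∸ (ℓ κ ∸ ℓ μ)
  byLength : ∀ b → ℓ ρ ≡ (if does (b ℕ.≟ 0) then suc (ℓ κ) else ℓ κ) →
    rowWeight (ℓ κ) (ℓ ρ) * fromℕ (2 ^ e) ≡ fromℕ (2 ^ (suc n ∸ (ℓ ρ ∸ ℓ μ)))
  byLength zero l = begin
    rowWeight (ℓ κ) (ℓ ρ) * fromℕ (2 ^ e) ≡⟨ cong (λ k → rowWeight (ℓ κ) k * fromℕ (2 ^ e)) l ⟩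
    rowWeight (ℓ κ) (suc (ℓ κ)) * fromℕ (2 ^ e) ≡⟨ cong (_* fromℕ (2 ^ e)) (rowWeight-suc (ℓ κ)) ⟩
    1ℚ * fromℕ (2 ^ e) ≡⟨ ℚ.*-identityˡ _ ⟩
    fromℕ (2 ^ (suc n ∸ suc (ℓ κ ∸ ℓ μ))) ≡⟨ cong (λ k → fromℕ (2 ^ (suc n ∸ k)))
                                                    (trans (sym (ℕ.+-∸-assoc 1 (≼-length μ≼κ))) (cong (_∸ ℓ μ) (sym l))) ⟩
    fromℕ (2 ^ (suc n ∸ (ℓ ρ ∸ ℓ μ)))           ∎
  byLength (suc _) l = begin
    rowWeight (ℓ κ) (ℓ ρ) * fromℕ (2 ^ e) ≡⟨ cong (λ k → rowWeight (ℓ κ) k * fromℕ (2 ^ e)) l ⟩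
    rowWeight (ℓ κ) (ℓ κ) * fromℕ (2 ^ e) ≡⟨ cong (_* fromℕ (2 ^ e)) (rowWeight-refl (ℓ κ)) ⟩
    fromℕ 2 * fromℕ (2 ^ e) ≡⟨ fromℕ-* 2 (2 ^ e) ⟨
    fromℕ (2 ^ suc e) ≡⟨ cong (λ k → fromℕ (2 ^ k)) (sym (ℕ.+-∸-assoc 1 rows≤n)) ⟩
    fromℕ (2 ^ (suc n ∸ (ℓ κ ∸ ℓ μ))) ≡⟨ cong (λ k → fromℕ (2 ^ (suc n ∸ (k ∸ ℓ μ)))) l ⟨
    fromℕ (2 ^ (suc n ∸ (ℓ ρ ∸ ℓ μ)))           ∎

paths-recursion : ∀ μ n {ρ} → ρ ∈ above μ (suc n) →
  ∑ (filter (_⊆? ρ) (above μ n)) (λ κ → paths μ κ * rowWeight (ℓ κ) (ℓ ρ)) ≡ paths μ ρ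
paths-recursion μ n {ρ} ρ∈ = begin
  ∑ below (λ κ → paths μ κ * rowWeight (ℓ κ) (ℓ ρ))
    ≡⟨ ∑-cong below summand ⟩
  ∑ below (λ κ → fromℕ (2 ^ exponent μ ρ) * fromℕ (f κ μ))
    ≡⟨ ∑-*ˡ below (fromℕ (2 ^ exponent μ ρ)) (λ κ → fromℕ (f κ μ)) ⟩
  fromℕ (2 ^ exponent μ ρ) * ∑ below (λ κ → fromℕ (f κ μ))
    ≡⟨ cong (fromℕ (2 ^ exponent μ ρ) *_) (f-recursion μ n ρ ρ∈) ⟨
  fromℕ (2 ^ exponent μ ρ) * fromℕ (f ρ μ)
    ≡⟨ fromℕ-* (2 ^ exponent μ ρ) (f ρ μ) ⟨
  paths μ ρ ∎
  where
  below = filter (_⊆? ρ) (above μ n)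
  summand : ∀ {κ} → κ ∈ below → paths μ κ * rowWeight (ℓ κ) (ℓ ρ) ≡ fromℕ (2 ^ exponent μ ρ) * fromℕ (f κ μ)
  summand {κ} κ∈ = begin
    paths μ κ * rowWeight (ℓ κ) (ℓ ρ)
      ≡⟨ cong (_* rowWeight (ℓ κ) (ℓ ρ)) (fromℕ-* (2 ^ exponent μ κ) (f κ μ)) ⟩
    x * y * r
      ≡⟨ solve 3 (λ x y r → x :* y :* r := r :* x :* y) refl x y r ⟩
    r * x * y
      ≡⟨ cong (_* y) (rowWeight-exponent μ n {κ} {ρ} (proj₁ κ∈′) ρ∈ (proj₂ κ∈′)) ⟩
    fromℕ (2 ^ exponent μ ρ) * y ∎
    where
    κ∈′ = ∈-filter⁻ (_⊆? ρ) {xs = above μ n} κ∈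
    x = fromℕ (2 ^ exponent μ κ)
    y = fromℕ (f κ μ)
    r = rowWeight (ℓ κ) (ℓ ρ)

⊆-trans : ∀ μ κ ρ → μ ⊆ κ → κ ⊆ ρ → μ ⊆ ρ
⊆-trans μ κ ρ μ⊆κ κ⊆ρ = ≼⇒⊆ μ ρ (≼-trans (⊆⇒≼ μ κ μ⊆κ) (⊆⇒≼ κ ρ κ⊆ρ))

above-suc : ∀ μ n {κ} → κ ∈ above μ n → above κ 1 ↭ filter (κ ⊆?_) (above μ (suc n))
above-suc μ n {κ} κ∈ = ↭-sets (unique-above κ 1) (Unique.filter⁺ (κ ⊆?_) (unique-above μ (suc n))) to from
  where
  μ⊆κ = proj₁ (∈-above⁻ μ n κ∈)
  size≡ : size κ ℕ.+ 1 ≡ size μ ℕ.+ suc n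
  size≡ = trans (cong (ℕ._+ 1) (proj₂ (∈-above⁻ μ n κ∈))) (trans (ℕ.+-assoc (size μ) n 1) (cong (size μ ℕ.+_) (ℕ.+-comm n 1)))
  to : ∀ {ρ} → ρ ∈ above κ 1 → ρ ∈ filter (κ ⊆?_) (above μ (suc n))
  to {ρ} ρ∈ = ∈-filter⁺ (κ ⊆?_) (∈-above⁺ μ (suc n) (⊆-trans μ κ ρ μ⊆κ (proj₁ (∈-above⁻ κ 1 ρ∈)))
    (trans (proj₂ (∈-above⁻ κ 1 ρ∈)) size≡)) (proj₁ (∈-above⁻ κ 1 ρ∈))
  from : ∀ {ρ} → ρ ∈ filter (κ ⊆?_) (above μ (suc n)) → ρ ∈ above κ 1
  from {ρ} ρ∈ = ∈-above⁺ κ 1 (proj₂ ρ∈′) (trans (proj₂ (∈-above⁻ μ (suc n) (proj₁ ρ∈′))) (sym size≡))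
    where ρ∈′ = ∈-filter⁻ (κ ⊆?_) {xs = above μ (suc n)} ρ∈

-- The term `- G` of `D` cancels the first sum. What remains is a double sum over pairs κ ⊆ ρ
-- differing by one box; summing over κ first leaves `paths-recursion`.
weightedSum-suc : ∀ μ n G → weightedSum μ (suc n) G ≡ weightedSum μ n G + weightedSum μ n (D G)
weightedSum-suc μ n G = sym (begin
  weightedSum μ n G + weightedSum μ n (D G)
    ≡⟨ sym (∑-+ A (λ κ → paths μ κ * G κ) (λ κ → paths μ κ * D G κ)) ⟩
  ∑ A (λ κ → paths μ κ * G κ + paths μ κ * D G κ)
    ≡⟨ ∑-cong A (λ {κ} κ∈ → begin
         paths μ κ * G κ + paths μ κ * D G κ
           ≡⟨ cong (λ d → paths μ κ * G κ + paths μ κ * d) (D-sum G κ) ⟩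
         paths μ κ * G κ + paths μ κ * (∑ (above κ 1) (λ ρ → rowWeight (ℓ κ) (ℓ ρ) * G ρ) - G κ)
           ≡⟨ solve 3 (λ p g s → p :* g :+ p :* (s :- g) := p :* s) refl (paths μ κ) (G κ) (∑ (above κ 1) (λ ρ → rowWeight (ℓ κ) (ℓ ρ) * G ρ)) ⟩
         paths μ κ * ∑ (above κ 1) (λ ρ → rowWeight (ℓ κ) (ℓ ρ) * G ρ)
           ≡⟨ cong (paths μ κ *_) (trans (∑-↭ (λ ρ → rowWeight (ℓ κ) (ℓ ρ) * G ρ) (above-suc μ n κ∈)) (∑-filter (κ ⊆?_) B (λ ρ → rowWeight (ℓ κ) (ℓ ρ) * G ρ))) ⟩
         paths μ κ * ∑ B (λ ρ → if does (κ ⊆? ρ) then rowWeight (ℓ κ) (ℓ ρ) * G ρ else 0ℚ)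
           ≡⟨ sym (∑-*ˡ B (paths μ κ) (λ ρ → if does (κ ⊆? ρ) then rowWeight (ℓ κ) (ℓ ρ) * G ρ else 0ℚ)) ⟩
         ∑ B (λ ρ → paths μ κ * (if does (κ ⊆? ρ) then rowWeight (ℓ κ) (ℓ ρ) * G ρ else 0ℚ)) ∎) ⟩
  ∑ A (λ κ → ∑ B (λ ρ → paths μ κ * (if does (κ ⊆? ρ) then rowWeight (ℓ κ) (ℓ ρ) * G ρ else 0ℚ)))
    ≡⟨ ∑-swap A B (λ κ ρ → paths μ κ * (if does (κ ⊆? ρ) then rowWeight (ℓ κ) (ℓ ρ) * G ρ else 0ℚ)) ⟩
  ∑ B (λ ρ → ∑ A (λ κ → paths μ κ * (if does (κ ⊆? ρ) then rowWeight (ℓ κ) (ℓ ρ) * G ρ else 0ℚ)))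
    ≡⟨ ∑-cong B (λ {ρ} ρ∈ → begin
         ∑ A (λ κ → paths μ κ * (if does (κ ⊆? ρ) then rowWeight (ℓ κ) (ℓ ρ) * G ρ else 0ℚ))
           ≡⟨ ∑-cong′ A (λ κ → pull (does (κ ⊆? ρ)) (paths μ κ) (rowWeight (ℓ κ) (ℓ ρ)) (G ρ)) ⟩
         ∑ A (λ κ → (if does (κ ⊆? ρ) then paths μ κ * rowWeight (ℓ κ) (ℓ ρ) else 0ℚ) * G ρ)
           ≡⟨ ∑-*ʳ A (G ρ) (λ κ → if does (κ ⊆? ρ) then paths μ κ * rowWeight (ℓ κ) (ℓ ρ) else 0ℚ) ⟩
         ∑ A (λ κ → if does (κ ⊆? ρ) then paths μ κ * rowWeight (ℓ κ) (ℓ ρ) else 0ℚ) * G ρ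
           ≡⟨ cong (_* G ρ) (trans (sym (∑-filter (_⊆? ρ) A (λ κ → paths μ κ * rowWeight (ℓ κ) (ℓ ρ)))) (paths-recursion μ n ρ∈)) ⟩
         paths μ ρ * G ρ ∎) ⟩
  weightedSum μ (suc n) G ∎)
  where
  A = above μ n
  B = above μ (suc n)
  pull : ∀ c p r g → p * (if c then r * g else 0ℚ) ≡ (if c then p * r else 0ℚ) * g
  pull true  p r g = sym (ℚ.*-assoc p r g)
  pull false p r g = trans (ℚ.*-zeroʳ p) (sym (ℚ.*-zeroˡ g))

-- Finite Newton series as polynomials in n

pascal : ∀ n k → fromℕ (suc n C suc k) ≡ fromℕ (n C k) + fromℕ (n C suc k)
pascal n k = trans (cong fromℕ (sym (Comb.nCk+nC[k+1]≡[n+1]C[k+1] n k))) (fromℕ-+ (n C k) (n C suc k))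

-- The starting index `k` is kept variable because the forward difference lowers it by one.
binomialSum : ℕ → List ℚ → ℕ → ℚ
binomialSum k []       n = 0ℚ
binomialSum k (c ∷ cs) n = c * fromℕ (n C k) + binomialSum (suc k) cs n

binomialSum-0 : ∀ k cs → binomialSum (suc k) cs 0 ≡ 0ℚ
binomialSum-0 k []       = refl
binomialSum-0 k (c ∷ cs) = cong₂ _+_ (ℚ.*-zeroʳ c) (binomialSum-0 (suc k) cs)

binomialSum-suc : ∀ k cs n → binomialSum (suc k) cs (suc n) ≡ binomialSum (suc k) cs n + binomialSum k cs n
binomialSum-suc k []       n = refl
binomialSum-suc k (c ∷ cs) n = begin
  c * fromℕ (suc n C suc k) + binomialSum (suc (suc k)) cs (suc n)
    ≡⟨ cong₂ (λ x y → c * x + y) (pascal n k) (binomialSum-suc (suc k) cs n) ⟩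
  c * (fromℕ (n C k) + fromℕ (n C suc k)) + (binomialSum (suc (suc k)) cs n + binomialSum (suc k) cs n)
    ≡⟨ solve 5 (λ c x y s t → c :* (x :+ y) :+ (s :+ t) := (c :* y :+ s) :+ (c :* x :+ t)) refl c (fromℕ (n C k)) (fromℕ (n C suc k)) _ _ ⟩
  (c * fromℕ (n C suc k) + binomialSum (suc (suc k)) cs n) + (c * fromℕ (n C k) + binomialSum (suc k) cs n) ∎

-- The forward difference in `n` is the application of `D`, so this is Newton's formula with the
-- sums at n = 0 for the iterates of `D` as coefficients.
weightedSum-binomial : ∀ μ r G → (∀ ρ → iterate D G r ρ ≡ 0ℚ) → ∃[ cs ] ∀ n → weightedSum μ n G ≡ binomialSum 0 cs n
weightedSum-binomial μ zero    G G≡0 = [] , λ n → trans (∑-cong′ (above μ n) (λ κ → trans (cong (paths μ κ *_) (G≡0 κ)) (ℚ.*-zeroʳ (paths μ κ)))) (∑-0 (above μ n))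
weightedSum-binomial μ (suc r) G DG≡0 = weightedSum μ 0 G ∷ cs , go
  where
  cs = proj₁ (weightedSum-binomial μ r (D G) DG≡0)
  go : ∀ n → weightedSum μ n G ≡ binomialSum 0 (weightedSum μ 0 G ∷ cs) n
  go zero    = sym (trans (cong₂ _+_ (ℚ.*-identityʳ (weightedSum μ 0 G)) (binomialSum-0 0 cs)) (ℚ.+-identityʳ (weightedSum μ 0 G)))
  go (suc n) = begin
    weightedSum μ (suc n) G
      ≡⟨ weightedSum-suc μ n G ⟩
    weightedSum μ n G + weightedSum μ n (D G)
      ≡⟨ cong₂ _+_ (go n) (proj₂ (weightedSum-binomial μ r (D G) DG≡0) n) ⟩
    weightedSum μ 0 G * 1ℚ + binomialSum 1 cs n + binomialSum 0 cs n
      ≡⟨ ℚ.+-assoc (weightedSum μ 0 G * 1ℚ) (binomialSum 1 cs n) (binomialSum 0 cs n) ⟩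
    weightedSum μ 0 G * 1ℚ + (binomialSum 1 cs n + binomialSum 0 cs n)
      ≡⟨ cong (weightedSum μ 0 G * 1ℚ +_) (sym (binomialSum-suc 0 cs n)) ⟩
    weightedSum μ 0 G * 1ℚ + binomialSum 1 cs (suc n) ∎

IsPolynomial : (ℕ → ℚ) → Set
IsPolynomial g = ∃[ p ] ∀ n → g n ≡ evalPoly p (fromℕ n)

polynomial-cong : ∀ {g h} → (∀ n → g n ≡ h n) → IsPolynomial h → IsPolynomial g
polynomial-cong e (p , eq) = p , λ n → trans (e n) (eq n)

polynomial-const : ∀ c → IsPolynomial (λ _ → c)
polynomial-const c = [ c ] , λ n → solve 2 (λ c x → c := c :+ x :* con 0ℚ) refl c (fromℕ n)

polynomial-x : ∀ {g} → IsPolynomial g → IsPolynomial (λ n → fromℕ n * g n)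
polynomial-x (p , eq) = 0ℚ ∷ p , λ n → trans (cong (fromℕ n *_) (eq n)) (sym (ℚ.+-identityˡ _))

polynomial-+ : ∀ {g h} → IsPolynomial g → IsPolynomial h → IsPolynomial (λ n → g n + h n)
polynomial-+ (p , eq) (p′ , eq′) = add p p′ , λ n → trans (cong₂ _+_ (eq n) (eq′ n)) (sym (evalPoly-add p p′ (fromℕ n)))
  where
  add : Polynomial → Polynomial → Polynomial
  add []       bs       = bs
  add (a ∷ as) []       = a ∷ as
  add (a ∷ as) (b ∷ bs) = (a + b) ∷ add as bs
  evalPoly-add : ∀ as bs x → evalPoly (add as bs) x ≡ evalPoly as x + evalPoly bs x
  evalPoly-add []       bs       x = sym (ℚ.+-identityˡ _)
  evalPoly-add (a ∷ as) []       x = sym (ℚ.+-identityʳ _)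
  evalPoly-add (a ∷ as) (b ∷ bs) x = trans (cong (λ v → a + b + x * v) (evalPoly-add as bs x))
    (solve 5 (λ a b x s t → a :+ b :+ x :* (s :+ t) := (a :+ x :* s) :+ (b :+ x :* t)) refl a b x (evalPoly as x) (evalPoly bs x))

polynomial-* : ∀ c {g} → IsPolynomial g → IsPolynomial (λ n → c * g n)
polynomial-* c (p , eq) = map (c *_) p , λ n → trans (cong (c *_) (eq n)) (sym (evalPoly-scale p (fromℕ n)))
  where
  evalPoly-scale : ∀ as x → evalPoly (map (c *_) as) x ≡ c * evalPoly as x
  evalPoly-scale []       x = sym (ℚ.*-zeroʳ c)
  evalPoly-scale (a ∷ as) x = trans (cong (λ v → c * a + x * v) (evalPoly-scale as x))
    (solve 4 (λ c a x s → c :* a :+ x :* (c :* s) := c :* (a :+ x :* s)) refl c a x (evalPoly as x))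

-- The subtraction-free form of (k + 1) C(n, k + 1) = (n - k) C(n, k), which gives the polynomial
-- for C(n, k + 1) from that for C(n, k).
binomial-absorption : ∀ n k → fromℕ (suc k) * fromℕ (n C suc k) + fromℕ k * fromℕ (n C k) ≡ fromℕ n * fromℕ (n C k)
binomial-absorption zero    zero    = refl
binomial-absorption zero    (suc k) = solve 2 (λ x y → x :* con 0ℚ :+ y :* con 0ℚ := con 0ℚ :* con 0ℚ) refl (fromℕ (suc (suc k))) (fromℕ (suc k))
binomial-absorption (suc n) zero    = trans (cong (λ m → 1ℚ * fromℕ m + 0ℚ * 1ℚ) (Comb.nC1≡n (suc n)))
  (solve 1 (λ x → con 1ℚ :* x :+ con 0ℚ :* con 1ℚ := x :* con 1ℚ) refl (fromℕ (suc n)))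
binomial-absorption (suc n) (suc k) = begin
  fromℕ (suc (suc k)) * fromℕ (suc n C suc (suc k)) + fromℕ (suc k) * fromℕ (suc n C suc k)
    ≡⟨ cong₂ _+_ (cong₂ _*_ (fromℕ-suc (suc k)) (pascal n (suc k))) (cong₂ _*_ (fromℕ-suc k) (pascal n k)) ⟩
  (1ℚ + fromℕ (suc k)) * (y + u) + (1ℚ + K) * (x + y)
    ≡⟨ cong (λ s → (1ℚ + s) * (y + u) + (1ℚ + K) * (x + y)) (fromℕ-suc k) ⟩
  (1ℚ + (1ℚ + K)) * (y + u) + (1ℚ + K) * (x + y)
    ≡⟨ solve 4 (λ K x y u → (con 1ℚ :+ (con 1ℚ :+ K)) :* (y :+ u) :+ (con 1ℚ :+ K) :* (x :+ y)
         := ((con 1ℚ :+ (con 1ℚ :+ K)) :* u :+ (con 1ℚ :+ K) :* y) :+ ((con 1ℚ :+ K) :* y :+ K :* x) :+ (x :+ y)) refl K x y u ⟩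
  ((1ℚ + (1ℚ + K)) * u + (1ℚ + K) * y) + ((1ℚ + K) * y + K * x) + (x + y)
    ≡⟨ cong₂ (λ s t → s + t + (x + y)) ih₂ ih₁ ⟩
  fromℕ n * y + fromℕ n * x + (x + y)
    ≡⟨ solve 3 (λ n x y → n :* y :+ n :* x :+ (x :+ y) := (con 1ℚ :+ n) :* (x :+ y)) refl (fromℕ n) x y ⟩
  (1ℚ + fromℕ n) * (x + y)
    ≡⟨ cong₂ _*_ (fromℕ-suc n) (pascal n k) ⟨
  fromℕ (suc n) * fromℕ (suc n C suc k) ∎
  where
  K = fromℕ k
  x = fromℕ (n C k)
  y = fromℕ (n C suc k)
  u = fromℕ (n C suc (suc k))
  ih₁ : (1ℚ + K) * y + K * x ≡ fromℕ n * x
  ih₁ = trans (cong (λ s → s * y + K * x) (sym (fromℕ-suc k))) (binomial-absorption n k)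
  ih₂ : (1ℚ + (1ℚ + K)) * u + (1ℚ + K) * y ≡ fromℕ n * y
  ih₂ = trans (cong₂ (λ s t → s * u + t * y) (sym (trans (fromℕ-suc (suc k)) (cong (1ℚ +_) (fromℕ-suc k)))) (sym (fromℕ-suc k)))
    (binomial-absorption n (suc k))

polynomial-binomial : ∀ k → IsPolynomial (λ n → fromℕ (n C k))
polynomial-binomial zero    = polynomial-const 1ℚ
polynomial-binomial (suc k) = polynomial-cong eq (polynomial-* (inv S)
  (polynomial-+ (polynomial-x (polynomial-binomial k)) (polynomial-* (- fromℕ k) (polynomial-binomial k))))
  where
  S = fromℕ (suc k)
  eq : ∀ n → fromℕ (n C suc k) ≡ inv S * (fromℕ n * fromℕ (n C k) + - fromℕ k * fromℕ (n C k))
  eq n = *-cancel (fromℕ-≢0 {suc k} (s≤s z≤n)) (begin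
    S * y
      ≡⟨ solve 3 (λ t K x → t := (t :+ K :* x) :+ (:- K) :* x) refl (S * y) (fromℕ k) x ⟩
    S * y + fromℕ k * x + - fromℕ k * x
      ≡⟨ cong (_+ - fromℕ k * x) (binomial-absorption n k) ⟩
    fromℕ n * x + - fromℕ k * x
      ≡⟨ ℚ.*-identityˡ _ ⟨
    1ℚ * (fromℕ n * x + - fromℕ k * x)
      ≡⟨ cong (_* (fromℕ n * x + - fromℕ k * x)) (inv-inverse (fromℕ-≢0 {suc k} (s≤s z≤n))) ⟨
    S * inv S * (fromℕ n * x + - fromℕ k * x)
      ≡⟨ ℚ.*-assoc S (inv S) _ ⟩
    S * (inv S * (fromℕ n * x + - fromℕ k * x)) ∎)
    where
    x = fromℕ (n C k)
    y = fromℕ (n C suc k)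

polynomial-binomialSum : ∀ k cs → IsPolynomial (binomialSum k cs)
polynomial-binomialSum k []       = polynomial-const 0ℚ
polynomial-binomialSum k (c ∷ cs) = polynomial-+ (polynomial-* c (polynomial-binomial k)) (polynomial-binomialSum (suc k) cs)

-- Assembly of both claims

evaluate-weighted : ∀ Q → ∃[ d ] Weighted d (λ as → evaluate Q (contentValues as))
evaluate-weighted Q = _ , ext (λ as _ → sym (evaluate≡expand Q (contentValues as)))
  -- A leading zero exponent is moved to the end by symmetry, where `trailing` removes it.
  (contents degree degree coeff symmetric (λ α → trans (symmetric (Perm.++-comm [ 0 ] α)) (trailing α)) bounded)
  where open SymmetricFunction Q

atContents≡ : ∀ Q ρ → atContents Q ρ ≡ evaluate Q (contentValues (parts ρ))
atContents≡ Q ρ = cong (evaluate Q) (begin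
  map (λ b → content b C 2) (diagram ρ) ≡⟨ List.map-∘ (diagram ρ) ⟩
  map (_C 2) (map content (diagram ρ)) ≡⟨ cong (map (_C 2) ∘ map content) (diagram≡boxes ρ) ⟩
  map (_C 2) (map content (boxes (parts ρ))) ≡⟨ cong (map (_C 2)) (contents-boxes (parts ρ)) ⟩
  contentValues (parts ρ)                        ∎)

powers-weighted : ∀ ks → Weighted (sum ks) (λ as → ∏ ks (powerDifference as))
powers-weighted []       = const 1ℚ
powers-weighted (k ∷ ks) = powers k ⊗ powers-weighted ks

-- The parts of ν are positive, so the exceptional exponent 0 does not occur; the irrelevant proof
-- is recovered by deciding positivity again.
qᵖ≡ : ∀ ν ρ → qᵖ ν ρ ≡ ∏ (Partition.parts ν) (powerDifference (parts ρ))
qᵖ≡ (mkPartition ks _ pos) ρ = go (recompute (All.all? (0 ℕ.<?_) ks) pos)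
  where
  go : ∀ {ks} → All (0 <_) ks → ∏ ks (λ k → q k ρ) ≡ ∏ ks (powerDifference (parts ρ))
  go []                   = refl
  go (s≤s {n = k} _ ∷ pos) = cong₂ _*_ (q≡powerDifference k ρ) (go pos)

theorem4p1 : (ν : Partition) (μ : StrictPartition) (Q : SymmetricFunction) →
    (∃[ r ] (∀ (ρ : StrictPartition) → iterate D (λ κ → (atContents Q κ * qᵖ ν κ) /H κ) r ρ ≡ 0ℚ))
    × (∃[ p ] (∀ (n : ℕ) → P ν μ Q n ≡ evalPoly p (fromℕ n)))
theorem4p1 ν μ Q = (suc d , nilpotent) , polynomial-cong P≡ (polynomial-cong (proj₂ binomial) (polynomial-binomialSum 0 (proj₁ binomial)))
  where
  G : StrictPartition → ℚ
  G κ = (atContents Q κ * qᵖ ν κ) /H κ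
  F : List ℕ → ℚ
  F as = evaluate Q (contentValues as) * ∏ (Partition.parts ν) (powerDifference as)
  d = proj₁ (evaluate-weighted Q) ℕ.+ sum (Partition.parts ν)
  G≡ : ∀ ρ → G ρ ≡ 1/hooks (parts ρ) * F (parts ρ)
  G≡ ρ = trans (/H≡1/hooks (atContents Q ρ * qᵖ ν ρ) ρ)
    (trans (cong (_* 1/hooks (parts ρ)) (cong₂ _*_ (atContents≡ Q ρ) (qᵖ≡ ν ρ))) (ℚ.*-comm (F (parts ρ)) (1/hooks (parts ρ))))
  nilpotent : ∀ ρ → iterate D G (suc d) ρ ≡ 0ℚ
  nilpotent = D-nilpotent (proj₂ (evaluate-weighted Q) ⊗ powers-weighted (Partition.parts ν)) G≡
  binomial = weightedSum-binomial μ (suc d) G nilpotent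
  P≡ : ∀ n → P ν μ Q n ≡ weightedSum μ n G
  P≡ n = ∑-cong′ (above μ n) (λ ρ → solve 4 (λ p h a b → p :* h :* a :* b := p :* (a :* b :* h)) refl
    (paths μ ρ) _ (atContents Q ρ) (qᵖ ν ρ))
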